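{- (Fundamental Lemma.) Let $F$ be a non-archimedean local field of arbitrary characteristic, $E/F$ an unramified separable quadratic algebra (the unramified quadratic field extension, or $F\oplus F$), $\mathcal E=\{T_{E/F},\varepsilon_{E/F}\}$, $\kappa=\varepsilon_{E/F}$, and let $f$ be the characteristic function of $K=SL(2,\mathfrak O_F)$. With transfer factor normalized by the constant $1$, $$t\mapsto f^{\mathcal E}(t)=\Delta^{\mathcal E}(t)\,\mathcal O^\kappa(t,f)$$ (defined for regular $t$ and extended smoothly to $T_{E/F}(F)$) is the characteristic function of $T_{E/F}(\mathfrak O_F)=\mathfrak O_E^1$, the subgroup of elements of norm $1$ in $\mathfrak O_E^\times$.
   Context: $F$ is a non-archimedean local field with ring of integers $\mathfrak O_F$ and normalized absolute value $|\cdot|_F$. $\mathfrak O_E$ is the ring of integers of $E$ ($\mathfrak O_F\oplus\mathfrak O_F$ if $E=F\oplus F$); $x\mapsto\overline x$ is the nontrivial $F$-automorphism of $E$, $N_{E/F}(x)=x\overline x$, and $|x|:=|N_{E/F}(x)|_F^{1/2}$ on $E^\times$. $\varepsilon_{E/F}:F^\times\to\{\pm1\}$ is the character with kernel $N_{E/F}E^\times$. Choose $\tau\in E^\times$ with $\mathfrak O_E=\mathfrak O_F\oplus\mathfrak O_F\tau$. Multiplication on $E$ in the basis $\{1,\tau\}$ embeds $E^\times$ in $GL(2,F)$ with image $\widetilde T(F)$; $T_{E/F}(F)=\widetilde T(F)\cap SL(2,F)$ is the group of norm-one elements of $E^\times$. For $t\ne\pm1$ in $T_{E/F}(F)$, corresponding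 to $\gamma=a+b\tau$, $$\mathcal O^\kappa(t,f)=\int_{\widetilde T(F)\backslash GL(2,F)}\kappa(\det x)f(x^{ -1}tx)\,dx,\qquad \Delta^{\mathcal E}(t)=\varepsilon_{E/F}\Big(\frac{\gamma-\overline\gamma}{\tau-\overline\tau}\Big)|\gamma-\overline\gamma|.$$ The measure on $\widetilde T(F)\backslash GL(2,F)$ is the right-invariant one extending the quotient measure on the open subset $T_{E/F}(F)\backslash SL(2,F)$, for the Haar measures giving volume $1$ to $SL(2,\mathfrak O_F)$ and to $T_{E/F}(\mathfrak O_F)$. -}

module Defs where

open import Level using (0ℓ)
open import Algebra.Bundles using (CommutativeRing)
open import Algebra.Construct.DirectProduct using () renaming (commutativeRing to _×ᴿ_)
open import Algebra.Morphism.Structures using (module RingMorphisms)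
open import Axiom.ExcludedMiddle using (ExcludedMiddle)
open import Data.Bool.Base using (if_then_else_)
open import Data.Fin.Base using (Fin)
open import Data.Integer.Base using (+_)
open import Data.List.Base using (List; []; _∷_)
open import Data.List.Relation.Unary.All using (All)
open import Data.List.Relation.Unary.Any using (Any)
open import Data.Nat.Base as ℕ using (ℕ)
open import Data.Product.Base using (Σ; ∃; ∃₂; _×_; _,_; proj₁; proj₂)
open import Data.Rational.Base as ℚ using (ℚ; 0ℚ; 1ℚ)
open import Data.Sign.Base as Sign using (Sign)
open import Data.Sum.Base using (_⊎_)
open import Function.Bundles using (_⇔_)
open import Relation.Binary.PropositionalEquality.Core using (_≡_; _≢_)
open import Relation.Nullary using (¬_; does)
open import Relation.Unary using (Pred)
import Algebra.Definitions as AlgebraDefinitions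
import Algebra.Properties.AbelianGroup as AbelianGroupProperties
import Algebra.Properties.Ring as RingProperties
import Algebra.Solver.Ring.NaturalCoefficients.Default as SemiringSolver
import Relation.Binary.Reasoning.Setoid as SetoidReasoning

-- The subsets of interest are not decidable constructively; excluded middle is
-- carried as an explicit hypothesis.
indicator : ExcludedMiddle 0ℓ → {A : Set} → Pred A 0ℓ → A → ℚ
indicator lem P x = if does (lem {P x}) then 1ℚ else 0ℚ

signℚ : Sign → ℚ
signℚ Sign.+ = 1ℚ
signℚ Sign.- = ℚ.- 1ℚ

IsField : CommutativeRing 0ℓ 0ℓ → Set
IsField R = ¬ (1# ≈ 0#) × (∀ x → ¬ (x ≈ 0#) → Invertible 1# _*_ x)
  where open CommutativeRing R
        open AlgebraDefinitions _≈_ using (Invertible)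

record LocalField : Set₁ where
  field
    commRing : CommutativeRing 0ℓ 0ℓ
    isField  : IsField commRing

  open CommutativeRing commRing public

  field
    ∣_∣            : Carrier → ℚ
    ∣∣-cong        : ∀ {x y} → x ≈ y → ∣ x ∣ ≡ ∣ y ∣
    ∣∣-nonneg      : ∀ x → 0ℚ ℚ.≤ ∣ x ∣
    ∣∣-definite    : ∀ x → ∣ x ∣ ≡ 0ℚ ⇔ x ≈ 0#
    ∣∣-mult        : ∀ x y → ∣ x * y ∣ ≡ ∣ x ∣ ℚ.* ∣ y ∣
    ∣∣-ultrametric : ∀ x y → ∣ x + y ∣ ℚ.≤ ∣ x ∣ ℚ.⊔ ∣ y ∣

  Cauchy : (ℕ → Carrier) → Set
  Cauchy u = ∀ δ → 0ℚ ℚ.< δ → ∃ λ N → ∀ m n → N ℕ.≤ m → N ℕ.≤ n → ∣ u m - u n ∣ ℚ.< δ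

  _⟶_ : (ℕ → Carrier) → Carrier → Set
  u ⟶ l = ∀ δ → 0ℚ ℚ.< δ → ∃ λ N → ∀ n → N ℕ.≤ n → ∣ u n - l ∣ ℚ.< δ

  𝔒 : Pred Carrier 0ℓ
  𝔒 x = ∣ x ∣ ℚ.≤ 1ℚ

  field
    complete : ∀ u → Cauchy u → ∃ λ l → u ⟶ l

    -- Representatives of the q residue classes of 𝔒 modulo its maximal ideal.
    q              : ℕ
    residue        : Fin q → Carrier
    residue-𝔒      : ∀ i → 𝔒 (residue i)
    residue-covers : ∀ x → 𝔒 x → ∃ λ i → ∣ x - residue i ∣ ℚ.< 1ℚ
    residue-unique : ∀ i j → ∣ residue i - residue j ∣ ℚ.< 1ℚ → i ≡ j

    -- The valuation is discrete with uniformizer ϖ, and ∣ϖ∣ = q⁻¹.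
    ϖ           : Carrier
    ϖ-generates : ∀ x → ∣ x ∣ ℚ.< 1ℚ → ∣ x ∣ ℚ.≤ ∣ ϖ ∣
    normalized  : ∣ ϖ ∣ ℚ.* ((+ q) ℚ./ 1) ≡ 1ℚ

  Fˣ : Set
  Fˣ = Σ Carrier λ x → ¬ (x ≈ 0#)

  inv : Fˣ → Carrier
  inv (x , x≉0) = proj₁ (proj₂ isField x x≉0)

  inv-left : ∀ x → inv x * proj₁ x ≈ 1#
  inv-left (x , x≉0) = proj₁ (proj₂ (proj₂ isField x x≉0))

  abstract
    *-nonzero : ∀ x y → ¬ (x ≈ 0#) → ¬ (y ≈ 0#) → ¬ (x * y ≈ 0#)
    *-nonzero x y x≉0 y≉0 xy≈0 = y≉0 (begin
      y                          ≈⟨ *-identityˡ y ⟨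
      1# * y                     ≈⟨ *-congʳ (inv-left (x , x≉0)) ⟨
      (inv (x , x≉0) * x) * y    ≈⟨ *-assoc _ x y ⟩
      inv (x , x≉0) * (x * y)    ≈⟨ *-congˡ xy≈0 ⟩
      inv (x , x≉0) * 0#         ≈⟨ zeroʳ _ ⟩
      0#                         ∎)
      where open SetoidReasoning setoid

  _*ˣ_ : Fˣ → Fˣ → Fˣ
  (x , x≉0) *ˣ (y , y≉0) = x * y , *-nonzero x y x≉0 y≉0

record QuadraticAlgebra (F : LocalField) : Set₁ where
  private module F = LocalField F
  field
    commRing : CommutativeRing 0ℓ 0ℓ

  open CommutativeRing commRing public
  open AlgebraDefinitions _≈_ using (Invertible)
  open RingMorphisms

  field
    ι      : F.Carrier → Carrier
    ι-homo : IsRingHomomorphism F.rawRing rawRing ι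

    e₁ e₂       : Carrier
    spanning    : ∀ x → ∃₂ λ a b → x ≈ ι a * e₁ + ι b * e₂
    independent : ∀ a b → ι a * e₁ + ι b * e₂ ≈ 0# → (a F.≈ F.0#) × (b F.≈ F.0#)

    conj            : Carrier → Carrier
    conj-iso        : IsRingIsomorphism rawRing rawRing conj
    conj-fixes-F    : ∀ a → conj (ι a) ≈ ι a
    conj-nontrivial : ∃ λ x → ¬ (conj x ≈ x)

  IsUnit : Pred Carrier 0ℓ
  IsUnit = Invertible 1# _*_

  -- N_{E/F}(x) = a
  HasNorm : Carrier → F.Carrier → Set
  HasNorm x a = ι a ≈ x * conj x

  -- ∣x∣ = r, where ∣x∣ is the square root of the absolute value of the norm
  HasAbs : Carrier → ℚ → Set
  HasAbs x r = (0ℚ ℚ.≤ r) × ∃ λ a → HasNorm x a × (r ℚ.* r ≡ F.∣ a ∣)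

  -- [c₀ , … , cₙ₋₁] stands for c₀ + c₁X + … + cₙ₋₁Xⁿ⁻¹ + Xⁿ.
  evalMonic : List F.Carrier → Carrier → Carrier
  evalMonic []       x = 1#
  evalMonic (c ∷ cs) x = ι c + x * evalMonic cs x

  -- The integral closure of 𝔒_F in E; it is 𝔒_F ⊕ 𝔒_F when E = F ⊕ F.
  𝔒ᴱ : Pred Carrier 0ℓ
  𝔒ᴱ x = ∃ λ cs → All F.𝔒 cs × (evalMonic cs x ≈ 0#)

  𝔒ᴱ-unit : Pred Carrier 0ℓ
  𝔒ᴱ-unit x = 𝔒ᴱ x × ∃ λ y → 𝔒ᴱ y × (x * y ≈ 1#)

  𝔒ᴱ¹ : Pred Carrier 0ℓ
  𝔒ᴱ¹ x = 𝔒ᴱ-unit x × HasNorm x F.1#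

  -- 𝔒_E = 𝔒_F ⊕ 𝔒_F τ with τ ∈ Eˣ
  record IsIntegralGenerator (τ : Carrier) : Set where
    field
      unit   : IsUnit τ
      sum    : ∀ x → 𝔒ᴱ x ⇔ (∃₂ λ a b → F.𝔒 a × F.𝔒 b × (x ≈ ι a + ι b * τ))
      direct : ∀ a b → F.𝔒 a → F.𝔒 b → ι a + ι b * τ ≈ 0# → (a F.≈ F.0#) × (b F.≈ F.0#)

  -- Separability is stated for the minimal polynomial X² + sX + n of an
  -- element outside F; unramifiedness says that ϖ generates the maximal ideal
  -- of 𝔒_E (the residue field is finite, so its extension is separable).
  record IsUnramifiedField : Set where
    field
      isField    : IsField commRing
      separable  : ∀ x s n → ¬ (∃ λ a → x ≈ ι a) → x * x + ι s * x + ι n ≈ 0# →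
                   ¬ (x + x + ι s ≈ 0#)
      unramified : ∀ x → 𝔒ᴱ x → 𝔒ᴱ-unit x ⊎ (∃ λ y → 𝔒ᴱ y × (x ≈ ι F.ϖ * y))

  record IsSplit : Set where
    field
      φ   : Carrier → F.Carrier × F.Carrier
      iso : IsRingIsomorphism rawRing (CommutativeRing.rawRing (F.commRing ×ᴿ F.commRing)) φ
      diagonal : ∀ a → (proj₁ (φ (ι a)) F.≈ a) × (proj₂ (φ (ι a)) F.≈ a)

  Unramified : Set
  Unramified = IsUnramifiedField ⊎ IsSplit

  record IsNormCharacter (ε : F.Fˣ → Sign) : Set where
    field
      cong   : ∀ x y → proj₁ x F.≈ proj₁ y → ε x ≡ ε y
      homo   : ∀ x y → ε (x F.*ˣ y) ≡ ε x Sign.* ε y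
      kernel : ∀ x → ε x ≡ Sign.+ ⇔ (∃ λ y → IsUnit y × HasNorm y (proj₁ x))

-- All spaces below are locally compact and
-- totally disconnected, so a Radon measure amounts to a positive linear
-- functional on locally constant functions of compact support.  The Haar
-- measures in question give rational volume to compact open sets, so rational
-- scalars suffice.

record Space : Set₁ where
  field
    Pt     : Set
    IsOpen : Pred Pt 0ℓ → Set

-- Points of Γ \ X are represented by points of X; the opens of the quotient
-- topology are the Γ-stable opens of X.
quotient : (X : Space) (Γ : Set) → (Γ → Space.Pt X → Space.Pt X) → Space
quotient X Γ _·_ = record
  { Pt     = Pt
  ; IsOpen = λ U → IsOpen U × (∀ γ x → U x ⇔ U (γ · x))
  }
  where open Space X

module _ (X : Space) where
  open Space X

  LocallyConstant : (Pt → ℚ) → Set₁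
  LocallyConstant f = ∀ x → Σ (Pred Pt 0ℓ) λ U →
    IsOpen U × U x × (∀ y → U y → f y ≡ f x)

  Compact : Pred Pt 0ℓ → Set₁
  Compact C = (I : Set) (U : I → Pred Pt 0ℓ) → (∀ i → IsOpen (U i)) →
    (∀ x → C x → ∃ λ i → U i x) →
    ∃ λ is → ∀ x → C x → Any (λ i → U i x) is

  -- The support of a locally constant f is { x : f x ≠ 0 }, without closure.
  record TestFunction : Set₁ where
    constructor test
    field
      fun     : Pt → ℚ
      locally : LocallyConstant fun
      support : Compact (λ x → fun x ≢ 0ℚ)

  open TestFunction

  record Measure : Set₁ where
    field
      ∫           : TestFunction → ℚ
      additive    : ∀ φ ψ χ → (∀ x → fun χ x ≡ fun φ x ℚ.+ fun ψ x) → ∫ χ ≡ ∫ φ ℚ.+ ∫ ψ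
      homogeneous : ∀ c φ χ → (∀ x → fun χ x ≡ c ℚ.* fun φ x) → ∫ χ ≡ c ℚ.* ∫ φ
      positive    : ∀ φ → (∀ x → 0ℚ ℚ.≤ fun φ x) → 0ℚ ℚ.≤ ∫ φ

-- f is locally constant of compact support, and its integral is v.
HasIntegral : (X : Space) → Measure X → (Space.Pt X → ℚ) → ℚ → Set₁
HasIntegral X μ f v =
  Σ (LocallyConstant X f) λ l → Σ (Compact X (λ x → f x ≢ 0ℚ)) λ c → Measure.∫ μ (test f l c) ≡ v

LeftInvariant : (X : Space) → (Space.Pt X → Space.Pt X → Space.Pt X) → Measure X → Set₁
LeftInvariant X _·_ μ = ∀ g φ ψ → (∀ x → fun ψ x ≡ fun φ (g · x)) → ∫ ψ ≡ ∫ φ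
  where open Measure μ
        open TestFunction

RightInvariant : (X : Space) → (Space.Pt X → Space.Pt X → Space.Pt X) → Measure X → Set₁
RightInvariant X _·_ μ = ∀ g φ ψ → (∀ x → fun ψ x ≡ fun φ (x · g)) → ∫ ψ ≡ ∫ φ
  where open Measure μ
        open TestFunction

module RingIdentities (R : CommutativeRing 0ℓ 0ℓ) where
  open CommutativeRing R
  private
    open SetoidReasoning setoid
    open SemiringSolver commutativeSemiring using (solve; _:+_; _:*_; _:=_)
    open RingProperties ring
      using (-‿distribˡ-*; -‿distribʳ-*; -‿involutive)
    open AbelianGroupProperties +-abelianGroup using (⁻¹-∙-comm)

    move : ∀ {p q r s} → p + s ≈ q + r → p - q ≈ r - s
    move {p} {q} {r} {s} e = begin
      p - q                  ≈⟨ +-congʳ (+-identityʳ p) ⟨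
      (p + 0#) - q           ≈⟨ +-congʳ (+-congˡ (-‿inverseʳ s)) ⟨
      (p + (s - s)) - q      ≈⟨ +-congʳ (+-assoc p s (- s)) ⟨
      ((p + s) - s) - q      ≈⟨ +-congʳ (+-congʳ e) ⟩
      ((q + r) - s) - q      ≈⟨ solve 4 (λ q r s' q' → ((q :+ r) :+ s') :+ q' := (q :+ q') :+ (r :+ s')) refl q r (- s) (- q) ⟩
      (q - q) + (r - s)      ≈⟨ +-congʳ (-‿inverseʳ q) ⟩
      0# + (r - s)           ≈⟨ +-identityˡ _ ⟩
      r - s                  ∎

    neg² : ∀ x z → - x * - z ≈ x * z
    neg² x z = begin
      - x * - z     ≈⟨ -‿distribˡ-* x (- z) ⟨
      - (x * - z)   ≈⟨ -‿cong (-‿distribʳ-* x z) ⟨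
      - - (x * z)   ≈⟨ -‿involutive _ ⟩
      x * z         ∎

    expand : ∀ w x y z → (w - x) * (y - z) ≈ (w * y + x * z) - (w * z + x * y)
    expand w x y z = begin
      (w - x) * (y - z)
        ≈⟨ solve 4 (λ w x' y z' → (w :+ x') :* (y :+ z') := (w :* y :+ x' :* z') :+ (w :* z' :+ x' :* y)) refl w (- x) y (- z) ⟩
      (w * y + - x * - z) + (w * - z + - x * y)
        ≈⟨ +-cong (+-congˡ (neg² x z)) (+-cong (sym (-‿distribʳ-* w z)) (sym (-‿distribˡ-* x y))) ⟩
      (w * y + x * z) + (- (w * z) + - (x * y))
        ≈⟨ +-congˡ (⁻¹-∙-comm (w * z) (x * y)) ⟩
      (w * y + x * z) - (w * z + x * y) ∎

    cross : ∀ u v w z → (u + v) * (w + z) ≈ ((u * w + u * z) + v * w) + v * z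
    cross = solve 4 (λ u v w z → (u :+ v) :* (w :+ z) := ((u :* w :+ u :* z) :+ v :* w) :+ v :* z) refl

    swap : ∀ u v w z → (u * v) * (w * z) ≈ (u * z) * (w * v)
    swap = solve 4 (λ u v w z → (u :* v) :* (w :* z) := (u :* z) :* (w :* v)) refl

    regroup : ∀ u v w z → (u * v) * (w * z) ≈ (u * w) * (v * z)
    regroup = solve 4 (λ u v w z → (u :* v) :* (w :* z) := (u :* w) :* (v :* z)) refl

    permute : ∀ p q r s u v → (((p + q) + r) + s) + (u + v) ≈ (((p + u) + v) + s) + (q + r)
    permute = solve 6 (λ p q r s u v →
      (((p :+ q) :+ r) :+ s) :+ (u :+ v) := (((p :+ u) :+ v) :+ s) :+ (q :+ r)) refl

  det-product : ∀ a b c d e f g h →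
    (a * e + b * g) * (c * f + d * h) - (a * f + b * h) * (c * e + d * g) ≈
    (a * d - b * c) * (e * h - f * g)
  det-product a b c d e f g h = trans (move (begin
    (a * e + b * g) * (c * f + d * h) + ((a * d) * (f * g) + (b * c) * (e * h))
      ≈⟨ +-congʳ (cross (a * e) (b * g) (c * f) (d * h)) ⟩
    ((((a * e) * (c * f) + (a * e) * (d * h)) + (b * g) * (c * f)) + (b * g) * (d * h)) + ((a * d) * (f * g) + (b * c) * (e * h))
      ≈⟨ permute _ _ _ _ _ _ ⟩
    ((((a * e) * (c * f) + (a * d) * (f * g)) + (b * c) * (e * h)) + (b * g) * (d * h)) + ((a * e) * (d * h) + (b * g) * (c * f))
      ≈⟨ +-cong (+-cong (+-cong (+-cong (swap a e c f) (regroup a d f g)) (trans (regroup b c e h) (swap b e c h)))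
                        (swap b g d h))
                (+-cong (regroup a e d h) (trans (regroup b g c f) (*-congˡ (*-comm g f)))) ⟩
    ((((a * f) * (c * e) + (a * f) * (d * g)) + (b * h) * (c * e)) + (b * h) * (d * g)) + ((a * d) * (e * h) + (b * c) * (f * g))
      ≈⟨ +-congʳ (cross (a * f) (b * h) (c * e) (d * g)) ⟨
    (a * f + b * h) * (c * e + d * g) + ((a * d) * (e * h) + (b * c) * (f * g)) ∎))
    (sym (expand (a * d) (b * c) (e * h) (f * g)))

  det-adjugate : ∀ a b c d k → k * (a * d - b * c) ≈ 1# →
    ((k * d) * (k * a) - (k * - b) * (k * - c)) * (a * d - b * c) ≈ 1#
  det-adjugate a b c d k kD≈1 = begin
    ((k * d) * (k * a) - (k * - b) * (k * - c)) * D
      ≈⟨ *-congʳ (+-cong (trans (regroup k d k a) (*-congˡ (*-comm d a)))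
                         (-‿cong (trans (regroup k (- b) k (- c)) (*-congˡ (neg² b c))))) ⟩
    ((k * k) * (a * d) - (k * k) * (b * c)) * D
      ≈⟨ *-congʳ (+-congˡ (-‿distribʳ-* (k * k) (b * c))) ⟩
    ((k * k) * (a * d) + (k * k) * - (b * c)) * D
      ≈⟨ *-congʳ (distribˡ (k * k) _ _) ⟨
    ((k * k) * D) * D    ≈⟨ *-assoc (k * k) D D ⟩
    (k * k) * (D * D)    ≈⟨ regroup k k D D ⟩
    (k * D) * (k * D)    ≈⟨ *-cong kD≈1 kD≈1 ⟩
    1# * 1#              ≈⟨ *-identityˡ 1# ⟩
    1#                   ∎
    where D = a * d - b * c

  columns : ∀ a b c d e g t →
    (a * e + b * g) + (c * e + d * g) * t ≈ (a + c * t) * e + (b + d * t) * g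
  columns = solve 7 (λ a b c d e g t →
    (a :* e :+ b :* g) :+ (c :* e :+ d :* g) :* t
    := (a :+ c :* t) :* e :+ (b :+ d :* t) :* g) refl

  factor : ∀ γ t x y → γ * x + (γ * t) * y ≈ γ * (x + y * t)
  factor = solve 4 (λ γ t x y → γ :* x :+ (γ :* t) :* y := γ :* (x :+ y :* t)) refl

  interchange : ∀ u v w z → (u * v) * (w * z) ≈ (u * w) * (v * z)
  interchange = regroup

module Matrices (F : LocalField) where
  open LocalField F

  record Mat : Set where
    constructor mat
    field
      m₁₁ m₁₂ m₂₁ m₂₂ : Carrier

  open Mat public

  _≈ᴹ_ : Mat → Mat → Set
  A ≈ᴹ B = (m₁₁ A ≈ m₁₁ B) × (m₁₂ A ≈ m₁₂ B) × (m₂₁ A ≈ m₂₁ B) × (m₂₂ A ≈ m₂₂ B)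

  _·_ : Mat → Mat → Mat
  A · B = mat (m₁₁ A * m₁₁ B + m₁₂ A * m₂₁ B) (m₁₁ A * m₁₂ B + m₁₂ A * m₂₂ B)
              (m₂₁ A * m₁₁ B + m₂₂ A * m₂₁ B) (m₂₁ A * m₁₂ B + m₂₂ A * m₂₂ B)

  det : Mat → Carrier
  det A = m₁₁ A * m₂₂ A - m₁₂ A * m₂₁ A

  scalar : Carrier → Mat
  scalar c = mat c 0# 0# c

  Integral : Pred Mat 0ℓ
  Integral A = 𝔒 (m₁₁ A) × 𝔒 (m₁₂ A) × 𝔒 (m₂₁ A) × 𝔒 (m₂₂ A)

  Close : ℚ → Mat → Mat → Set
  Close δ A B = (∣ m₁₁ A - m₁₁ B ∣ ℚ.< δ) × (∣ m₁₂ A - m₁₂ B ∣ ℚ.< δ) ×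
                (∣ m₂₁ A - m₂₁ B ∣ ℚ.< δ) × (∣ m₂₂ A - m₂₂ B ∣ ℚ.< δ)

  -- The topology induced from the matrix entries.  For GL(2,F) it is the usual
  -- one, inversion being continuous where det ≠ 0.
  subspace : (A : Set) → (A → Mat) → Space
  subspace A entries = record
    { Pt     = A
    ; IsOpen = λ U → ∀ x → U x →
        ∃ λ δ → (0ℚ ℚ.< δ) × (∀ y → Close δ (entries x) (entries y) → U y)
    }

  private module RI = RingIdentities commRing

  abstract
    det-· : ∀ A B → det (A · B) ≈ det A * det B
    det-· (mat a b c d) (mat e f g h) = RI.det-product a b c d e f g h

  GL₂ : Set
  GL₂ = Σ Mat λ A → ¬ (det A ≈ 0#)

  SL₂ : Set
  SL₂ = Σ Mat λ A → det A ≈ 1#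

  detᴳ : GL₂ → Fˣ
  detᴳ (A , d) = det A , d

  inverse : GL₂ → Mat
  inverse (mat a b c d , p) = mat (k * d) (k * - b) (k * - c) (k * a)
    where k = inv (det (mat a b c d) , p)

  abstract
    ·-nonzero : ∀ A B → ¬ (det A ≈ 0#) → ¬ (det B ≈ 0#) → ¬ (det (A · B) ≈ 0#)
    ·-nonzero A B dA dB e = *-nonzero (det A) (det B) dA dB (trans (sym (det-· A B)) e)

    ·-one : ∀ A B → det A ≈ 1# → det B ≈ 1# → det (A · B) ≈ 1#
    ·-one A B dA dB = trans (det-· A B) (trans (*-cong dA dB) (*-identityˡ 1#))

    one-nonzero : ∀ A → det A ≈ 1# → ¬ (det A ≈ 0#)
    one-nonzero A dA e = proj₁ isField (trans (sym dA) e)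

    det-inverse : ∀ x → det (inverse x) * det (proj₁ x) ≈ 1#
    det-inverse (mat a b c d , p) = RI.det-adjugate a b c d _ (inv-left (det (mat a b c d) , p))

    det-conjugate : ∀ x t → det t ≈ 1# → det ((inverse x · t) · proj₁ x) ≈ 1#
    det-conjugate x t dt = begin
      det ((inverse x · t) · proj₁ x)              ≈⟨ det-· _ _ ⟩
      det (inverse x · t) * det (proj₁ x)          ≈⟨ *-congʳ (det-· _ _) ⟩
      (det (inverse x) * det t) * det (proj₁ x)    ≈⟨ *-congʳ (*-congˡ dt) ⟩
      (det (inverse x) * 1#) * det (proj₁ x)       ≈⟨ *-congʳ (*-identityʳ _) ⟩
      det (inverse x) * det (proj₁ x)              ≈⟨ det-inverse x ⟩
      1#                                           ∎
      where open SetoidReasoning setoid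

  _·ᴳ_ : GL₂ → GL₂ → GL₂
  (A , dA) ·ᴳ (B , dB) = A · B , ·-nonzero A B dA dB

  _·ˢ_ : SL₂ → SL₂ → SL₂
  (A , dA) ·ˢ (B , dB) = A · B , ·-one A B dA dB

  SL₂→GL₂ : SL₂ → GL₂
  SL₂→GL₂ (A , dA) = A , one-nonzero A dA

  -- x⁻¹ t x
  conjugate : GL₂ → SL₂ → SL₂
  conjugate x (t , dt) = (inverse x · t) · proj₁ x , det-conjugate x t dt

  SL₂⟨𝔒⟩ : Pred SL₂ 0ℓ
  SL₂⟨𝔒⟩ (A , _) = Integral A

module Endoscopy (lem : ExcludedMiddle 0ℓ) (F : LocalField) (E : QuadraticAlgebra F)
                 (τ : QuadraticAlgebra.Carrier E) where
  private
    module F = LocalField F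
    module E = QuadraticAlgebra E
  open Matrices F public

  -- A is the matrix of multiplication by γ on column vectors, with respect to
  -- the basis {1, τ}:  (1 τ) A = γ (1 τ).
  Represents : Mat → E.Carrier → Set
  Represents A γ = (E.ι (m₁₁ A) E.+ E.ι (m₂₁ A) E.* τ E.≈ γ) ×
                   (E.ι (m₁₂ A) E.+ E.ι (m₂₂ A) E.* τ E.≈ γ E.* τ)

  InTorus : Mat → Set
  InTorus A = ∃ λ γ → E.IsUnit γ × Represents A γ

  T̃ : Set
  T̃ = Σ GL₂ λ x → InTorus (proj₁ x)

  T : Set
  T = Σ SL₂ λ x → InTorus (proj₁ x)

  element : T → E.Carrier
  element (_ , γ , _) = γ

  private
    open SetoidReasoning E.setoid
    module RI = RingIdentities E.commRing
    open RingMorphisms.IsRingHomomorphism E.ι-homo using (+-homo; *-homo)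

  abstract
    unit-* : ∀ γ δ → E.IsUnit γ → E.IsUnit δ → E.IsUnit (γ E.* δ)
    unit-* γ δ (γ' , l , _) (δ' , l' , _) = γ' E.* δ' , left , E.trans (E.*-comm _ _) left
      where
      left : (γ' E.* δ') E.* (γ E.* δ) E.≈ E.1#
      left = begin
        (γ' E.* δ') E.* (γ E.* δ)   ≈⟨ RI.interchange γ' δ' γ δ ⟩
        (γ' E.* γ) E.* (δ' E.* δ)   ≈⟨ E.*-cong l l' ⟩
        E.1# E.* E.1#               ≈⟨ E.*-identityˡ E.1# ⟩
        E.1#                        ∎

    represents-· : ∀ A B γ δ → Represents A γ → Represents B δ → Represents (A · B) (γ E.* δ)
    represents-· (mat a b c d) (mat e f g h) γ δ (A₁ , A₂) (B₁ , B₂) =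
      E.trans (column e g) (E.*-congˡ B₁) ,
      E.trans (column f h) (E.trans (E.*-congˡ B₂) (E.sym (E.*-assoc γ δ τ)))
      where
      hom : ∀ p q r s → E.ι (p F.* q F.+ r F.* s) E.≈ E.ι p E.* E.ι q E.+ E.ι r E.* E.ι s
      hom p q r s = E.trans (+-homo _ _) (E.+-cong (*-homo p q) (*-homo r s))

      column : ∀ x y → E.ι (a F.* x F.+ b F.* y) E.+ E.ι (c F.* x F.+ d F.* y) E.* τ E.≈
                       γ E.* (E.ι x E.+ E.ι y E.* τ)
      column x y = begin
        E.ι (a F.* x F.+ b F.* y) E.+ E.ι (c F.* x F.+ d F.* y) E.* τ
          ≈⟨ E.+-cong (hom a x b y) (E.*-congʳ (hom c x d y)) ⟩
        (E.ι a E.* E.ι x E.+ E.ι b E.* E.ι y) E.+ (E.ι c E.* E.ι x E.+ E.ι d E.* E.ι y) E.* τ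
          ≈⟨ RI.columns (E.ι a) (E.ι b) (E.ι c) (E.ι d) (E.ι x) (E.ι y) τ ⟩
        (E.ι a E.+ E.ι c E.* τ) E.* E.ι x E.+ (E.ι b E.+ E.ι d E.* τ) E.* E.ι y
          ≈⟨ E.+-cong (E.*-congʳ A₁) (E.*-congʳ A₂) ⟩
        γ E.* E.ι x E.+ (γ E.* τ) E.* E.ι y
          ≈⟨ RI.factor γ τ (E.ι x) (E.ι y) ⟩
        γ E.* (E.ι x E.+ E.ι y E.* τ) ∎

  _·ᵀ_ : T → T → T
  (s , γ , γ-unit , s~γ) ·ᵀ (t , δ , δ-unit , t~δ) =
    s ·ˢ t , γ E.* δ , unit-* γ δ γ-unit δ-unit , represents-· (proj₁ s) (proj₁ t) γ δ s~γ t~δ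

  T⟨𝔒⟩ : Pred T 0ℓ
  T⟨𝔒⟩ t = E.𝔒ᴱ¹ (element t)

  Regular : Pred T 0ℓ
  Regular ((A , _) , _) = ¬ (A ≈ᴹ scalar F.1#) × ¬ (A ≈ᴹ scalar (F.- F.1#))

  SL₂-space T-space GL₂-space T\SL₂ T̃\GL₂ : Space
  SL₂-space = subspace SL₂ proj₁
  T-space   = subspace T (λ t → proj₁ (proj₁ t))
  GL₂-space = subspace GL₂ proj₁
  T\SL₂     = quotient SL₂-space T (λ t x → proj₁ t ·ˢ x)
  T̃\GL₂     = quotient GL₂-space T̃ (λ t x → proj₁ t ·ᴳ x)

  record Measures : Set₁ where
    field
      μ-SL₂   : Measure SL₂-space
      μ-T     : Measure T-space
      μ-T\SL₂ : Measure T\SL₂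
      μ-T̃\GL₂ : Measure T̃\GL₂

    open Measure
    open TestFunction

    field
      haar-SL₂ : LeftInvariant SL₂-space _·ˢ_ μ-SL₂
      vol-SL₂  : HasIntegral SL₂-space μ-SL₂ (indicator lem SL₂⟨𝔒⟩) 1ℚ
      haar-T   : LeftInvariant T-space _·ᵀ_ μ-T
      vol-T    : HasIntegral T-space μ-T (indicator lem T⟨𝔒⟩) 1ℚ

      -- ∫_{T\SL₂} ( ∫_T φ(tx) dt ) dx = ∫_{SL₂} φ
      quotient-measure : ∀ (φ : TestFunction SL₂-space) (ψ : TestFunction T\SL₂) →
        (∀ x → HasIntegral T-space μ-T (λ t → fun φ (proj₁ t ·ˢ x)) (fun ψ x)) →
        ∫ μ-T\SL₂ ψ ≡ ∫ μ-SL₂ φ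

      right-invariant : RightInvariant T̃\GL₂ _·ᴳ_ μ-T̃\GL₂

      -- χ is the extension by zero of ψ along T\SL₂ ↪ T̃\GL₂, whose image
      -- is the set of cosets of elements of T̃·SL₂.
      extends : ∀ (ψ : TestFunction T\SL₂) (χ : TestFunction T̃\GL₂) →
        (∀ x → fun χ (SL₂→GL₂ x) ≡ fun ψ x) →
        (∀ y → ¬ (∃₂ λ (t : T̃) x → proj₁ y ≈ᴹ proj₁ (proj₁ t ·ᴳ SL₂→GL₂ x)) → fun χ y ≡ 0ℚ) →
        ∫ μ-T̃\GL₂ χ ≡ ∫ μ-T\SL₂ ψ

  -- 𝒪^κ(t , f) = v; in particular the integrand has compact support mod T̃.
  OrbitalIntegral : Measures → (κ : F.Fˣ → Sign) → T → (SL₂ → ℚ) → ℚ → Set₁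
  OrbitalIntegral M κ t f v =
    HasIntegral T̃\GL₂ (Measures.μ-T̃\GL₂ M) (λ x → signℚ (κ (detᴳ x)) ℚ.* f (conjugate x (proj₁ t))) v

  -- Δ(t) = d; here c = (γ - γ̄) / (τ - τ̄) and r = ∣γ - γ̄∣.
  TransferFactor : (ε : F.Fˣ → Sign) → T → ℚ → Set
  TransferFactor ε t d = ∃₂ λ (c : F.Fˣ) r →
    (E.ι (proj₁ c) E.* (τ E.- E.conj τ) E.≈ γ E.- E.conj γ) ×
    E.HasAbs (γ E.- E.conj γ) r ×
    (d ≡ signℚ (ε c) ℚ.* r)
    where γ = element t

  -- fᴱ is the smooth function on T(F) with fᴱ(t) = Δ(t) 𝒪^κ(t , f) for regular t.
  record IsTransfer (M : Measures) (ε κ : F.Fˣ → Sign) (f : SL₂ → ℚ) (fᴱ : T → ℚ) : Set₁ where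
    field
      smooth  : LocallyConstant T-space fᴱ
      regular : ∀ t → Regular t → ∃₂ λ d v →
        TransferFactor ε t d × OrbitalIntegral M κ t f v × (fᴱ t ≡ d ℚ.* v)

{-# OPTIONS --safe #-}
module Submission where

-- Write κ = ε(ϖ), and let fₙ(x) be ε(det x) if the lattice x 𝔒² is stable under
-- the order 𝔒 + ϖⁿ 𝔒_E and 0 otherwise.  For regular t = a + b τ in T(𝔒) with
-- ∣b∣ = q⁻ⁿ the integrand of the orbital integral is fₙ; for t outside T(𝔒) it
-- vanishes.  Let H sum a function over the q + 1 neighbours of a lattice.
-- Counting how many neighbours are stable under the order gives
--   κ H f₀ = f₁ + κ f₀   and   κ H fₙ₊₁ = fₙ₊₂ + q fₙ ,
-- and right invariance gives ∫ H f = (q + 1) ∫ f.  As f₀ is the indicator of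
-- T̃ K, which has volume 1, it follows that ∫ fₙ = (κ q)ⁿ, and this cancels the
-- transfer factor κⁿ q⁻ⁿ.  The recursion also shows that fₙ is locally constant
-- with compact support modulo T̃.  The values at t = ±1 follow by smoothness.

open import Level using (0ℓ)
open import Algebra.Bundles using (CommutativeRing)
open import Algebra.Morphism.Structures using (module RingMorphisms)
open import Algebra.Solver.Ring.AlmostCommutativeRing using (fromCommutativeRing; _-Raw-AlmostCommutative⟶_)
open import Axiom.ExcludedMiddle using (ExcludedMiddle)
open import Data.Bool.Base using (if_then_else_)
open import Data.Empty using (⊥; ⊥-elim)
open import Data.Fin.Base as Fin using (Fin; zero; suc)
open import Data.Integer.Base as ℤ using (ℤ; +_; -[1+_]; _⊖_)
open import Data.List.Base using (List; []; _∷_; _++_; catMaybes)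
open import Data.List.Relation.Unary.All using (All; []; _∷_)
open import Data.List.Relation.Unary.Any as Any using (Any; here; there)
open import Data.Maybe.Base using (Maybe; just; nothing)
open import Data.Nat.Base as ℕ using (ℕ; zero; suc)
open import Data.Product.Base using (Σ; ∃; ∃₂; _×_; _,_; proj₁; proj₂)
open import Data.Rational.Base as ℚ using (ℚ; 0ℚ; 1ℚ; mkℚ)
open import Data.Rational.Unnormalised.Base as ℚᵘ using (mkℚᵘ; *≡*; *≤*)
open import Data.Sign.Base as Sign using (Sign)
open import Data.Sum.Base using (_⊎_; inj₁; inj₂)
open import Data.Unit.Base using (⊤; tt)
open import Function.Base using (_∘_)
open import Function.Bundles using (_⇔_; mk⇔; Equivalence)
open import Relation.Binary.Definitions using (tri<; tri≈; tri>)
open import Relation.Binary.PropositionalEquality as ≡ using (_≡_; _≢_)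
open import Relation.Nullary using (¬_; yes; no; Dec; does)
open import Relation.Nullary.Decidable using (toWitness)
open import Relation.Unary using (Pred)
import Algebra.Properties.AbelianGroup as AbelianGroupProperties
import Algebra.Properties.Ring as RingProperties
import Algebra.Properties.Semiring.Mult.TCOptimised as SemiringMult
import Algebra.Solver.Ring as RingSolver
import Data.Fin.Properties as Fin
import Data.Integer.Properties as ℤ
import Data.List.Relation.Unary.Any.Properties as Any
import Data.Nat.Properties as ℕ
import Data.Rational.Properties as ℚ
import Data.Rational.Unnormalised.Properties as ℚᵘ
import Relation.Binary.Reasoning.Setoid as SetoidReasoning
open import Defs

-- Lattices never appear as such: x 𝔒² is known through the matrix of τ in its basis, of trace T and
-- determinant N. The off-diagonal entries r and s alone decide stability, the diagonal ones being
-- roots of monic quadratic equations. Neighbours are the points of the projective line over the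
-- residue field, and the stable ones are zeros of a binary quadratic form whose discriminant is T²
-- - 4N times a square. At the bottom level this is a unit and there are 1 + κ zeros; higher up the
-- rescaled form degenerates to one double zero. Residue characteristic 2 rules out completing the
-- square, so the norm form in T and N takes its place, and that T² - 4N is a unit has to be proved.
-- The closed form (κ q)ⁿ comes from X² - κ(q + 1) X + q = (X - κ q)(X - κ): the initial values 1
-- and κ(q + 1) - κ = κ q select the first root. No double cosets are described; the induction needs
-- right invariance, one volume, and that translates of test functions are test functions.

module IntegerCoefficients (R : CommutativeRing 0ℓ 0ℓ) where
  open CommutativeRing R
  open SetoidReasoning setoid
  open RingProperties ring using (-‿distribˡ-*; -‿involutive; -0#≈0#)
  open AbelianGroupProperties +-abelianGroup using (⁻¹-∙-comm)
  open SemiringMult semiring using (1+×; ×-homo-+; ×1-homo-*) renaming (_×_ to _×′_)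

  fromℤ : ℤ → Carrier
  fromℤ (+ n)    = n ×′ 1#
  fromℤ -[1+ n ] = - (suc n ×′ 1#)

  fromℤ-⊖ : ∀ m n → fromℤ (m ⊖ n) ≈ m ×′ 1# - n ×′ 1#
  fromℤ-⊖ zero    zero    = sym (-‿inverseʳ 0#)
  fromℤ-⊖ zero    (suc n) = sym (+-identityˡ _)
  fromℤ-⊖ (suc m) zero    = sym (trans (+-congˡ -0#≈0#) (+-identityʳ _))
  fromℤ-⊖ (suc m) (suc n) = begin
    fromℤ (suc m ⊖ suc n)                   ≡⟨ ≡.cong fromℤ (ℤ.[1+m]⊖[1+n]≡m⊖n m n) ⟩
    fromℤ (m ⊖ n)                           ≈⟨ fromℤ-⊖ m n ⟩
    m ×′ 1# - n ×′ 1#                         ≈⟨ +-identityˡ _ ⟨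
    0# + (m ×′ 1# - n ×′ 1#)                  ≈⟨ +-congʳ (-‿inverseʳ 1#) ⟨
    (1# - 1#) + (m ×′ 1# - n ×′ 1#)           ≈⟨ +-assoc _ _ _ ⟩
    1# + (- 1# + (m ×′ 1# - n ×′ 1#))         ≈⟨ +-congˡ
      (trans (sym (+-assoc _ _ _)) (trans (+-congʳ (+-comm _ _)) (+-assoc _ _ _))) ⟩
    1# + (m ×′ 1# + (- 1# + - (n ×′ 1#)))     ≈⟨ +-assoc _ _ _ ⟨
    (1# + m ×′ 1#) + (- 1# + - (n ×′ 1#))     ≈⟨ +-cong (1+× m 1#) (sym (⁻¹-∙-comm _ _)) ⟨
    suc m ×′ 1# - (1# + n ×′ 1#)              ≈⟨ +-congˡ (-‿cong (1+× n 1#)) ⟨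
    suc m ×′ 1# - suc n ×′ 1#                 ∎

  fromℤ-neg : ∀ i → fromℤ (ℤ.- i) ≈ - fromℤ i
  fromℤ-neg (+ zero)  = sym -0#≈0#
  fromℤ-neg (+ suc n) = refl
  fromℤ-neg -[1+ n ]  = sym (-‿involutive _)

  fromℤ-+ : ∀ i j → fromℤ (i ℤ.+ j) ≈ fromℤ i + fromℤ j
  fromℤ-+ (+ m)    (+ n)    = ×-homo-+ 1# m n
  fromℤ-+ (+ m)    -[1+ n ] = fromℤ-⊖ m (suc n)
  fromℤ-+ -[1+ m ] (+ n)    = trans (fromℤ-⊖ n (suc m)) (+-comm _ _)
  fromℤ-+ -[1+ m ] -[1+ n ] = begin
    - (suc (suc (m ℕ.+ n)) ×′ 1#)        ≡⟨ ≡.cong (λ k → - (suc k ×′ 1#)) (≡.sym (ℕ.+-suc m n)) ⟩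
    - ((suc m ℕ.+ suc n) ×′ 1#)          ≈⟨ -‿cong (×-homo-+ 1# (suc m) (suc n)) ⟩
    - (suc m ×′ 1# + suc n ×′ 1#)         ≈⟨ ⁻¹-∙-comm _ _ ⟨
    - (suc m ×′ 1#) + - (suc n ×′ 1#)     ∎

  fromℤ-pos-* : ∀ m j → fromℤ (+ m ℤ.* j) ≈ (m ×′ 1#) * fromℤ j
  fromℤ-pos-* m (+ n) = trans (reflexive (≡.cong fromℤ (≡.sym (ℤ.pos-* m n)))) (×1-homo-* m n)
  fromℤ-pos-* m -[1+ n ] = begin
    fromℤ (+ m ℤ.* -[1+ n ])              ≡⟨ ≡.cong fromℤ (≡.sym (ℤ.neg-distribʳ-* (+ m) (+ suc n)))
      ⟩
    fromℤ (ℤ.- (+ m ℤ.* + suc n))         ≈⟨ fromℤ-neg (+ m ℤ.* + suc n) ⟩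
    - fromℤ (+ m ℤ.* + suc n)             ≈⟨ -‿cong (fromℤ-pos-* m (+ suc n)) ⟩
    - ((m ×′ 1#) * (suc n ×′ 1#))           ≈⟨ RingProperties.-‿distribʳ-* ring _ _ ⟩
    (m ×′ 1#) * - (suc n ×′ 1#)             ∎

  fromℤ-* : ∀ i j → fromℤ (i ℤ.* j) ≈ fromℤ i * fromℤ j
  fromℤ-* (+ m)    j = fromℤ-pos-* m j
  fromℤ-* -[1+ m ] j = begin
    fromℤ (-[1+ m ] ℤ.* j)           ≡⟨ ≡.cong fromℤ (≡.sym (ℤ.neg-distribˡ-* (+ suc m) j)) ⟩
    fromℤ (ℤ.- (+ suc m ℤ.* j))      ≈⟨ fromℤ-neg (+ suc m ℤ.* j) ⟩
    - fromℤ (+ suc m ℤ.* j)          ≈⟨ -‿cong (fromℤ-pos-* (suc m) j) ⟩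
    - ((suc m ×′ 1#) * fromℤ j)       ≈⟨ -‿distribˡ-* _ _ ⟩
    - (suc m ×′ 1#) * fromℤ j         ∎

  morphism : CommutativeRing.rawRing ℤ.+-*-commutativeRing -Raw-AlmostCommutative⟶
    fromCommutativeRing R
  morphism = record
    { ⟦_⟧    = fromℤ
    ; +-homo = fromℤ-+
    ; *-homo = fromℤ-*
    ; -‿homo = fromℤ-neg
    ; 0-homo = refl
    ; 1-homo = refl
    }

  -- Sound but incomplete on purpose: in positive characteristic distinct integers can have equal
  -- images.
  ≟-weak : ∀ i j → Maybe (fromℤ i ≈ fromℤ j)
  ≟-weak i j with i ℤ.≟ j
  ... | yes ≡.refl = just refl
  ... | no  _      = nothing

  open RingSolver (CommutativeRing.rawRing ℤ.+-*-commutativeRing) (fromCommutativeRing R) morphism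
    ≟-weak public
    using (Polynomial; solve; _:+_; _:*_; _:-_; :-_; con; _:=_)

  :0 :1 : ∀ {n} → Polynomial n
  :0 = con (+ 0)
  :1 = con (+ 1)

module LinearCombination (R : CommutativeRing 0ℓ 0ℓ) where
  open CommutativeRing R
  open SetoidReasoning setoid

  difference-zero : ∀ {x y} → x ≈ y → x - y ≈ 0#
  difference-zero {x} {y} e = trans (+-congʳ e) (-‿inverseʳ y)

  zero-difference : ∀ {x y} → x - y ≈ 0# → x ≈ y
  zero-difference {x} {y} e = begin
    x              ≈⟨ +-identityʳ x ⟨
    x + 0#         ≈⟨ +-congˡ (-‿inverseˡ y) ⟨
    x + (- y + y)  ≈⟨ +-assoc x (- y) y ⟨
    (x - y) + y    ≈⟨ +-congʳ e ⟩
    0# + y         ≈⟨ +-identityˡ y ⟩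
    y              ∎

  multiple-zero : ∀ {x y} c → x ≈ y → c * (x - y) ≈ 0#
  multiple-zero c e = trans (*-congˡ (difference-zero e)) (zeroʳ c)

  -- The coefficients are a certificate: the difference of the two sides is an explicit combination
  -- of differences that vanish by hypothesis. This turns an identity modulo hypotheses into one
  -- that the ring solver can check.
  combine₁ : ∀ {l r x y} c → x ≈ y → l - r ≈ c * (x - y) → l ≈ r
  combine₁ c e i = zero-difference (trans i (multiple-zero c e))

  combine₂ : ∀ {l r x y x′ y′} c c′ → x ≈ y → x′ ≈ y′ →
             l - r ≈ c * (x - y) + c′ * (x′ - y′) → l ≈ r
  combine₂ c c′ e e′ i = zero-difference
    (trans i (trans (+-cong (multiple-zero c e) (multiple-zero c′ e′)) (+-identityˡ 0#)))

  combine₃ : ∀ {l r x y x′ y′ x″ y″} c c′ c″ → x ≈ y → x′ ≈ y′ → x″ ≈ y″ →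
             l - r ≈ c * (x - y) + c′ * (x′ - y′) + c″ * (x″ - y″) → l ≈ r
  combine₃ c c′ c″ e e′ e″ i = zero-difference (trans i
    (trans (+-cong (trans (+-cong (multiple-zero c e) (multiple-zero c′ e′)) (+-identityˡ 0#))
      (multiple-zero c″ e″)) (+-identityˡ 0#)))

-- Order and powers in ℚ

module Rational where
  open IntegerCoefficients ℚ.+-*-commutativeRing

  *-mono-≤-nonNeg : ∀ {p q r s} → 0ℚ ℚ.≤ p → 0ℚ ℚ.≤ s → p ℚ.≤ q → r ℚ.≤ s → p ℚ.* r ℚ.≤ q ℚ.* s
  *-mono-≤-nonNeg {p} {q} {r} {s} 0≤p 0≤s p≤q r≤s = ℚ.≤-trans
    (ℚ.*-monoˡ-≤-nonNeg p {{ℚ.nonNegative 0≤p}} r≤s)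
    (ℚ.*-monoʳ-≤-nonNeg s {{ℚ.nonNegative 0≤s}} p≤q)

  square-cancel-≤ : ∀ {p q} → 0ℚ ℚ.≤ p → 0ℚ ℚ.≤ q → p ℚ.* p ≡ q ℚ.* q → p ℚ.≤ q
  square-cancel-≤ {p} {q} 0≤p 0≤q e with p ℚ.≤? q
  ... | yes p≤q = p≤q
  ... | no  p≰q = ⊥-elim (ℚ.<-irrefl (≡.sym e) (ℚ.≤-<-trans
          (ℚ.*-monoˡ-≤-nonNeg q {{ℚ.nonNegative 0≤q}} (ℚ.<⇒≤ q<p))
          (ℚ.*-monoˡ-<-pos p {{ℚ.positive (ℚ.≤-<-trans 0≤q q<p)}} q<p)))
    where q<p = ℚ.≰⇒> p≰q

  square-injective : ∀ {p q} → 0ℚ ℚ.≤ p → 0ℚ ℚ.≤ q → p ℚ.* p ≡ q ℚ.* q → p ≡ q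
  square-injective 0≤p 0≤q e = ℚ.≤-antisym (square-cancel-≤ 0≤p 0≤q e)
    (square-cancel-≤ 0≤q 0≤p (≡.sym e))

  nonNeg≢0⇒pos : ∀ {p} → 0ℚ ℚ.≤ p → p ≢ 0ℚ → 0ℚ ℚ.< p
  nonNeg≢0⇒pos {p} 0≤p p≢0 with ℚ.<-cmp 0ℚ p
  ... | tri< 0<p _ _ = 0<p
  ... | tri≈ _ 0≡p _ = ⊥-elim (p≢0 (≡.sym 0≡p))
  ... | tri> _ _ p<0 = ⊥-elim (ℚ.<-irrefl ≡.refl (ℚ.<-≤-trans p<0 0≤p))

  fromℕ : ℕ → ℚ
  fromℕ n = (+ n) ℚ./ 1

  ≤-fromℕ : ∀ p → ∃ λ n → p ℚ.≤ fromℕ n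
  ≤-fromℕ p@(mkℚ n d _) = ℤ.∣ n ∣ , ℚ.toℚᵘ-cancel-≤
    (ℚᵘ.≤-respʳ-≃ (ℚᵘ.≃-sym (ℚ.toℚᵘ-fromℚᵘ (mkℚᵘ (+ ℤ.∣ n ∣) 0))) (*≤* bound))
    where
    bound : n ℤ.* ℤ.1ℤ ℤ.≤ + ℤ.∣ n ∣ ℤ.* + suc d
    bound = ℤ.≤-trans (ℤ.≤-reflexive (ℤ.*-identityʳ n)) (ℤ.≤-trans (i≤∣i∣ n)
      (ℤ.≤-trans (ℤ.+≤+ (ℕ.m≤m*n ℤ.∣ n ∣ (suc d))) (ℤ.≤-reflexive (ℤ.pos-* ℤ.∣ n ∣ (suc d)))))
      where
      i≤∣i∣ : ∀ i → i ℤ.≤ + ℤ.∣ i ∣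
      i≤∣i∣ (+ _)    = ℤ.≤-refl
      i≤∣i∣ -[1+ _ ] = ℤ.-≤+

  fromℕ-suc : ∀ n → fromℕ (suc n) ≡ 1ℚ ℚ.+ fromℕ n
  fromℕ-suc n = ℚ.toℚᵘ-injective (begin
    ℚ.toℚᵘ (fromℕ (suc n))           ≈⟨ ℚ.toℚᵘ-fromℚᵘ (mkℚᵘ (+ suc n) 0) ⟩
    mkℚᵘ (+ suc n) 0                 ≈⟨ *≡*
      (≡.cong (ℤ._* ℤ.1ℤ) (≡.cong (λ i → ℤ.1ℤ ℤ.+ i) (≡.sym (ℤ.*-identityʳ (+ n))))) ⟩
    mkℚᵘ ℤ.1ℤ 0 ℚᵘ.+ mkℚᵘ (+ n) 0    ≈⟨ ℚᵘ.+-congʳ (mkℚᵘ ℤ.1ℤ 0) (ℚ.toℚᵘ-fromℚᵘ (mkℚᵘ (+ n) 0)) ⟨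
    mkℚᵘ ℤ.1ℤ 0 ℚᵘ.+ ℚ.toℚᵘ (fromℕ n) ≈⟨ ℚ.toℚᵘ-homo-+ 1ℚ (fromℕ n) ⟨
    ℚ.toℚᵘ (1ℚ ℚ.+ fromℕ n)          ∎)
    where open SetoidReasoning ℚᵘ.≃-setoid

  fromℕ-nonNeg : ∀ n → 0ℚ ℚ.≤ fromℕ n
  fromℕ-nonNeg zero    = ℚ.≤-refl
  fromℕ-nonNeg (suc n) = ℚ.≤-trans (ℚ.+-mono-≤ {0ℚ} {1ℚ} (ℚ.<⇒≤ (ℚ.positive⁻¹ 1ℚ)) (fromℕ-nonNeg n))
    (ℚ.≤-reflexive (≡.sym (fromℕ-suc n)))

  2≤fromℕ : ∀ n → 2 ℕ.≤ n → 1ℚ ℚ.+ 1ℚ ℚ.≤ fromℕ n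
  2≤fromℕ (suc (suc n)) _ = ℚ.≤-trans
    (ℚ.+-monoʳ-≤ 1ℚ (ℚ.≤-trans (ℚ.≤-reflexive (≡.sym (ℚ.+-identityʳ 1ℚ)))
      (ℚ.+-monoʳ-≤ 1ℚ (fromℕ-nonNeg n))))
    (ℚ.≤-reflexive (≡.sym (≡.trans (fromℕ-suc (suc n)) (≡.cong (1ℚ ℚ.+_) (fromℕ-suc n)))))
  2≤fromℕ zero ()
  2≤fromℕ (suc zero) (ℕ.s≤s ())

  infixr 8 _^_
  _^_ : ℚ → ℕ → ℚ
  p ^ zero  = 1ℚ
  p ^ suc n = p ℚ.* p ^ n

  ^-distrib-* : ∀ p q n → (p ℚ.* q) ^ n ≡ p ^ n ℚ.* q ^ n
  ^-distrib-* p q zero    = ≡.refl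
  ^-distrib-* p q (suc n) = begin
    (p ℚ.* q) ℚ.* (p ℚ.* q) ^ n            ≡⟨ ≡.cong ((p ℚ.* q) ℚ.*_) (^-distrib-* p q n) ⟩
    (p ℚ.* q) ℚ.* (p ^ n ℚ.* q ^ n)        ≡⟨ interchange p q (p ^ n) (q ^ n) ⟩
    (p ℚ.* p ^ n) ℚ.* (q ℚ.* q ^ n)        ∎
    where open ≡.≡-Reasoning
          interchange = solve 4 (λ a b c d → (a :* b) :* (c :* d) := (a :* c) :* (b :* d)) ≡.refl

  1^n≡1 : ∀ n → 1ℚ ^ n ≡ 1ℚ
  1^n≡1 zero    = ≡.refl
  1^n≡1 (suc n) = ≡.trans (ℚ.*-identityˡ _) (1^n≡1 n)

  -- The bound 1 ≤ pⁿ is carried along because the step is 1 + n ≤ pⁿ + pⁿ ≤ p pⁿ.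
  fromℕ≤^ : ∀ {p} → 1ℚ ℚ.+ 1ℚ ℚ.≤ p → ∀ n → fromℕ n ℚ.≤ p ^ n × 1ℚ ℚ.≤ p ^ n
  fromℕ≤^ 2≤p zero    = ℚ.<⇒≤ (ℚ.positive⁻¹ 1ℚ) , ℚ.≤-refl
  fromℕ≤^ {p} 2≤p (suc n) with fromℕ≤^ 2≤p n
  ... | n≤pⁿ , 1≤pⁿ =
    ℚ.≤-trans (ℚ.≤-reflexive (fromℕ-suc n)) (ℚ.≤-trans (ℚ.+-mono-≤ 1≤pⁿ n≤pⁿ) double) ,
    ℚ.≤-trans 1≤pⁿ (ℚ.≤-trans (ℚ.≤-trans (ℚ.≤-reflexive (≡.sym (ℚ.+-identityˡ (p ^ n))))
      (ℚ.+-monoˡ-≤ (p ^ n) 0≤pⁿ)) double)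
    where
    0≤pⁿ : 0ℚ ℚ.≤ p ^ n
    0≤pⁿ = ℚ.≤-trans (ℚ.<⇒≤ (ℚ.positive⁻¹ 1ℚ)) 1≤pⁿ
    double : p ^ n ℚ.+ p ^ n ℚ.≤ p ℚ.* p ^ n
    double = ≡.subst (ℚ._≤ p ℚ.* p ^ n)
      (solve 1 (λ x → (:1 :+ :1) :* x := x :+ x) ≡.refl (p ^ n))
      (ℚ.*-monoʳ-≤-nonNeg (p ^ n) {{ℚ.nonNegative 0≤pⁿ}} 2≤p)

  1<2 : 1ℚ ℚ.< 1ℚ ℚ.+ 1ℚ
  1<2 = toWitness {a? = 1ℚ ℚ.<? 1ℚ ℚ.+ 1ℚ} tt

-- Integers, maximal ideal and valuation of the local field

module Valuation (lem : ExcludedMiddle 0ℓ) (F : LocalField) where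
  open LocalField F hiding (zero)
  open IntegerCoefficients commRing
  open LinearCombination commRing
  open Rational hiding (_^_)

  decide : (P : Set) → Dec P
  decide P = lem {P}

  abstract
    stable : {P : Set} → ¬ ¬ P → P
    stable {P} ¬¬p with decide P
    ... | yes p = p
    ... | no ¬p = ⊥-elim (¬¬p ¬p)

    1≉0 : ¬ (1# ≈ 0#)
    1≉0 = proj₁ isField

    inverse-of : ∀ x → ¬ (x ≈ 0#) → ∃ λ y → x * y ≈ 1#
    inverse-of x x≉0 = inv (x , x≉0) , trans (*-comm _ _) (inv-left (x , x≉0))

    *-cancel : ∀ c {x y} → ¬ (c ≈ 0#) → c * x ≈ c * y → x ≈ y
    *-cancel c {x} {y} c≉0 e with inverse-of c c≉0
    ... | d , cd≈1 = combine₃ d (- x) y e cd≈1 cd≈1 (solve 4 (λ c d x y →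
      x :- y := d :* (c :* x :- c :* y) :+ (:- x) :* (c :* d :- :1) :+ y :* (c :* d :- :1)) refl c d
        x y)

    integral-domain : ∀ {x y} → x * y ≈ 0# → (x ≈ 0#) ⊎ (y ≈ 0#)
    integral-domain {x} {y} e with decide (x ≈ 0#)
    ... | yes x≈0 = inj₁ x≈0
    ... | no  x≉0 = inj₂ (*-cancel x x≉0 (trans e (sym (zeroʳ x))))

    ∣x∣≢0 : ∀ {x} → ¬ (x ≈ 0#) → ∣ x ∣ ≢ 0ℚ
    ∣x∣≢0 {x} x≉0 e = x≉0 (Equivalence.to (∣∣-definite x) e)

    ∣x∣>0 : ∀ {x} → ¬ (x ≈ 0#) → 0ℚ ℚ.< ∣ x ∣
    ∣x∣>0 {x} x≉0 = nonNeg≢0⇒pos (∣∣-nonneg x) (∣x∣≢0 x≉0)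

    ∣0∣ : ∣ 0# ∣ ≡ 0ℚ
    ∣0∣ = Equivalence.from (∣∣-definite 0#) refl

    0≤1 : 0ℚ ℚ.≤ 1ℚ
    0≤1 = ℚ.<⇒≤ (ℚ.positive⁻¹ 1ℚ)

    square-one : ∀ x → x * x ≈ 1# → ∣ x ∣ ≡ 1ℚ
    square-one x e = square-injective (∣∣-nonneg x) 0≤1
      (≡.trans (≡.sym (∣∣-mult x x)) (≡.trans (∣∣-cong e) ∣1∣))
      where
      ∣1∣ : ∣ 1# ∣ ≡ 1ℚ ℚ.* 1ℚ
      ∣1∣ with ℚ.<-cmp ∣ 1# ∣ 1ℚ
      ... | tri≈ _ e _ = e
      ... | tri< l _ _ = ⊥-elim (ℚ.<-irrefl
        (≡.trans (≡.sym (∣∣-mult 1# 1#)) (∣∣-cong (*-identityˡ 1#)))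
            (ℚ.<-≤-trans (ℚ.*-monoˡ-<-pos ∣ 1# ∣ {{ℚ.positive (∣x∣>0 1≉0)}} l)
              (ℚ.≤-reflexive (ℚ.*-identityˡ _))))
      ... | tri> _ _ g = ⊥-elim (ℚ.<-irrefl (≡.trans (∣∣-cong (sym (*-identityˡ 1#)))
        (∣∣-mult 1# 1#))
            (ℚ.≤-<-trans (ℚ.≤-reflexive (≡.sym (ℚ.*-identityˡ _)))
              (ℚ.*-monoˡ-<-pos ∣ 1# ∣ {{ℚ.positive (∣x∣>0 1≉0)}} g)))

    ∣1∣ : ∣ 1# ∣ ≡ 1ℚ
    ∣1∣ = square-one 1# (*-identityˡ 1#)

    ∣-x∣ : ∀ x → ∣ - x ∣ ≡ ∣ x ∣
    ∣-x∣ x = ≡.trans (∣∣-cong (solve 1 (λ x → :- x := (:- :1) :* x) refl x))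
      (≡.trans (∣∣-mult (- 1#) x)
        (≡.trans (≡.cong (ℚ._* ∣ x ∣) (square-one (- 1#) (solve 0 ((:- :1) :* (:- :1) := :1) refl)))
        (ℚ.*-identityˡ _)))

  𝔪 : Pred Carrier 0ℓ
  𝔪 x = ∣ x ∣ ℚ.< 1ℚ

  abstract
    𝔒-resp : ∀ {x y} → x ≈ y → 𝔒 x → 𝔒 y
    𝔒-resp e = ≡.subst (ℚ._≤ 1ℚ) (∣∣-cong e)

    𝔪-resp : ∀ {x y} → x ≈ y → 𝔪 x → 𝔪 y
    𝔪-resp e = ≡.subst (ℚ._< 1ℚ) (∣∣-cong e)

    𝔪⇒𝔒 : ∀ {x} → 𝔪 x → 𝔒 x
    𝔪⇒𝔒 = ℚ.<⇒≤

    𝔒0 : 𝔒 0#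
    𝔒0 = ≡.subst (ℚ._≤ 1ℚ) (≡.sym ∣0∣) 0≤1

    𝔒1 : 𝔒 1#
    𝔒1 = ℚ.≤-reflexive ∣1∣

    𝔪0 : 𝔪 0#
    𝔪0 = ≡.subst (ℚ._< 1ℚ) (≡.sym ∣0∣) (ℚ.positive⁻¹ 1ℚ)

    ¬𝔪1 : ¬ 𝔪 1#
    ¬𝔪1 = ℚ.<-irrefl ∣1∣

    𝔒-+ : ∀ {x y} → 𝔒 x → 𝔒 y → 𝔒 (x + y)
    𝔒-+ {x} {y} a b = ℚ.≤-trans (∣∣-ultrametric x y) (ℚ.⊔-lub a b)

    ∣x+y∣< : ∀ {δ} x y → ∣ x ∣ ℚ.< δ → ∣ y ∣ ℚ.< δ → ∣ x + y ∣ ℚ.< δ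
    ∣x+y∣< x y a b with ℚ.⊔-sel ∣ x ∣ ∣ y ∣
    ... | inj₁ e = ℚ.≤-<-trans (∣∣-ultrametric x y) (≡.subst (ℚ._< _) (≡.sym e) a)
    ... | inj₂ e = ℚ.≤-<-trans (∣∣-ultrametric x y) (≡.subst (ℚ._< _) (≡.sym e) b)

    𝔪-+ : ∀ {x y} → 𝔪 x → 𝔪 y → 𝔪 (x + y)
    𝔪-+ {x} {y} = ∣x+y∣< x y

    𝔒-neg : ∀ {x} → 𝔒 x → 𝔒 (- x)
    𝔒-neg {x} = ≡.subst (ℚ._≤ 1ℚ) (≡.sym (∣-x∣ x))

    𝔪-neg : ∀ {x} → 𝔪 x → 𝔪 (- x)
    𝔪-neg {x} = ≡.subst (ℚ._< 1ℚ) (≡.sym (∣-x∣ x))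

    𝔒-- : ∀ {x y} → 𝔒 x → 𝔒 y → 𝔒 (x - y)
    𝔒-- a b = 𝔒-+ a (𝔒-neg b)

    𝔪-- : ∀ {x y} → 𝔪 x → 𝔪 y → 𝔪 (x - y)
    𝔪-- a b = 𝔪-+ a (𝔪-neg b)

    𝔒-* : ∀ {x y} → 𝔒 x → 𝔒 y → 𝔒 (x * y)
    𝔒-* {x} {y} a b = ≡.subst (ℚ._≤ 1ℚ) (≡.sym (∣∣-mult x y))
      (*-mono-≤-nonNeg (∣∣-nonneg x) 0≤1 a b)

    𝔪-*ˡ : ∀ {x y} → 𝔪 x → 𝔒 y → 𝔪 (x * y)
    𝔪-*ˡ {x} {y} a b = ≡.subst (ℚ._< 1ℚ) (≡.sym (∣∣-mult x y)) (ℚ.≤-<-trans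
      (ℚ.≤-trans (ℚ.*-monoˡ-≤-nonNeg ∣ x ∣ {{ℚ.nonNegative (∣∣-nonneg x)}} b)
        (ℚ.≤-reflexive (ℚ.*-identityʳ _))) a)

    𝔪-*ʳ : ∀ {x y} → 𝔒 x → 𝔪 y → 𝔪 (x * y)
    𝔪-*ʳ a b = 𝔪-resp (*-comm _ _) (𝔪-*ˡ b a)

    𝔪-prime : ∀ {x y} → 𝔪 (x * y) → 𝔪 x ⊎ 𝔪 y
    𝔪-prime {x} {y} m with decide (𝔪 x) | decide (𝔪 y)
    ... | yes a | _     = inj₁ a
    ... | no _  | yes b = inj₂ b
    ... | no a  | no b  = ⊥-elim (ℚ.<-irrefl ≡.refl (ℚ.≤-<-trans
      (*-mono-≤-nonNeg 0≤1 (∣∣-nonneg y) (ℚ.≮⇒≥ a) (ℚ.≮⇒≥ b)) (≡.subst (ℚ._< 1ℚ) (∣∣-mult x y) m)))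

    𝔪-square : ∀ {x} → 𝔪 (x * x) → 𝔪 x
    𝔪-square m with 𝔪-prime m
    ... | inj₁ a = a
    ... | inj₂ a = a

    unit : ∀ {x y} → 𝔒 y → x * y ≈ 1# → ¬ 𝔪 x
    unit 𝔒y e 𝔪x = ¬𝔪1 (𝔪-resp e (𝔪-*ˡ 𝔪x 𝔒y))

    ¬𝔪⇒≉0 : ∀ {x} → ¬ 𝔪 x → ¬ (x ≈ 0#)
    ¬𝔪⇒≉0 u e = u (𝔪-resp (sym e) 𝔪0)

    unit-inverse : ∀ {x} → ¬ 𝔪 x → ∃ λ y → 𝔒 y × (x * y ≈ 1#)
    unit-inverse {x} u with inverse-of x (¬𝔪⇒≉0 u)
    ... | y , e with decide (𝔒 y)
    ...   | yes 𝔒y = y , 𝔒y , e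
    ...   | no ¬𝔒y = ⊥-elim (ℚ.<-irrefl
      (≡.trans (≡.sym ∣1∣) (≡.trans (∣∣-cong (sym e)) (∣∣-mult x y)))
      (ℚ.<-≤-trans (ℚ.≰⇒> ¬𝔒y) (ℚ.≤-trans (ℚ.≤-reflexive (≡.sym (ℚ.*-identityˡ _)))
        (ℚ.*-monoʳ-≤-nonNeg ∣ y ∣ {{ℚ.nonNegative (∣∣-nonneg y)}} (ℚ.≮⇒≥ u)))))

    ¬𝔒⇒≉0 : ∀ {x} → ¬ 𝔒 x → ¬ (x ≈ 0#)
    ¬𝔒⇒≉0 u e = u (𝔒-resp (sym e) 𝔒0)

    nonintegral-inverse : ∀ {x} → ¬ 𝔒 x → ∃ λ y → 𝔪 y × (x * y ≈ 1#)
    nonintegral-inverse {x} u with inverse-of x (¬𝔒⇒≉0 u)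
    ... | y , e with decide (𝔪 y)
    ...   | yes 𝔪y = y , 𝔪y , e
    ...   | no ¬𝔪y = ⊥-elim (u (helper (unit-inverse ¬𝔪y)))
      where
      helper : (∃ λ z → 𝔒 z × (y * z ≈ 1#)) → 𝔒 x
      helper (z , 𝔒z , yz≈1) = 𝔒-resp (combine₂ (- z) x e yz≈1 (solve 3 (λ x y z →
        z :- x := (:- z) :* (x :* y :- :1) :+ x :* (y :* z :- :1)) refl x y z)) 𝔒z

    -- If y is not integral, then z = 1/y lies in 𝔪, and the equation multiplied by z reads y = a +
    -- b z, which is integral after all.
    root-𝔒 : ∀ {y a b} → 𝔒 a → 𝔒 b → y * y ≈ a * y + b → 𝔒 y
    root-𝔒 {y} {a} {b} 𝔒a 𝔒b e with decide (𝔒 y)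
    ... | yes 𝔒y = 𝔒y
    ... | no ¬𝔒y with nonintegral-inverse ¬𝔒y
    ...   | z , 𝔪z , yz≈1 = 𝔒-resp (sym (combine₂ z (a - y) e yz≈1 (solve 4 (λ a b y z →
      y :- (a :+ b :* z) := z :* (y :* y :- (a :* y :+ b)) :+ (a :- y) :* (y :* z :- :1)) refl a b y
        z)))
      (𝔒-+ 𝔒a (𝔒-* 𝔒b (𝔪⇒𝔒 𝔪z)))

    root-𝔪 : ∀ {y a b} → 𝔪 a → 𝔪 b → y * y ≈ a * y + b → 𝔪 y
    root-𝔪 {y} {a} {b} 𝔪a 𝔪b e = 𝔪-square (𝔪-resp (sym e)
      (𝔪-+ (𝔪-*ˡ 𝔪a (root-𝔒 (𝔪⇒𝔒 𝔪a) (𝔪⇒𝔒 𝔪b) e)) 𝔪b))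

    ∣ϖ∣>0 : 0ℚ ℚ.< ∣ ϖ ∣
    ∣ϖ∣>0 = ∣x∣>0 ϖ≉0′
      where
      ϖ≉0′ : ¬ (ϖ ≈ 0#)
      ϖ≉0′ e = absurd (≡.trans (≡.sym normalized)
        (≡.trans (≡.cong (ℚ._* fromℕ q) (≡.trans (∣∣-cong e) ∣0∣)) (ℚ.*-zeroˡ (fromℕ q))))
        where
        absurd : ¬ (1ℚ ≡ 0ℚ)
        absurd ()

    ϖ≉0 : ¬ (ϖ ≈ 0#)
    ϖ≉0 e = ℚ.<-irrefl (≡.sym (≡.trans (∣∣-cong e) ∣0∣)) ∣ϖ∣>0

    -- 0 and 1 lie in different residue classes.
    2≤q : 2 ℕ.≤ q
    2≤q = distinct-residues q residue residue-covers
      where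
      distinct-residues : ∀ n (r : Fin n → Carrier) → (∀ x → 𝔒 x → ∃ λ i → 𝔪 (x - r i)) → 2 ℕ.≤ n
      distinct-residues zero c covers with () ← proj₁ (covers 0# 𝔒0)
      distinct-residues (suc (suc _)) _ _ = ℕ.s≤s (ℕ.s≤s ℕ.z≤n)
      distinct-residues (suc zero) r covers with covers 0# 𝔒0 | covers 1# 𝔒1
      ... | zero , a | zero , b = ⊥-elim (¬𝔪1 (𝔪-resp (solve 1 (λ r →
        (:1 :- r) :- (:0 :- r) := :1) refl (r zero)) (𝔪-- b a)))

    -- Otherwise q ≤ ∣ϖ∣ q = 1 by `normalized`, against 2 ≤ q.
    𝔪ϖ : 𝔪 ϖ
    𝔪ϖ with decide (𝔪 ϖ)
    ... | yes m = m
    ... | no ¬m = ⊥-elim (ℚ.<-irrefl ≡.refl (ℚ.<-≤-trans 1<2 (ℚ.≤-trans (2≤fromℕ q 2≤q) q≤1)))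
      where
      q≤1 : fromℕ q ℚ.≤ 1ℚ
      q≤1 = ≡.subst₂ ℚ._≤_ (ℚ.*-identityˡ (fromℕ q)) normalized
        (ℚ.*-monoʳ-≤-nonNeg (fromℕ q) {{ℚ.nonNegative (fromℕ-nonNeg q)}} (ℚ.≮⇒≥ ¬m))

    𝔒ϖ : 𝔒 ϖ
    𝔒ϖ = 𝔪⇒𝔒 𝔪ϖ

    ϖ-𝔪 : ∀ {x} → 𝔒 x → 𝔪 (ϖ * x)
    ϖ-𝔪 = 𝔪-*ˡ 𝔪ϖ

    𝔪-ϖ : ∀ {x} → 𝔪 (ϖ * x) → 𝔒 x
    𝔪-ϖ {x} m = ℚ.*-cancelˡ-≤-pos ∣ ϖ ∣ {{ℚ.positive ∣ϖ∣>0}}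
      (≡.subst₂ ℚ._≤_ (∣∣-mult ϖ x) (≡.sym (ℚ.*-identityʳ _)) (ϖ-generates (ϖ * x) m))

    𝔪-divide : ∀ {x} → 𝔪 x → ∃ λ y → 𝔒 y × (x ≈ ϖ * y)
    𝔪-divide {x} m = divide (inverse-of ϖ ϖ≉0)
      where
      divide : (∃ λ z → ϖ * z ≈ 1#) → ∃ λ y → 𝔒 y × (x ≈ ϖ * y)
      divide (z , e) = z * x , 𝔪-ϖ (𝔪-resp eq m) , eq
        where
        eq : x ≈ ϖ * (z * x)
        eq = combine₁ (- x) e (solve 3 (λ x ϖ z → x :- ϖ :* (z :* x) := (:- x) :* (ϖ :* z :- :1))
          refl x ϖ z)

  infix 9 ϖ^_
  ϖ^_ : ℕ → Carrier
  ϖ^ zero  = 1#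
  ϖ^ suc n = ϖ * ϖ^ n

  abstract
    𝔒ϖ^ : ∀ n → 𝔒 (ϖ^ n)
    𝔒ϖ^ zero    = 𝔒1
    𝔒ϖ^ (suc n) = 𝔒-* 𝔒ϖ (𝔒ϖ^ n)

    ϖ^≉0 : ∀ n → ¬ (ϖ^ n ≈ 0#)
    ϖ^≉0 zero    = 1≉0
    ϖ^≉0 (suc n) = *-nonzero ϖ (ϖ^ n) ϖ≉0 (ϖ^≉0 n)

    ϖ^-+ : ∀ m n → ϖ^ (m ℕ.+ n) ≈ ϖ^ m * ϖ^ n
    ϖ^-+ zero    n = sym (*-identityˡ _)
    ϖ^-+ (suc m) n = trans (*-congˡ (ϖ^-+ m n)) (sym (*-assoc _ _ _))

    ∣ϖ^∣ : ∀ n → ∣ ϖ^ n ∣ ≡ ∣ ϖ ∣ Rational.^ n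
    ∣ϖ^∣ zero    = ∣1∣
    ∣ϖ^∣ (suc n) = ≡.trans (∣∣-mult ϖ (ϖ^ n)) (≡.cong (∣ ϖ ∣ ℚ.*_) (∣ϖ^∣ n))

    ∣ϖ^∣-normalized : ∀ n → ∣ ϖ^ n ∣ ℚ.* fromℕ q Rational.^ n ≡ 1ℚ
    ∣ϖ^∣-normalized n = ≡.trans (≡.cong (ℚ._* fromℕ q Rational.^ n) (∣ϖ^∣ n))
      (≡.trans (≡.sym (^-distrib-* ∣ ϖ ∣ (fromℕ q) n)) (≡.trans (≡.cong (Rational._^ n) normalized)
        (1^n≡1 n)))

    -- Some natural number n bounds ∣x∣, and n ≤ qⁿ = ∣ϖⁿ∣⁻¹.
    scale : ∀ x → ∃ λ n → 𝔒 (ϖ^ n * x)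
    scale x with ≤-fromℕ ∣ x ∣
    ... | n , ∣x∣≤n = n , ℚ.≤-trans (ℚ.≤-reflexive (∣∣-mult (ϖ^ n) x)) (ℚ.≤-trans
        (ℚ.*-monoˡ-≤-nonNeg ∣ ϖ^ n ∣ {{ℚ.nonNegative (∣∣-nonneg (ϖ^ n))}}
          (ℚ.≤-trans ∣x∣≤n (proj₁ (fromℕ≤^ (2≤fromℕ q 2≤q) n))))
        (ℚ.≤-reflexive (∣ϖ^∣-normalized n)))

    scale-more : ∀ m n {x} → 𝔒 (ϖ^ n * x) → 𝔒 (ϖ^ (m ℕ.+ n) * x)
    scale-more m n {x} o = 𝔒-resp (trans (sym (*-assoc _ _ _)) (*-congʳ (sym (ϖ^-+ m n))))
      (𝔒-* (𝔒ϖ^ m) o)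

    scale₂ : ∀ x y → ∃ λ n → 𝔒 (ϖ^ n * x) × 𝔒 (ϖ^ n * y)
    scale₂ x y = common (scale x) (scale y)
      where
      common : (∃ λ m → 𝔒 (ϖ^ m * x)) → (∃ λ n → 𝔒 (ϖ^ n * y)) → ∃ λ n → 𝔒 (ϖ^ n * x) × 𝔒 (ϖ^ n * y)
      common (m , a) (n , b) =
        m ℕ.+ n , ≡.subst (λ k → 𝔒 (ϖ^ k * x)) (ℕ.+-comm n m) (scale-more n m a) , scale-more m n b

  HasValuation : Carrier → Set
  HasValuation x = ∃₂ λ n u → 𝔒 u × ¬ 𝔪 u × (x ≈ ϖ^ n * u)

  abstract
    -- The recursion needs a bound on the number of factors ϖ in x. It is an n for which ϖⁿ x⁻¹ is
    -- integral: each factor removed from x moves to the inverse, and `descend` counts n down.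
    valuation : ∀ x → 𝔒 x → ¬ (x ≈ 0#) → HasValuation x
    valuation x 𝔒x x≉0 = descend (proj₁ (scale y)) x y 𝔒x (proj₂ (inverse-of x x≉0))
      (proj₂ (scale y))
      where
      y : Carrier
      y = proj₁ (inverse-of x x≉0)

      no-factor : ∀ {x} → 𝔒 x → ¬ 𝔪 x → HasValuation x
      no-factor {x} 𝔒x u = 0 , x , 𝔒x , u , sym (*-identityˡ x)

      one-factor : ∀ {x x′} → x ≈ ϖ * x′ → HasValuation x′ → HasValuation x
      one-factor e (k , u , 𝔒u , ¬𝔪u , e′) = suc k , u , 𝔒u , ¬𝔪u ,
        trans e (trans (*-congˡ e′) (sym (*-assoc _ _ _)))

      descend : ∀ n x y → 𝔒 x → x * y ≈ 1# → 𝔒 (ϖ^ n * y) → HasValuation x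
      step : ∀ n x y → 𝔒 x → x * y ≈ 1# → 𝔒 (ϖ^ suc n * y) → Dec (𝔪 x) → HasValuation x

      descend zero    x y 𝔒x e o = no-factor 𝔒x (unit (𝔒-resp (*-identityˡ y) o) e)
      descend (suc n) x y 𝔒x e o = step n x y 𝔒x e o (decide (𝔪 x))

      step n x y 𝔒x e o (no u) = no-factor 𝔒x u
      step n x y 𝔒x e o (yes m) = one-factor (proj₂ (proj₂ (𝔪-divide m)))
        (descend n (proj₁ (𝔪-divide m)) (ϖ * y) (proj₁ (proj₂ (𝔪-divide m)))
          (trans (trans (sym (*-assoc _ ϖ y))
            (*-congʳ (trans (*-comm _ ϖ) (sym (proj₂ (proj₂ (𝔪-divide m))))))) e)
          (𝔒-resp (trans (*-congʳ (*-comm ϖ (ϖ^ n))) (*-assoc (ϖ^ n) ϖ y)) o))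

  nearest : ∀ e → 𝔒 e → Fin q
  nearest e 𝔒e = proj₁ (residue-covers e 𝔒e)

  abstract
    nearest-close : ∀ e 𝔒e → 𝔪 (residue (nearest e 𝔒e) - e)
    nearest-close e 𝔒e = 𝔪-resp (solve 2 (λ e r → :- (e :- r) := r :- e) refl e _)
      (𝔪-neg (proj₂ (residue-covers e 𝔒e)))

    nearest-unique : ∀ e 𝔒e i → 𝔪 (residue i - e) → i ≡ nearest e 𝔒e
    nearest-unique e 𝔒e i m = residue-unique i _
      (𝔪-resp (solve 3 (λ e a b → (a :- e) :- (b :- e) := a :- b) refl e (residue i)
      (residue (nearest e 𝔒e)))
      (𝔪-- m (nearest-close e 𝔒e)))

-- Truth values as rational numbers and finite sums

module Counting (lem : ExcludedMiddle 0ℓ) where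
  open Rational
  open IntegerCoefficients ℚ.+-*-commutativeRing

  ⟦_⟧ : Set → ℚ
  ⟦ P ⟧ = if does (lem {P}) then 1ℚ else 0ℚ

  ⟦⟧-true : ∀ {P} → P → ⟦ P ⟧ ≡ 1ℚ
  ⟦⟧-true {P} p with lem {P}
  ... | yes _ = ≡.refl
  ... | no ¬p = ⊥-elim (¬p p)

  ⟦⟧-false : ∀ {P} → ¬ P → ⟦ P ⟧ ≡ 0ℚ
  ⟦⟧-false {P} ¬p with lem {P}
  ... | yes p = ⊥-elim (¬p p)
  ... | no _  = ≡.refl

  ⟦⟧-cong : ∀ {P Q} → (P → Q) → (Q → P) → ⟦ P ⟧ ≡ ⟦ Q ⟧
  ⟦⟧-cong {P} {Q} f g with lem {Q}
  ... | yes q = ⟦⟧-true (g q)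
  ... | no ¬q = ⟦⟧-false (¬q ∘ f)

  ∑ : ∀ n → (Fin n → ℚ) → ℚ
  ∑ zero    f = 0ℚ
  ∑ (suc n) f = f zero ℚ.+ ∑ n (f ∘ suc)

  ∑-cong : ∀ n {f g : Fin n → ℚ} → (∀ i → f i ≡ g i) → ∑ n f ≡ ∑ n g
  ∑-cong zero    e = ≡.refl
  ∑-cong (suc n) e = ≡.cong₂ ℚ._+_ (e zero) (∑-cong n (e ∘ suc))

  ∑-*ˡ : ∀ n c (f : Fin n → ℚ) → ∑ n (λ i → c ℚ.* f i) ≡ c ℚ.* ∑ n f
  ∑-*ˡ zero    c f = ≡.sym (ℚ.*-zeroʳ c)
  ∑-*ˡ (suc n) c f = ≡.trans (≡.cong (c ℚ.* f zero ℚ.+_) (∑-*ˡ n c (f ∘ suc)))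
    (≡.sym (ℚ.*-distribˡ-+ c (f zero) (∑ n (f ∘ suc))))

  ∑-zero : ∀ n {f : Fin n → ℚ} → (∀ i → f i ≡ 0ℚ) → ∑ n f ≡ 0ℚ
  ∑-zero zero    e = ≡.refl
  ∑-zero (suc n) e = ≡.cong₂ ℚ._+_ (e zero) (∑-zero n (e ∘ suc))

  ∑-const : ∀ n v → ∑ n (λ _ → v) ≡ fromℕ n ℚ.* v
  ∑-const zero    v = ≡.sym (ℚ.*-zeroˡ v)
  ∑-const (suc n) v = ≡.trans (≡.cong (v ℚ.+_) (∑-const n v)) (≡.trans
    (solve 2 (λ v k → v :+ k :* v := (:1 :+ k) :* v) ≡.refl v (fromℕ n))
    (≡.cong (ℚ._* v) (≡.sym (fromℕ-suc n))))

  ∑-none : ∀ n {P : Fin n → Set} → (∀ i → ¬ P i) → ∑ n (λ i → ⟦ P i ⟧) ≡ 0ℚ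
  ∑-none n none = ∑-zero n (λ i → ⟦⟧-false (none i))

  ∑-all : ∀ n {P : Fin n → Set} → (∀ i → P i) → ∑ n (λ i → ⟦ P i ⟧) ≡ fromℕ n
  ∑-all n all = ≡.trans (∑-cong n (λ i → ⟦⟧-true (all i)))
    (≡.trans (∑-const n 1ℚ) (ℚ.*-identityʳ (fromℕ n)))

  ∑-one : ∀ n {P : Fin n → Set} (i₀ : Fin n) → P i₀ → (∀ i → P i → i ≡ i₀) → ∑ n (λ i → ⟦ P i ⟧) ≡
    1ℚ
  ∑-one (suc n) zero    p u = ≡.cong₂ ℚ._+_ (⟦⟧-true p) (∑-none n (λ i q → absurd (u (suc i) q)))
    where absurd : ∀ {n} {i : Fin n} → suc i ≡ zero → ⊥
          absurd ()
  ∑-one (suc n) (suc i₀) p u = ≡.cong₂ ℚ._+_ (⟦⟧-false (λ q → absurd (u zero q)))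
    (∑-one n i₀ p (λ i q → Fin.suc-injective (u (suc i) q)))
    where absurd : ∀ {n} {i : Fin n} → zero ≡ suc i → ⊥
          absurd ()

  ∑-two : ∀ n {P : Fin n → Set} (i₁ i₂ : Fin n) → i₁ ≢ i₂ → P i₁ → P i₂ →
          (∀ i → P i → i ≡ i₁ ⊎ i ≡ i₂) → ∑ n (λ i → ⟦ P i ⟧) ≡ 1ℚ ℚ.+ 1ℚ
  ∑-two n zero zero i₁≢i₂ _ _ _ = ⊥-elim (i₁≢i₂ ≡.refl)
  ∑-two (suc n) zero (suc i₂) _ p₁ p₂ u = ≡.cong₂ ℚ._+_ (⟦⟧-true p₁)
    (∑-one n i₂ p₂ (λ i q → other i (u (suc i) q)))
    where other : ∀ i → suc i ≡ zero ⊎ suc i ≡ suc i₂ → i ≡ i₂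
          other i (inj₁ ())
          other i (inj₂ e) = Fin.suc-injective e
  ∑-two (suc n) (suc i₁) zero _ p₁ p₂ u = ≡.cong₂ ℚ._+_ (⟦⟧-true p₂)
    (∑-one n i₁ p₁ (λ i q → other i (u (suc i) q)))
    where other : ∀ i → suc i ≡ suc i₁ ⊎ suc i ≡ zero → i ≡ i₁
          other i (inj₁ e) = Fin.suc-injective e
          other i (inj₂ ())
  ∑-two (suc n) (suc i₁) (suc i₂) ne p₁ p₂ u = ≡.cong₂ ℚ._+_ (⟦⟧-false (λ q → neither (u zero q)))
    (∑-two n i₁ i₂ (ne ∘ ≡.cong suc) p₁ p₂ (λ i q → other i (u (suc i) q)))
    where other : ∀ i → suc i ≡ suc i₁ ⊎ suc i ≡ suc i₂ → i ≡ i₁ ⊎ i ≡ i₂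
          other i (inj₁ e) = inj₁ (Fin.suc-injective e)
          other i (inj₂ e) = inj₂ (Fin.suc-injective e)
          neither : ¬ (Fin.zero ≡ suc i₁ ⊎ Fin.zero ≡ suc i₂)
          neither (inj₁ ())
          neither (inj₂ ())

-- Stable neighbours as zeros of a quadratic form

module Neighbours (lem : ExcludedMiddle 0ℓ) (F : LocalField)
                  (T N : LocalField.Carrier F) (𝔒T : LocalField.𝔒 F T) (𝔒N : LocalField.𝔒 F N) where
  open LocalField F hiding (zero)
  open IntegerCoefficients commRing
  open LinearCombination commRing
  open Valuation lem F
  open Counting lem
  open Rational using (fromℕ)

  Divides² : Carrier → Set
  Divides² x = ∃ λ y → 𝔒 y × (x ≈ ϖ * (ϖ * y))

  abstract
    divides²-resp : ∀ {x y} → x ≈ y → Divides² x → Divides² y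
    divides²-resp e (z , 𝔒z , x≈) = z , 𝔒z , trans (sym e) x≈

    divides²-+ : ∀ {x y} → Divides² x → Divides² y → Divides² (x + y)
    divides²-+ (a , 𝔒a , ea) (b , 𝔒b , eb) = a + b , 𝔒-+ 𝔒a 𝔒b ,
      trans (+-cong ea eb) (solve 3 (λ a b ϖ → ϖ :* (ϖ :* a) :+ ϖ :* (ϖ :* b)
        := ϖ :* (ϖ :* (a :+ b))) refl a b ϖ)

    divides²-* : ∀ {x y} → 𝔒 x → Divides² y → Divides² (x * y)
    divides²-* {x} 𝔒x (b , 𝔒b , eb) = x * b , 𝔒-* 𝔒x 𝔒b ,
      trans (*-congˡ eb) (solve 3 (λ x b ϖ → x :* (ϖ :* (ϖ :* b)) := ϖ :* (ϖ :* (x :* b))) refl x b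
        ϖ)

    divides²-𝔪𝔪 : ∀ {x y} → 𝔪 x → 𝔪 y → Divides² (x * y)
    divides²-𝔪𝔪 {x} {y} mx my = combine (𝔪-divide mx) (𝔪-divide my)
      where
      combine : (∃ λ a → 𝔒 a × (x ≈ ϖ * a)) → (∃ λ b → 𝔒 b × (y ≈ ϖ * b)) → Divides² (x * y)
      combine (a , 𝔒a , ea) (b , 𝔒b , eb) = a * b , 𝔒-* 𝔒a 𝔒b ,
        trans (*-cong ea eb) (solve 3 (λ a b ϖ → (ϖ :* a) :* (ϖ :* b) := ϖ :* (ϖ :* (a :* b))) refl
          a b ϖ)

  :Q : ∀ {n} (p r s p′ e : Polynomial n) → Polynomial n
  :Q p r s p′ e = (r :+ e :* (p :- p′)) :- e :* e :* s

  -- The behaviour of X² - T X + N over the residue field; the index is chosen so that the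
  -- polynomial has 1 + κ roots there.
  data Splitting : Sign → Set where
    inert : (∀ y → 𝔒 y → ¬ 𝔪 (y * y - T * y + N)) → Splitting Sign.-
    split : ∀ y₁ y₂ → 𝔒 y₁ → 𝔒 y₂ → y₁ + y₂ ≈ T → y₁ * y₂ ≈ N → ¬ 𝔪 (y₁ - y₂) → Splitting Sign.+

  module _ (p r s p′ : Carrier) (trace : p + p′ ≈ T) (determinant : p * p′ - r * s ≈ N) where

    -- The upper right entry of [[p , r] , [s , p′]] after conjugation by the unipotent matrix with
    -- entry e. As a form in e its discriminant is (p - p′)² + 4 r s = T² - 4N, and s is, up to
    -- sign, its value at infinity.
    Q : Carrier → Carrier
    Q e = (r + e * (p - p′)) - e * e * s

    abstract
      diagonal-equation : ∀ c →
        (c * p) * (c * p) ≈ (c * T) * (c * p) + - ((c * r) * (c * s) + c * c * N)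
      diagonal-equation c = combine₂ (c * c * p) (- (c * c)) trace determinant
        (solve 7 (λ p r s p′ T N c →
        (c :* p) :* (c :* p) :- ((c :* T) :* (c :* p) :+ (:- ((c :* r) :* (c :* s) :+ c :* c :* N)))
        := (c :* c :* p) :* (p :+ p′ :- T) :+ (:- (c :* c)) :* (p :* p′ :- r :* s :- N)) refl p r s
          p′ T N c)

      -- c p is a root of X² - c T X + (c r · c s + c² N), whose coefficients are integral. Hence
      -- integrality need only be recorded for the off-diagonal entries.
      diagonal-integral : ∀ {c} → 𝔒 c → 𝔒 (c * r) → 𝔒 (c * s) → 𝔒 (c * p)
      diagonal-integral {c} 𝔒c 𝔒cr 𝔒cs = root-𝔒 {a = c * T} {b = - ((c * r) * (c * s) + c * c * N)}
        (𝔒-* 𝔒c 𝔒T) (𝔒-neg (𝔒-+ (𝔒-* 𝔒cr 𝔒cs) (𝔒-* (𝔒-* 𝔒c 𝔒c) 𝔒N)))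
        (diagonal-equation c)

      diagonal-integral′ : ∀ {c} → 𝔒 c → 𝔒 (c * r) → 𝔒 (c * s) → 𝔒 (c * p′)
      diagonal-integral′ {c} 𝔒c 𝔒cr 𝔒cs = 𝔒-resp (combine₁ (- c) trace (solve 4 (λ p p′ T c →
          (c :* T :- c :* p) :- c :* p′ := (:- c) :* (p :+ p′ :- T)) refl p p′ T c))
        (𝔒-- (𝔒-* 𝔒c 𝔒T) (diagonal-integral 𝔒c 𝔒cr 𝔒cs))

      𝔒-Q : ∀ {c e} → 𝔒 c → 𝔒 e → 𝔒 (c * r) → 𝔒 (c * s) → 𝔒 (c * Q e)
      𝔒-Q {c} {e} 𝔒c 𝔒e 𝔒cr 𝔒cs = 𝔒-resp (solve 6 (λ p r s p′ c e →
          (c :* r :+ e :* (c :* p :- c :* p′)) :- e :* e :* (c :* s) := c :* :Q p r s p′ e) refl p r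
            s p′ c e)
        (𝔒-- (𝔒-+ 𝔒cr (𝔒-* 𝔒e (𝔒-- (diagonal-integral 𝔒c 𝔒cr 𝔒cs) (diagonal-integral′ 𝔒c 𝔒cr 𝔒cs))))
          (𝔒-* (𝔒-* 𝔒e 𝔒e) 𝔒cs))

      -- The substitute for completing the square: up to the factor - c s, the form c Q becomes the
      -- norm form at (w , c) with w = c (s e - p). No division by 2 occurs.
      norm-identity : ∀ c e → - (c * s) * (c * Q e) ≈
        (c * s * e - c * p) * (c * s * e - c * p) + c * T * (c * s * e - c * p) + c * c * N
      norm-identity c e = combine₂ (c * (c * s * e - c * p)) (c * c) trace determinant
        (solve 8 (λ p r s p′ T N c e →
        (:- (c :* s)) :* (c :* :Q p r s p′ e) :-
        ((c :* s :* e :- c :* p) :* (c :* s :* e :- c :* p) :+ c :* T :* (c :* s :* e :- c :* p)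
          :+ c :* c :* N)
        := (c :* (c :* s :* e :- c :* p)) :* (p :+ p′ :- T) :+ (c :* c) :* (p :* p′ :- r :* s :- N))
          refl p r s p′ T N c e)

      -- Conjugating back by the unipotent matrix with entry - e recovers r. The diagonal entry p -
      -- e s met on the way is integral for the same reason as in `diagonal-integral`.
      Q-integral⇒r-integral : ∀ {c e} → 𝔒 c → 𝔒 e → 𝔒 (c * Q e) → 𝔒 (c * s) → 𝔒 (c * r)
      Q-integral⇒r-integral {c} {e} 𝔒c 𝔒e 𝔒cQ 𝔒cs =
        𝔒-resp (combine₁ (- (e * c)) trace (solve 7 (λ p r s p′ T c e →
          ((c :* :Q p r s p′ e :- e :* (c :* (p :- e :* s) :+ c :* (p :- e :* s) :- c :* T)) :- e
            :* e :* (c :* s)) :- c :* r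
          := (:- (e :* c)) :* (p :+ p′ :- T)) refl p r s p′ T c e))
        (𝔒-- (𝔒-- 𝔒cQ (𝔒-* 𝔒e (𝔒-- (𝔒-+ 𝔒c[p-es] 𝔒c[p-es]) (𝔒-* 𝔒c 𝔒T)))) (𝔒-* (𝔒-* 𝔒e 𝔒e) 𝔒cs))
        where
        𝔒c[p-es] : 𝔒 (c * (p - e * s))
        𝔒c[p-es] = root-𝔒 {a = c * T} {b = - ((c * Q e) * (c * s) + c * c * N)}
          (𝔒-* 𝔒c 𝔒T) (𝔒-neg (𝔒-+ (𝔒-* 𝔒cQ 𝔒cs) (𝔒-* (𝔒-* 𝔒c 𝔒c) 𝔒N)))
          (combine₂ (c * c * (p - e * s)) (- (c * c)) trace determinant
            (solve 8 (λ p r s p′ T N c e →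
            (c :* (p :- e :* s)) :* (c :* (p :- e :* s))
              :- ((c :* T) :* (c :* (p :- e :* s))
              :+ (:- ((c :* :Q p r s p′ e) :* (c :* s) :+ c :* c :* N)))
            := (c :* c :* (p :- e :* s)) :* (p :+ p′ :- T) :+ (:- (c :* c))
              :* (p :* p′ :- r :* s :- N)) refl p r s p′ T N c e))

    -- Exactly one zero of c Q on the projective line over the residue field, at infinity in the
    -- first alternative and at e₀ in the second. As the zero is double, the value there is
    -- divisible by ϖ² and not merely by ϖ.
    OneRoot : (c : Carrier) → Set
    OneRoot c = (Divides² (c * s) × (∀ e → 𝔒 e → ¬ 𝔪 (c * Q e))) ⊎
                (¬ 𝔪 (c * s) × ∃ λ e₀ → 𝔒 e₀ × (∀ e → 𝔒 e →
                  (𝔪 (e - e₀) → Divides² (c * Q e)) × (𝔪 (c * Q e) → 𝔪 (e - e₀))))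

    abstract
      -- Modulo ϖ the form c Q is a nonzero multiple of the square of a linear form.
      primitive-one-root : ∀ {c} → 𝔪 c → 𝔒 (c * r) → 𝔒 (c * s) → ¬ (𝔪 (c * r) × 𝔪 (c * s)) →
        OneRoot c
      primitive-one-root {c} 𝔪c 𝔒cr 𝔒cs nonzero = cases (decide (𝔪 (c * s)))
        where
        𝔒c : 𝔒 c
        𝔒c = 𝔪⇒𝔒 𝔪c
        𝔒cp : 𝔒 (c * p)
        𝔒cp = diagonal-integral 𝔒c 𝔒cr 𝔒cs

        infinite : 𝔪 (c * s) → (∃ λ y → 𝔒 y × ((c * r) * y ≈ 1#)) → ¬ 𝔪 (c * r) → OneRoot c
        infinite 𝔪cs (y , 𝔒y , e) ¬𝔪cr = inj₁ (
          -- Here c r is a unit, and c r · c s = c T · c p - (c p)² - N c² is divisible by ϖ²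
          -- because c and c p lie in 𝔪.
          divides²-resp (combine₃ (- (c * c * p * y)) (c * c * y) (c * s) trace determinant e
            (solve 8 (λ p r s p′ T N c y →
              y :* (((c :* T) :* (c :* p) :+ (:- (c :* p)) :* (c :* p)) :+ (:- N) :* (c :* c)) :- c
                :* s
              := (:- (c :* c :* p :* y)) :* (p :+ p′ :- T) :+ (c :* c :* y)
                :* (p :* p′ :- r :* s :- N) :+ (c :* s) :* ((c :* r) :* y :- :1)) refl p r s p′ T N
                c y))
            (divides²-* 𝔒y (divides²-+ (divides²-+ (divides²-𝔪𝔪 (𝔪-*ˡ 𝔪c 𝔒T) 𝔪cp)
              (divides²-𝔪𝔪 (𝔪-neg 𝔪cp) 𝔪cp))
              (divides²-* (𝔒-neg 𝔒N) (divides²-𝔪𝔪 𝔪c 𝔪c)))) ,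
          λ e 𝔒e 𝔪cQ → ¬𝔪cr (𝔪-resp (combine₁ (- (c * e)) trace (solve 7 (λ p r s p′ T c e →
              ((c :* :Q p r s p′ e :- e :* (c :* p :+ c :* p :- c :* T)) :+ e :* e :* (c :* s)) :- c
                :* r
              := (:- (c :* e)) :* (p :+ p′ :- T)) refl p r s p′ T c e))
            (𝔪-+ (𝔪-- 𝔪cQ (𝔪-*ʳ 𝔒e (𝔪-- (𝔪-+ 𝔪cp 𝔪cp) (𝔪-*ˡ 𝔪c 𝔒T)))) (𝔪-*ʳ (𝔒-* 𝔒e 𝔒e) 𝔪cs))))
          where
          𝔪cp : 𝔪 (c * p)
          𝔪cp = root-𝔪 {a = c * T} {b = - ((c * r) * (c * s) + c * c * N)}
            (𝔪-*ˡ 𝔪c 𝔒T) (𝔪-neg (𝔪-+ (𝔪-*ʳ 𝔒cr 𝔪cs) (𝔪-*ˡ (𝔪-*ˡ 𝔪c 𝔒c) 𝔒N)))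
            (diagonal-equation c)

        finite : ¬ 𝔪 (c * s) → (∃ λ y → 𝔒 y × ((c * s) * y ≈ 1#)) → OneRoot c
        -- The zero is e₀ = p / s, where w vanishes. By `norm-identity` the value - c s · c Q is w²
        -- modulo 𝔪, and modulo ϖ² it is zero once w lies in 𝔪.
        finite ¬𝔪cs (y , 𝔒y , sy≈1) = inj₂ (¬𝔪cs , c * p * y , 𝔒-* 𝔒cp 𝔒y ,
          λ e 𝔒e → near⇒divides e 𝔒e , root⇒near e 𝔒e)
          where
          w : Carrier → Carrier
          w e = c * s * e - c * p

          w-root : ∀ e → w e ≈ (c * s) * (e - c * p * y)
          w-root e = combine₁ (c * p) sy≈1 (solve 5 (λ c s e p y →
            (c :* s :* e :- c :* p) :- (c :* s) :* (e :- c :* p :* y)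
              := (c :* p) :* ((c :* s) :* y :- :1)) refl c s e p y)

          near⇒divides : ∀ e → 𝔒 e → 𝔪 (e - c * p * y) → Divides² (c * Q e)
          near⇒divides e 𝔒e m = divides²-resp
            (combine₂ y (c * Q e) (norm-identity c e) sy≈1 (solve 4 (λ cs cQ R y →
              (:- y) :* R :- cQ := y :* ((:- cs) :* cQ :- R) :+ cQ :* (cs :* y :- :1))
              refl (c * s) (c * Q e) (w e * w e + c * T * w e + c * c * N) y))
            (divides²-* (𝔒-neg 𝔒y) (divides²-+
              (divides²-+ (divides²-𝔪𝔪 𝔪w 𝔪w) (divides²-𝔪𝔪 (𝔪-*ˡ 𝔪c 𝔒T) 𝔪w))
              (divides²-resp (*-comm _ _) (divides²-* 𝔒N (divides²-𝔪𝔪 𝔪c 𝔪c)))))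
            where
            𝔪w : 𝔪 (w e)
            𝔪w = 𝔪-resp (sym (w-root e)) (𝔪-*ʳ 𝔒cs m)

          root⇒near : ∀ e → 𝔒 e → 𝔪 (c * Q e) → 𝔪 (e - c * p * y)
          root⇒near e 𝔒e m = 𝔪-resp (combine₁ (e - c * p * y) sy≈1 (solve 3 (λ y cs z →
              y :* (cs :* z) :- z := z :* (cs :* y :- :1)) refl y (c * s) (e - c * p * y)))
                (𝔪-*ʳ 𝔒y (𝔪-resp (w-root e) 𝔪w))
            where
            𝔒w : 𝔒 (w e)
            𝔒w = 𝔒-- (𝔒-* 𝔒cs 𝔒e) 𝔒cp
            𝔪w : 𝔪 (w e)
            𝔪w = 𝔪-square (𝔪-resp (combine₁ 1# (norm-identity c e) (solve 4 (λ l a b d →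
                ((l :- b) :- d) :- a := :1 :* (l :- (a :+ b :+ d))) refl
                (- (c * s) * (c * Q e)) (w e * w e) (c * T * w e) (c * c * N)))
              (𝔪-- (𝔪-- (𝔪-*ʳ (𝔒-neg 𝔒cs) m) (𝔪-*ˡ (𝔪-*ˡ 𝔪c 𝔒T) 𝔒w)) (𝔪-*ˡ (𝔪-*ˡ 𝔪c 𝔒c) 𝔒N)))

        cases : Dec (𝔪 (c * s)) → OneRoot c
        cases (yes 𝔪cs) = infinite 𝔪cs (unit-inverse ¬𝔪cr) ¬𝔪cr
          where ¬𝔪cr : ¬ 𝔪 (c * r)
                ¬𝔪cr 𝔪cr = nonzero (𝔪cr , 𝔪cs)
        cases (no ¬𝔪cs) = finite ¬𝔪cs (unit-inverse ¬𝔪cs)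

      characteristic : ∀ e → - s * Q e ≈ (p - s * e) * (p - s * e) - T * (p - s * e) + N
      characteristic e = combine₂ (s * e - p) 1# trace determinant (solve 7 (λ p r s p′ T N e →
        (:- s) :* :Q p r s p′ e :- ((p :- s :* e) :* (p :- s :* e) :- T :* (p :- s :* e) :+ N)
        := (s :* e :- p) :* (p :+ p′ :- T) :+ :1 :* (p :* p′ :- r :* s :- N)) refl p r s p′ T N e)

      characteristic-p : - r * s ≈ p * p - T * p + N
      characteristic-p = combine₂ (- p) 1# trace determinant (solve 6 (λ p r s p′ T N →
        (:- r) :* s :- (p :* p :- T :* p :+ N)
        := (:- p) :* (p :+ p′ :- T) :+ :1 :* (p :* p′ :- r :* s :- N)) refl p r s p′ T N)

    RootCount : ℚ → Set
    RootCount v = ∑ q (λ i → ⟦ 𝔪 (Q (residue i)) ⟧) ℚ.+ ⟦ 𝔪 s ⟧ ≡ v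

    abstract
      -- The zeros are the eigenlines of the matrix over the residue field. By `characteristic` a
      -- zero makes p - s e a root of X² - T X + N, so the inert case has none; in the split case
      -- one of the two may be the point at infinity.
      unramified-roots : ∀ {κ} → Splitting κ → 𝔒 r → 𝔒 s → RootCount (1ℚ ℚ.+ signℚ κ)
      unramified-roots sp 𝔒r 𝔒s = by-type sp
        where
        𝔒p : 𝔒 p
        𝔒p = 𝔒-resp (*-identityˡ p) (diagonal-integral 𝔒1 (𝔒-resp (sym (*-identityˡ r)) 𝔒r)
          (𝔒-resp (sym (*-identityˡ s)) 𝔒s))

        module _ (y₁ y₂ : Carrier) (𝔒y₁ : 𝔒 y₁) (𝔒y₂ : 𝔒 y₂) (sum : y₁ + y₂ ≈ T)
          (product : y₁ * y₂ ≈ N) (distinct : ¬ 𝔪 (y₁ - y₂)) where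
          factor : ∀ y → y * y - T * y + N ≈ (y - y₁) * (y - y₂)
          factor y = combine₂ y (- 1#) sum product (solve 5 (λ y y₁ y₂ T N →
            (y :* y :- T :* y :+ N) :- (y :- y₁) :* (y :- y₂)
              := y :* (y₁ :+ y₂ :- T) :+ (:- :1) :* (y₁ :* y₂ :- N)) refl y y₁ y₂ T N)

          -- With s in 𝔪, - r s = (p - y₁)(p - y₂) puts p near one of the roots, and p - p′ = (p -
          -- y₁) + (p - y₂) is then ±(y₁ - y₂) modulo 𝔪.
          p-p′-unit : 𝔪 s → ¬ 𝔪 (p - p′)
          p-p′-unit 𝔪s 𝔪g = by-root (𝔪-prime (𝔪-resp (trans characteristic-p (factor p))
            (𝔪-*ʳ (𝔒-neg 𝔒r) 𝔪s)))
            where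
            g : p - p′ ≈ (p - y₁) + (p - y₂)
            g = combine₂ (- 1#) 1# trace sum
              (solve 5 (λ p p′ y₁ y₂ T → (p :- p′) :- ((p :- y₁) :+ (p :- y₂)) :=
              (:- :1) :* (p :+ p′ :- T) :+ :1 :* (y₁ :+ y₂ :- T)) refl p p′ y₁ y₂ T)
            𝔪Σ : 𝔪 ((p - y₁) + (p - y₂))
            𝔪Σ = 𝔪-resp g 𝔪g
            by-root : 𝔪 (p - y₁) ⊎ 𝔪 (p - y₂) → ⊥
            by-root (inj₁ m) = distinct
              (𝔪-resp (solve 3 (λ a b p → (((p :- a) :+ (p :- b)) :- (p :- a)) :- (p :- a)
              := a :- b) refl y₁ y₂ p) (𝔪-- (𝔪-- 𝔪Σ m) m))
            by-root (inj₂ m) = distinct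
              (𝔪-resp (solve 3 (λ a b p → :- ((((p :- a) :+ (p :- b)) :- (p :- b)) :- (p :- b))
              := a :- b) refl y₁ y₂ p) (𝔪-neg (𝔪-- (𝔪-- 𝔪Σ m) m)))

          one-finite-root : 𝔪 s → (∃ λ g → 𝔒 g × ((p - p′) * g ≈ 1#)) → RootCount (1ℚ ℚ.+ 1ℚ)
          one-finite-root 𝔪s (g , 𝔒g , pg≈1) =
            ≡.cong₂ ℚ._+_ (∑-one q (nearest e₀ 𝔒e₀)
            (near⇒root _ (residue-𝔒 _) (nearest-close e₀ 𝔒e₀))
              (λ i m → nearest-unique e₀ 𝔒e₀ i (root⇒near _ (residue-𝔒 i) m))) (⟦⟧-true 𝔪s)
            where
            -- Modulo 𝔪 the form is the linear polynomial r + e (p - p′).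
            e₀ : Carrier
            e₀ = - (r * g)
            𝔒e₀ : 𝔒 e₀
            𝔒e₀ = 𝔒-neg (𝔒-* 𝔒r 𝔒g)
            𝔒p-p′ : 𝔒 (p - p′)
            𝔒p-p′ = 𝔒-resp (combine₁ 1# trace
              (solve 3 (λ p p′ T → (p :+ p :- T) :- (p :- p′) := :1 :* (p :+ p′ :- T)) refl p p′ T))
              (𝔒-- (𝔒-+ 𝔒p 𝔒p) 𝔒T)
            Q≈ : ∀ e → Q e ≈ (p - p′) * (e - e₀) - e * e * s
            Q≈ e = combine₁ (- r) pg≈1
              (solve 6 (λ p p′ r s e g →
              :Q p r s p′ e :- ((p :- p′) :* (e :- (:- (r :* g))) :- e :* e :* s)
              := (:- r) :* ((p :- p′) :* g :- :1)) refl p p′ r s e g)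
            near⇒root : ∀ e → 𝔒 e → 𝔪 (e - e₀) → 𝔪 (Q e)
            near⇒root e 𝔒e m = 𝔪-resp (sym (Q≈ e)) (𝔪-- (𝔪-*ʳ 𝔒p-p′ m) (𝔪-*ʳ (𝔒-* 𝔒e 𝔒e) 𝔪s))
            root⇒near : ∀ e → 𝔒 e → 𝔪 (Q e) → 𝔪 (e - e₀)
            root⇒near e 𝔒e m = 𝔪-resp (combine₂ g (e - e₀) (Q≈ e) pg≈1 (solve 5 (λ d z s′ g Q →
                g :* (Q :+ s′) :- z := g :* (Q :- (d :* z :- s′)) :+ z :* (d :* g :- :1)) refl
                  (p - p′) (e - e₀) (e * e * s) g (Q e)))
              (𝔪-*ʳ 𝔒g (𝔪-+ m (𝔪-*ʳ (𝔒-* 𝔒e 𝔒e) 𝔪s)))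

          two-finite-roots : ¬ 𝔪 s → (∃ λ y → 𝔒 y × (s * y ≈ 1#)) → RootCount (1ℚ ℚ.+ 1ℚ)
          two-finite-roots ¬𝔪s (y , 𝔒y , sy≈1) = ≡.trans (≡.cong₂ ℚ._+_
              (∑-two q (nearest e₁ 𝔒e₁) (nearest e₂ 𝔒e₂) nearest≢
                (near⇒root _ (residue-𝔒 _) (inj₁ (nearest-close e₁ 𝔒e₁)))
                (near⇒root _ (residue-𝔒 _) (inj₂ (nearest-close e₂ 𝔒e₂)))
                (λ i m → nearest-root i (root⇒near _ (residue-𝔒 i) m)))
              (⟦⟧-false ¬𝔪s)) (ℚ.+-identityʳ (1ℚ ℚ.+ 1ℚ))
            where
            -- These solve p - s e = y₁ and p - s e = y₂.
            e₁ e₂ : Carrier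
            e₁ = (p - y₁) * y
            e₂ = (p - y₂) * y
            𝔒e₁ : 𝔒 e₁
            𝔒e₁ = 𝔒-* (𝔒-- 𝔒p 𝔒y₁) 𝔒y
            𝔒e₂ : 𝔒 e₂
            𝔒e₂ = 𝔒-* (𝔒-- 𝔒p 𝔒y₂) 𝔒y
            Q≈ : ∀ e → - s * Q e ≈ (s * (e - e₁)) * (s * (e - e₂))
            Q≈ e = trans (trans (characteristic e) (factor (p - s * e)))
              (combine₂ (- ((p - y₁) * (p - s * e - y₂))) ((p - y₂) * (s * (e - e₁))) sy≈1 sy≈1
                (solve 6 (λ p s e y₁ y₂ y →
                (p :- s :* e :- y₁) :* (p :- s :* e :- y₂) :- (s :* (e :- (p :- y₁) :* y))
                  :* (s :* (e :- (p :- y₂) :* y))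
                := (:- ((p :- y₁) :* (p :- s :* e :- y₂))) :* (s :* y :- :1)
                  :+ ((p :- y₂) :* (s :* (e :- (p :- y₁) :* y))) :* (s :* y :- :1)) refl p s e y₁ y₂
                  y))
            nearest≢ : nearest e₁ 𝔒e₁ ≢ nearest e₂ 𝔒e₂
            nearest≢ same = distinct (𝔪-resp (combine₁ (y₁ - y₂) sy≈1 (solve 5 (λ p s y₁ y₂ y →
                s :* ((p :- y₂) :* y :- (p :- y₁) :* y) :- (y₁ :- y₂)
                  := (y₁ :- y₂) :* (s :* y :- :1)) refl p s y₁ y₂ y))
              (𝔪-*ʳ 𝔒s (𝔪-resp (solve 3 (λ a b c → (c :- a) :- (c :- b) := b :- a) refl e₁ e₂
                (residue (nearest e₁ 𝔒e₁)))
                (𝔪-- (nearest-close e₁ 𝔒e₁) (≡.subst (λ i → 𝔪 (residue i - e₂)) (≡.sym same)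
                  (nearest-close e₂ 𝔒e₂))))))
            near⇒root : ∀ e → 𝔒 e → 𝔪 (e - e₁) ⊎ 𝔪 (e - e₂) → 𝔪 (Q e)
            near⇒root e 𝔒e m = cancel-s (𝔪-prime (𝔪-resp (sym (Q≈ e)) (product-𝔪 m)))
              where
              product-𝔪 : 𝔪 (e - e₁) ⊎ 𝔪 (e - e₂) → 𝔪 ((s * (e - e₁)) * (s * (e - e₂)))
              product-𝔪 (inj₁ m) = 𝔪-*ˡ (𝔪-*ʳ 𝔒s m) (𝔒-* 𝔒s (𝔒-- 𝔒e 𝔒e₂))
              product-𝔪 (inj₂ m) = 𝔪-*ʳ (𝔒-* 𝔒s (𝔒-- 𝔒e 𝔒e₁)) (𝔪-*ʳ 𝔒s m)
              cancel-s : 𝔪 (- s) ⊎ 𝔪 (Q e) → 𝔪 (Q e)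
              cancel-s (inj₁ m) = ⊥-elim
                (¬𝔪s (𝔪-resp (solve 1 (λ s → :- (:- s) := s) refl s) (𝔪-neg m)))
              cancel-s (inj₂ m) = m
            cancel-s : ∀ {x} → 𝔪 (s * x) → 𝔪 x
            cancel-s m = by-factor (𝔪-prime m)
              where
              by-factor : ∀ {x} → 𝔪 s ⊎ 𝔪 x → 𝔪 x
              by-factor (inj₁ m) = ⊥-elim (¬𝔪s m)
              by-factor (inj₂ m) = m
            root⇒near : ∀ e → 𝔒 e → 𝔪 (Q e) → 𝔪 (e - e₁) ⊎ 𝔪 (e - e₂)
            root⇒near e 𝔒e m = by-factor (𝔪-prime (𝔪-resp (Q≈ e) (𝔪-*ʳ (𝔒-neg 𝔒s) m)))
              where
              by-factor : 𝔪 (s * (e - e₁)) ⊎ 𝔪 (s * (e - e₂)) → 𝔪 (e - e₁) ⊎ 𝔪 (e - e₂)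
              by-factor (inj₁ m) = inj₁ (cancel-s m)
              by-factor (inj₂ m) = inj₂ (cancel-s m)
            nearest-root : ∀ i → 𝔪 (residue i - e₁) ⊎ 𝔪 (residue i - e₂) → i ≡ nearest e₁ 𝔒e₁ ⊎ i ≡
              nearest e₂ 𝔒e₂
            nearest-root i (inj₁ m) = inj₁ (nearest-unique e₁ 𝔒e₁ i m)
            nearest-root i (inj₂ m) = inj₂ (nearest-unique e₂ 𝔒e₂ i m)

          roots : Dec (𝔪 s) → RootCount (1ℚ ℚ.+ 1ℚ)
          roots (yes 𝔪s) = one-finite-root 𝔪s (unit-inverse (p-p′-unit 𝔪s))
          roots (no ¬𝔪s) = two-finite-roots ¬𝔪s (unit-inverse ¬𝔪s)

        by-type : ∀ {κ} → Splitting κ → RootCount (1ℚ ℚ.+ signℚ κ)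
        by-type (split y₁ y₂ 𝔒y₁ 𝔒y₂ sum product distinct) = roots y₁ y₂ 𝔒y₁ 𝔒y₂ sum product
          distinct (decide (𝔪 s))
        by-type (inert noroot) = ≡.cong₂ ℚ._+_
          (∑-none q (λ i m → noroot _ (𝔒-- 𝔒p (𝔒-* 𝔒s (residue-𝔒 i)))
            (𝔪-resp (characteristic _) (𝔪-*ʳ (𝔒-neg 𝔒s) m))))
          (⟦⟧-false (λ 𝔪s → noroot p 𝔒p (𝔪-resp characteristic-p (𝔪-*ʳ (𝔒-neg 𝔒r) 𝔪s))))

    Level : ℕ → Set
    Level n = 𝔒 (ϖ^ n * r) × 𝔒 (ϖ^ n * s)

    -- Q e / ϖ and ϖ s are the off-diagonal entries for the e-th neighbour, ϖ r and
    -- s / ϖ those for the neighbour at infinity.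
    FiniteNeighbour : ℕ → Fin q → Set
    FiniteNeighbour n i = 𝔪 (ϖ^ n * Q (residue i)) × 𝔒 (ϖ^ suc n * s)

    InfiniteNeighbour : ℕ → Set
    InfiniteNeighbour n = 𝔪 (ϖ^ n * s) × 𝔒 (ϖ^ suc n * r)

    neighbours : ℕ → ℚ
    neighbours n = ∑ q (λ i → ⟦ FiniteNeighbour n i ⟧) ℚ.+ ⟦ InfiniteNeighbour n ⟧

    abstract
      raise : ∀ n {x} → 𝔒 (ϖ^ n * x) → 𝔪 (ϖ^ suc n * x)
      raise n {x} o = 𝔪-resp (sym (*-assoc ϖ (ϖ^ n) x)) (ϖ-𝔪 o)

      lower : ∀ n {x} → 𝔪 (ϖ^ suc n * x) → 𝔒 (ϖ^ n * x)
      lower n {x} m = 𝔪-ϖ (𝔪-resp (*-assoc ϖ (ϖ^ n) x) m)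

      lower² : ∀ n {x} → Divides² (ϖ^ suc n * x) → 𝔪 (ϖ^ n * x)
      lower² n {x} (y , 𝔒y , e) = 𝔪-resp (sym (*-cancel ϖ ϖ≉0 (trans (sym (*-assoc ϖ (ϖ^ n) x)) e)))
        (ϖ-𝔪 𝔒y)

      divides²⇒𝔪 : ∀ {x} → Divides² x → 𝔪 x
      divides²⇒𝔪 (y , 𝔒y , e) = 𝔪-resp (sym e) (ϖ-𝔪 (𝔒-* 𝔒ϖ 𝔒y))

      level-suc : ∀ n → Level n → Level (suc n)
      level-suc n (a , b) = 𝔪⇒𝔒 (raise n a) , 𝔪⇒𝔒 (raise n b)

      -- The scale c is separate from the level n because the zero found at c = ϖⁿ⁺¹ serves two
      -- counts: being a neighbour at level n asks for divisibility of c Q by ϖ², at level n + 1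
      -- only by ϖ. `OneRoot` gives the stronger property at the zero and excludes the weaker one
      -- elsewhere.
      exactly-one : ∀ n c → OneRoot c →
        (∀ i → Divides² (c * Q (residue i)) → FiniteNeighbour n i) →
          (∀ i → FiniteNeighbour n i → 𝔪 (c * Q (residue i))) →
        (Divides² (c * s) → InfiniteNeighbour n) → (InfiniteNeighbour n → 𝔪 (c * s)) →
          neighbours n ≡ 1ℚ
      exactly-one n c (inj₁ (d , noroot)) f g f′ g′ = ≡.cong₂ ℚ._+_
        (∑-none q (λ i nb → noroot _ (residue-𝔒 i) (g i nb))) (⟦⟧-true (f′ d))
      exactly-one n c (inj₂ (noroot , e₀ , 𝔒e₀ , roots)) f g f′ g′ = ≡.cong₂ ℚ._+_
        (∑-one q (nearest e₀ 𝔒e₀)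
          (f (nearest e₀ 𝔒e₀) (proj₁ (roots (residue (nearest e₀ 𝔒e₀)) (residue-𝔒 _))
            (nearest-close e₀ 𝔒e₀)))
          (λ i nb → nearest-unique e₀ 𝔒e₀ i (proj₂ (roots (residue i) (residue-𝔒 i)) (g i nb))))
        (⟦⟧-false (noroot ∘ g′))

      no-neighbours : ∀ n → ¬ Level (suc n) → neighbours n ≡ 0ℚ
      no-neighbours n ¬L = ≡.cong₂ ℚ._+_
        (∑-none q (λ i (m , o) → ¬L (Q-integral⇒r-integral (𝔒ϖ^ (suc n)) (residue-𝔒 i)
          (𝔪⇒𝔒 (raise n (𝔪⇒𝔒 m))) o , o)))
        (⟦⟧-false (λ (m , o) → ¬L (o , 𝔪⇒𝔒 (raise n (𝔪⇒𝔒 m)))))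

      -- Failure of level n says that ϖⁿ⁺¹ r and ϖⁿ⁺¹ s are not both in 𝔪, so the form is primitive
      -- at this scale.
      boundary : ∀ n → Level (suc n) → ¬ Level n → OneRoot (ϖ^ suc n)
      boundary n (a , b) ¬L = primitive-one-root (𝔪-*ˡ 𝔪ϖ (𝔒ϖ^ n)) a b
        (λ (ma , mb) → ¬L (lower n ma , lower n mb))

      one-neighbour-below : ∀ n → Level (suc n) → ¬ Level n → neighbours n ≡ 1ℚ
      one-neighbour-below n L@(a , b) ¬L = exactly-one n (ϖ^ suc n) (boundary n L ¬L)
        (λ i d → lower² n d , b) (λ i (m , _) → raise n (𝔪⇒𝔒 m))
        (λ d → lower² n d , a) (λ (m , _) → raise n (𝔪⇒𝔒 m))

      one-neighbour-above : ∀ n → Level (suc n) → ¬ Level n → neighbours (suc n) ≡ 1ℚ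
      one-neighbour-above n L@(a , b) ¬L = exactly-one (suc n) (ϖ^ suc n) (boundary n L ¬L)
        (λ i d → divides²⇒𝔪 d , 𝔪⇒𝔒 (raise (suc n) b)) (λ i (m , _) → m)
        (λ d → divides²⇒𝔪 d , 𝔪⇒𝔒 (raise (suc n) a)) (λ (m , _) → m)

      all-neighbours : ∀ n → Level n → neighbours (suc n) ≡ fromℕ q ℚ.+ 1ℚ
      all-neighbours n (a , b) = ≡.cong₂ ℚ._+_
        (∑-all q (λ i → raise n (𝔒-Q (𝔒ϖ^ n) (residue-𝔒 i) a b) ,
          𝔪⇒𝔒 (raise (suc n) (𝔪⇒𝔒 (raise n b)))))
        (⟦⟧-true (raise n b , 𝔪⇒𝔒 (raise (suc n) (𝔪⇒𝔒 (raise n a)))))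

      -- Along an edge the exact level changes by at most one. A lattice of level n has all q + 1
      -- neighbours at level n + 1; one of exact level n + 1 or n + 2 has a single neighbour there;
      -- beyond that there is none.
      neighbours-suc : ∀ n → neighbours (suc n) ≡ fromℕ q ℚ.* ⟦ Level n ⟧ ℚ.+ ⟦ Level (suc (suc n))
        ⟧
      neighbours-suc n = by-level (decide (Level n)) (decide (Level (suc n)))
        (decide (Level (suc (suc n))))
        where
        value : ∀ {P Q : Set} {x y} → ⟦ P ⟧ ≡ x → ⟦ Q ⟧ ≡ y → fromℕ q ℚ.* x ℚ.+ y ≡
          fromℕ q ℚ.* ⟦ P ⟧ ℚ.+ ⟦ Q ⟧
        value ≡.refl ≡.refl = ≡.refl
        q*0+ : ∀ y → y ≡ fromℕ q ℚ.* 0ℚ ℚ.+ y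
        q*0+ y = ≡.sym (≡.trans (≡.cong (ℚ._+ y) (ℚ.*-zeroʳ (fromℕ q))) (ℚ.+-identityˡ y))

        by-level : Dec (Level n) → Dec (Level (suc n)) → Dec (Level (suc (suc n))) →
                   neighbours (suc n) ≡ fromℕ q ℚ.* ⟦ Level n ⟧ ℚ.+ ⟦ Level (suc (suc n)) ⟧
        by-level (yes L) _ _ = ≡.trans
          (≡.trans (all-neighbours n L) (≡.cong (ℚ._+ 1ℚ) (≡.sym (ℚ.*-identityʳ (fromℕ q)))))
          (value (⟦⟧-true L) (⟦⟧-true (level-suc (suc n) (level-suc n L))))
        by-level (no ¬L) (yes L′) _ = ≡.trans (≡.trans (one-neighbour-above n L′ ¬L) (q*0+ 1ℚ))
          (value (⟦⟧-false ¬L) (⟦⟧-true (level-suc (suc n) L′)))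
        by-level (no ¬L) (no ¬L′) (yes L″) =
          ≡.trans (≡.trans (one-neighbour-below (suc n) L″ ¬L′) (q*0+ 1ℚ))
          (value (⟦⟧-false ¬L) (⟦⟧-true L″))
        by-level (no ¬L) (no ¬L′) (no ¬L″) = ≡.trans (≡.trans (no-neighbours (suc n) ¬L″) (q*0+ 0ℚ))
          (value (⟦⟧-false ¬L) (⟦⟧-false ¬L″))

      -- At level 0 the discriminant is a unit and the count is 1 + κ. At exact level 1 the double
      -- zero gives one neighbour.
      neighbours-zero : ∀ {κ} → Splitting κ → neighbours 0 ≡ ⟦ Level 1 ⟧ ℚ.+ signℚ κ ℚ.* ⟦ Level 0 ⟧
      neighbours-zero {κ} sp = by-level (decide (Level 0)) (decide (Level 1))
        where
        value : ∀ {P Q : Set} {x y} → ⟦ P ⟧ ≡ x → ⟦ Q ⟧ ≡ y → x ℚ.+ signℚ κ ℚ.* y ≡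
          ⟦ P ⟧ ℚ.+ signℚ κ ℚ.* ⟦ Q ⟧
        value ≡.refl ≡.refl = ≡.refl
        +κ*0 : ∀ y → y ≡ y ℚ.+ signℚ κ ℚ.* 0ℚ
        +κ*0 y = ≡.sym (≡.trans (≡.cong (y ℚ.+_) (ℚ.*-zeroʳ (signℚ κ))) (ℚ.+-identityʳ y))

        by-level : Dec (Level 0) → Dec (Level 1) → neighbours 0 ≡ ⟦ Level 1 ⟧ ℚ.+ signℚ κ ℚ.* ⟦
          Level 0 ⟧
        by-level (yes L@(a , b)) _ = ≡.trans (≡.trans (≡.trans
            (≡.cong₂ ℚ._+_
              (∑-cong q (λ i → ⟦⟧-cong (λ (m , _) → 𝔪-resp (*-identityˡ _) m)
                (λ m → 𝔪-resp (sym (*-identityˡ _)) m , proj₂ (level-suc 0 L))))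
              (⟦⟧-cong (λ (m , _) → 𝔪-resp (*-identityˡ s) m)
                (λ m → 𝔪-resp (sym (*-identityˡ s)) m , proj₁ (level-suc 0 L))))
            (unramified-roots sp (𝔒-resp (*-identityˡ r) a) (𝔒-resp (*-identityˡ s) b)))
            (≡.cong (1ℚ ℚ.+_) (≡.sym (ℚ.*-identityʳ (signℚ κ)))))
          (value (⟦⟧-true (level-suc 0 L)) (⟦⟧-true L))
        by-level (no ¬L) (yes L′) = ≡.trans (≡.trans (one-neighbour-below 0 L′ ¬L) (+κ*0 1ℚ))
          (value (⟦⟧-true L′) (⟦⟧-false ¬L))
        by-level (no ¬L) (no ¬L′) = ≡.trans (≡.trans (no-neighbours 0 ¬L′) (+κ*0 0ℚ))
          (value (⟦⟧-false ¬L′) (⟦⟧-false ¬L))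

-- Coordinates for the basis 1, τ: conjugation, norm and character

module Basis (lem : ExcludedMiddle 0ℓ) (F : LocalField) (E : QuadraticAlgebra F)
             (τ : QuadraticAlgebra.Carrier E) (gen : QuadraticAlgebra.IsIntegralGenerator E τ) where
  open LocalField F hiding (zero)
  open Valuation lem F
  open IntegerCoefficients commRing
  open LinearCombination commRing
  private module E = QuadraticAlgebra E
  open E using (ι; conj; 𝔒ᴱ) renaming (Carrier to Carrierᴱ; _+_ to _+ᴱ_; _*_ to _*ᴱ_; _≈_ to _≈ᴱ_;
    -_ to -ᴱ_; _-_ to _-ᴱ_; 0# to 0ᴱ; 1# to 1ᴱ)
  open IntegerCoefficients E.commRing using () renaming
    (solve to solveᴱ; _:+_ to _⊞_; _:*_ to _⊠_; _:-_ to _⊟_; :-_ to ⊟_; :0 to 𝟘; :1 to 𝟙; _:=_ to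
    _≐_)
  open LinearCombination E.commRing using () renaming
    (combine₁ to combineᴱ₁; combine₂ to combineᴱ₂; combine₃ to combineᴱ₃; zero-difference to
    zero-differenceᴱ; difference-zero to difference-zeroᴱ)
  open RingMorphisms.IsRingHomomorphism E.ι-homo public using ()
    renaming (+-homo to ι-+; *-homo to ι-*; -‿homo to ι-neg; 0#-homo to ι-0; 1#-homo to ι-1; ⟦⟧-cong
      to ι-cong)
  open E.IsIntegralGenerator gen using (sum; direct)
  private module C = RingMorphisms.IsRingIsomorphism E.conj-iso

  pair : Carrier → Carrier → Carrierᴱ
  pair a b = ι a +ᴱ ι b *ᴱ τ

  abstract
    ι-sub : ∀ a b → ι (a - b) ≈ᴱ ι a -ᴱ ι b
    ι-sub a b = E.trans (ι-+ a (- b)) (E.+-congˡ (ι-neg b))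

    pair-cong : ∀ {a b c d} → a ≈ c → b ≈ d → pair a b ≈ᴱ pair c d
    pair-cong e f = E.+-cong (ι-cong e) (E.*-congʳ (ι-cong f))

    pair-scale : ∀ c a b → ι c *ᴱ pair a b ≈ᴱ pair (c * a) (c * b)
    pair-scale c a b = E.trans (solveᴱ 4 (λ c a b t → c ⊠ (a ⊞ b ⊠ t) ≐ c ⊠ a ⊞ (c ⊠ b) ⊠ t) E.refl
      (ι c) (ι a) (ι b) τ)
      (E.sym (E.+-cong (ι-* c a) (E.*-congʳ (ι-* c b))))

    pair-sub : ∀ a b c d → pair a b -ᴱ pair c d ≈ᴱ pair (a - c) (b - d)
    pair-sub a b c d = E.trans (solveᴱ 5 (λ a b c d t → (a ⊞ b ⊠ t) ⊟ (c ⊞ d ⊠ t)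
      ≐ (a ⊟ c) ⊞ (b ⊟ d) ⊠ t) E.refl (ι a) (ι b) (ι c) (ι d) τ)
      (E.sym (E.+-cong (ι-sub a c) (E.*-congʳ (ι-sub b d))))

    pair-+ : ∀ a b c d → pair a b +ᴱ pair c d ≈ᴱ pair (a + c) (b + d)
    pair-+ a b c d = E.trans (solveᴱ 5 (λ a b c d t → (a ⊞ b ⊠ t) ⊞ (c ⊞ d ⊠ t)
      ≐ (a ⊞ c) ⊞ (b ⊞ d) ⊠ t) E.refl (ι a) (ι b) (ι c) (ι d) τ)
      (E.sym (E.+-cong (ι-+ a c) (E.*-congʳ (ι-+ b d))))

    pair-scalar : ∀ a → pair a 0# ≈ᴱ ι a
    pair-scalar a = E.trans (E.+-congˡ (E.trans (E.*-congʳ ι-0) (E.zeroˡ τ))) (E.+-identityʳ (ι a))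

    pair-τ : pair 0# 1# ≈ᴱ τ
    pair-τ = E.trans (E.+-cong ι-0 (E.trans (E.*-congʳ ι-1) (E.*-identityˡ τ))) (E.+-identityˡ τ)

    -- `direct` speaks of integral coefficients only; a common power of ϖ clears the denominators.
    pair-zero : ∀ {a b} → pair a b ≈ᴱ 0ᴱ → (a ≈ 0#) × (b ≈ 0#)
    pair-zero {a} {b} e = unscale (scale₂ a b)
      where
      unscale : (∃ λ n → 𝔒 (ϖ^ n * a) × 𝔒 (ϖ^ n * b)) → (a ≈ 0#) × (b ≈ 0#)
      unscale (n , 𝔒a , 𝔒b) = cancel (proj₁ zeros) , cancel (proj₂ zeros)
        where
        zeros : (ϖ^ n * a ≈ 0#) × (ϖ^ n * b ≈ 0#)
        zeros = direct _ _ 𝔒a 𝔒b (E.trans (E.sym (pair-scale (ϖ^ n) a b))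
          (E.trans (E.*-congˡ e) (E.zeroʳ _)))
        cancel : ∀ {x} → ϖ^ n * x ≈ 0# → x ≈ 0#
        cancel z = *-cancel (ϖ^ n) (ϖ^≉0 n) (trans z (sym (zeroʳ _)))

    pair-injective : ∀ {a b c d} → pair a b ≈ᴱ pair c d → (a ≈ c) × (b ≈ d)
    pair-injective {a} {b} {c} {d} e = zero-difference (proj₁ zeros) , zero-difference (proj₂ zeros)
      where
      zeros : (a - c ≈ 0#) × (b - d ≈ 0#)
      zeros = pair-zero (E.trans (E.sym (pair-sub a b c d)) (difference-zeroᴱ e))

    ι-injective : ∀ {a b} → ι a ≈ᴱ ι b → a ≈ b
    ι-injective {a} {b} e = proj₁ (pair-injective {a} {0#} {b} {0#} (E.+-congʳ e))

    τ-not-scalar : ∀ c → ¬ (τ ≈ᴱ ι c)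
    τ-not-scalar c e = 1≉0 (proj₂
      (pair-injective {0#} {1#} {c} {0#} (E.trans pair-τ (E.trans e (E.sym (pair-scalar c))))))

    1ᴱ≉0ᴱ : ¬ (1ᴱ ≈ᴱ 0ᴱ)
    1ᴱ≉0ᴱ e = 1≉0 (ι-injective (E.trans ι-1 (E.trans e (E.sym ι-0))))

    -- Cramer's rule: 1 and τ are expressed in the given basis, and Δ is the determinant of that
    -- change of basis.
    pair-spanning : ∀ z → ∃₂ λ a b → z ≈ᴱ pair a b
    pair-spanning z = solved (E.spanning 1ᴱ) (E.spanning τ) (E.spanning z)
      where
      Coordinates : Carrierᴱ → Set
      Coordinates x = ∃₂ λ a b → x ≈ᴱ ι a *ᴱ E.e₁ +ᴱ ι b *ᴱ E.e₂

      solved : Coordinates 1ᴱ → Coordinates τ → Coordinates z → ∃₂ λ a b → z ≈ᴱ pair a b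
      solved (a₁ , b₁ , 1≈) (a₂ , b₂ , τ≈) (a , b , z≈) = answer (decide (Δ ≈ 0#))
        where
        Δ : Carrier
        Δ = a₁ * b₂ - a₂ * b₁

        ιΔ : ι Δ ≈ᴱ ι a₁ *ᴱ ι b₂ -ᴱ ι a₂ *ᴱ ι b₁
        ιΔ = E.trans (ι-sub _ _) (E.+-cong (ι-* a₁ b₂) (E.-‿cong (ι-* a₂ b₁)))

        Δe₁ : pair b₂ (- b₁) ≈ᴱ ι Δ *ᴱ E.e₁
        Δe₁ = E.trans (E.+-congˡ (E.*-congʳ (ι-neg b₁))) (E.trans
          (combineᴱ₂ (ι b₂) (-ᴱ ι b₁) 1≈ τ≈ (solveᴱ 7 (λ a₁ b₁ a₂ b₂ e₁ e₂ t →
            (b₂ ⊞ (⊟ b₁) ⊠ t) ⊟ (a₁ ⊠ b₂ ⊟ a₂ ⊠ b₁) ⊠ e₁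
              ≐ b₂ ⊠ (𝟙 ⊟ (a₁ ⊠ e₁ ⊞ b₁ ⊠ e₂)) ⊞ (⊟ b₁) ⊠ (t ⊟ (a₂ ⊠ e₁ ⊞ b₂ ⊠ e₂)))
            E.refl (ι a₁) (ι b₁) (ι a₂) (ι b₂) E.e₁ E.e₂ τ))
          (E.*-congʳ (E.sym ιΔ)))

        Δe₂ : pair (- a₂) a₁ ≈ᴱ ι Δ *ᴱ E.e₂
        Δe₂ = E.trans (E.+-congʳ (ι-neg a₂)) (E.trans
          (combineᴱ₂ (-ᴱ ι a₂) (ι a₁) 1≈ τ≈ (solveᴱ 7 (λ a₁ b₁ a₂ b₂ e₁ e₂ t →
            ((⊟ a₂) ⊞ a₁ ⊠ t) ⊟ (a₁ ⊠ b₂ ⊟ a₂ ⊠ b₁) ⊠ e₂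
              ≐ (⊟ a₂) ⊠ (𝟙 ⊟ (a₁ ⊠ e₁ ⊞ b₁ ⊠ e₂)) ⊞ a₁ ⊠ (t ⊟ (a₂ ⊠ e₁ ⊞ b₂ ⊠ e₂)))
            E.refl (ι a₁) (ι b₁) (ι a₂) (ι b₂) E.e₁ E.e₂ τ))
          (E.*-congʳ (E.sym ιΔ)))

        answer : Dec (Δ ≈ 0#) → ∃₂ λ a b → z ≈ᴱ pair a b
        -- If Δ = 0, independence of 1 and τ applied to `Δe₁` and `Δe₂` kills both coordinates of 1.
        answer (yes Δ≈0) = ⊥-elim (1ᴱ≉0ᴱ
          (E.trans 1≈ (E.trans (E.+-cong (vanish a₁≈0) (vanish b₁≈0)) (E.+-identityˡ 0ᴱ))))
          where
          ιΔ≈0 : ∀ e → ι Δ *ᴱ e ≈ᴱ 0ᴱ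
          ιΔ≈0 e = E.trans (E.*-congʳ (E.trans (ι-cong Δ≈0) ι-0)) (E.zeroˡ e)
          a₁≈0 : a₁ ≈ 0#
          a₁≈0 = proj₂ (pair-zero (E.trans Δe₂ (ιΔ≈0 E.e₂)))
          b₁≈0 : b₁ ≈ 0#
          b₁≈0 = trans (solve 1 (λ b → b := :- (:- b)) refl b₁)
            (trans (-‿cong (proj₂ (pair-zero (E.trans Δe₁ (ιΔ≈0 E.e₁)))))
            (solve 0 (:- :0 := :0) refl))
          vanish : ∀ {x e} → x ≈ 0# → ι x *ᴱ e ≈ᴱ 0ᴱ
          vanish {x} {e} x≈0 = E.trans (E.*-congʳ (E.trans (ι-cong x≈0) ι-0)) (E.zeroˡ e)
        answer (no Δ≉0) = _ , _ , E.trans z≈ (E.trans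
            (E.+-cong (E.*-congˡ e₁≈) (E.*-congˡ e₂≈))
            (E.trans (E.+-cong (E.*-congˡ (pair-scale k b₂ (- b₁)))
              (E.*-congˡ (pair-scale k (- a₂) a₁)))
            (E.trans (E.+-cong (pair-scale a _ _) (pair-scale b _ _)) (pair-+ _ _ _ _))))
          where
          k : Carrier
          k = proj₁ (inverse-of Δ Δ≉0)
          kΔ : ι k *ᴱ ι Δ ≈ᴱ 1ᴱ
          kΔ = E.trans (E.sym (ι-* k Δ))
            (E.trans (ι-cong (trans (*-comm _ _) (proj₂ (inverse-of Δ Δ≉0)))) ι-1)
          undo : ∀ e → e ≈ᴱ ι k *ᴱ (ι Δ *ᴱ e)
          undo e = E.trans (E.sym (E.*-identityˡ e))
            (E.trans (E.*-congʳ (E.sym kΔ)) (E.*-assoc _ _ _))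
          e₁≈ : E.e₁ ≈ᴱ ι k *ᴱ pair b₂ (- b₁)
          e₁≈ = E.trans (undo E.e₁) (E.*-congˡ (E.sym Δe₁))
          e₂≈ : E.e₂ ≈ᴱ ι k *ᴱ pair (- a₂) a₁
          e₂≈ = E.trans (undo E.e₂) (E.*-congˡ (E.sym Δe₂))

  -- The coefficients of τ² = T τ - N. That T is also τ + conj τ is the content of `conj-τ`.
  T N : Carrier
  T = proj₁ (proj₂ (pair-spanning (τ *ᴱ τ)))
  N = - proj₁ (pair-spanning (τ *ᴱ τ))

  abstract
    τ² : τ *ᴱ τ ≈ᴱ ι T *ᴱ τ -ᴱ ι N
    τ² = E.trans (proj₂ (proj₂ (pair-spanning (τ *ᴱ τ)))) (E.trans (E.+-comm _ _)
      (E.+-congˡ (E.trans (solveᴱ 1 (λ x → x ≐ ⊟ (⊟ x)) E.refl _) (E.-‿cong (E.sym (ι-neg _))))))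

    conj-pair : ∀ a b → conj (pair a b) ≈ᴱ ι a +ᴱ ι b *ᴱ conj τ
    conj-pair a b = E.trans (C.+-homo _ _)
      (E.+-cong (E.conj-fixes-F a) (E.trans (C.*-homo _ _) (E.*-congʳ (E.conj-fixes-F b))))

    conj-τ² : conj τ *ᴱ conj τ ≈ᴱ ι T *ᴱ conj τ -ᴱ ι N
    conj-τ² = E.trans (E.sym (C.*-homo τ τ)) (E.trans (C.⟦⟧-cong τ²) (E.trans (C.+-homo _ _)
      (E.+-cong (E.trans (C.*-homo _ _) (E.*-congʳ (E.conj-fixes-F T)))
        (E.trans (C.-‿homo _) (E.-‿cong (E.conj-fixes-F N))))))

    conj-cong : ∀ {x y} → x ≈ᴱ y → conj x ≈ᴱ conj y
    conj-cong = C.⟦⟧-cong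

    conj-τ≉τ : ¬ (conj τ ≈ᴱ τ)
    conj-τ≉τ e = proj₂ E.conj-nontrivial (fixes (pair-spanning (proj₁ E.conj-nontrivial)))
      where
      fixes : ∀ {x} → (∃₂ λ a b → x ≈ᴱ pair a b) → conj x ≈ᴱ x
      fixes (a , b , x≈) = E.trans (C.⟦⟧-cong x≈)
        (E.trans (conj-pair a b) (E.trans (E.+-congˡ (E.*-congˡ e)) (E.sym x≈)))

    conj-τ-not-scalar : ∀ c → ¬ (conj τ ≈ᴱ ι c)
    conj-τ-not-scalar c e = τ-not-scalar c (C.injective (E.trans e (E.sym (E.conj-fixes-F c))))

    -- τ and conj τ satisfy the same quadratic equation, and their difference is invertible, so
    -- their sum is T.
    conj-τ-field : IsField E.commRing → conj τ ≈ᴱ ι T -ᴱ τ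
    conj-τ-field (_ , invert) = use (invert (conj τ -ᴱ τ) (λ z → conj-τ≉τ (zero-differenceᴱ z)))
      where
      use : (∃ λ i → (i *ᴱ (conj τ -ᴱ τ) ≈ᴱ 1ᴱ) × ((conj τ -ᴱ τ) *ᴱ i ≈ᴱ 1ᴱ)) → conj τ ≈ᴱ ι T -ᴱ τ
      use (i , il , _) = combineᴱ₃ i (-ᴱ i) (-ᴱ (conj τ +ᴱ τ -ᴱ ι T)) conj-τ² τ² il
        (solveᴱ 5 (λ t c T N i →
        c ⊟ (T ⊟ t) ≐ i ⊠ (c ⊠ c ⊟ (T ⊠ c ⊟ N)) ⊞ (⊟ i) ⊠ (t ⊠ t ⊟ (T ⊠ t ⊟ N)) ⊞ (⊟ (c ⊞ t ⊟ T))
          ⊠ (i ⊠ (c ⊟ t) ⊟ 𝟙))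
        E.refl τ (conj τ) (ι T) (ι N) i)

  module Split (isSplit : E.IsSplit) where
    open E.IsSplit isSplit
    private module Φ = RingMorphisms.IsRingIsomorphism iso

    u v : Carrier
    u = proj₁ (φ τ)
    v = proj₂ (φ τ)

    abstract
      φ-pair : ∀ a b → (proj₁ (φ (pair a b)) ≈ a + b * u) × (proj₂ (φ (pair a b)) ≈ a + b * v)
      φ-pair a b =
        trans (proj₁ (Φ.+-homo _ _))
          (+-cong (proj₁ (diagonal a))
          (trans (proj₁ (Φ.*-homo _ _)) (*-congʳ (proj₁ (diagonal b))))) ,
        trans (proj₂ (Φ.+-homo _ _))
          (+-cong (proj₂ (diagonal a))
          (trans (proj₂ (Φ.*-homo _ _)) (*-congʳ (proj₂ (diagonal b)))))

      φ-root : ∀ x → x *ᴱ x ≈ᴱ ι T *ᴱ x -ᴱ ι N →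
        (proj₁ (φ x) * proj₁ (φ x) ≈ T * proj₁ (φ x) - N) × (proj₂ (φ x) * proj₂ (φ x) ≈
          T * proj₂ (φ x) - N)
      φ-root x e =
        trans (sym (proj₁ (Φ.*-homo x x)))
          (trans (proj₁ (Φ.⟦⟧-cong e)) (trans (proj₁ (Φ.+-homo _ _))
          (+-cong (trans (proj₁ (Φ.*-homo _ _)) (*-congʳ (proj₁ (diagonal T))))
            (trans (proj₁ (Φ.-‿homo _)) (-‿cong (proj₁ (diagonal N))))))) ,
        trans (sym (proj₂ (Φ.*-homo x x)))
          (trans (proj₂ (Φ.⟦⟧-cong e)) (trans (proj₂ (Φ.+-homo _ _))
          (+-cong (trans (proj₂ (Φ.*-homo _ _)) (*-congʳ (proj₂ (diagonal T))))
            (trans (proj₂ (Φ.-‿homo _)) (-‿cong (proj₂ (diagonal N)))))))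

      φ-scalar : ∀ {x c} → proj₁ (φ x) ≈ c → proj₂ (φ x) ≈ c → x ≈ᴱ ι c
      φ-scalar {x} {c} e₁ e₂ = Φ.injective (trans e₁ (sym (proj₁ (diagonal c))) ,
        trans e₂ (sym (proj₂ (diagonal c))))

      u≉v : ¬ (u ≈ v)
      u≉v e = τ-not-scalar v (φ-scalar e refl)

      u-v≉0 : ¬ (u - v ≈ 0#)
      u-v≉0 z = u≉v (zero-difference z)

      u+v≈T : u + v ≈ T
      u+v≈T = *-cancel (u - v) u-v≉0 (combine₂ 1# (- 1#) (proj₁ (φ-root τ τ²)) (proj₂ (φ-root τ τ²))
        (solve 4 (λ u v T N →
        (u :- v) :* (u :+ v) :- (u :- v) :* T
          := :1 :* (u :* u :- (T :* u :- N)) :+ (:- :1) :* (v :* v :- (T :* v :- N))) refl u v T N))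

      uv≈N : u * v ≈ N
      uv≈N = combine₂ u (- 1#) u+v≈T (proj₁ (φ-root τ τ²)) (solve 4 (λ u v T N →
        u :* v :- N := u :* (u :+ v :- T) :+ (:- :1) :* (u :* u :- (T :* u :- N))) refl u v T N)

      roots : ∀ w → w * w ≈ T * w - N → (w ≈ u) ⊎ (w ≈ v)
      roots w e = by-factor (integral-domain
        (combine₃ 1# (- w) 1# e u+v≈T uv≈N (solve 5 (λ u v T N w →
          (w :- u) :* (w :- v) :- :0 := :1 :* (w :* w :- (T :* w :- N)) :+ (:- w) :* (u :+ v :- T)
            :+ :1 :* (u :* v :- N)) refl u v T N w)))
        where
        by-factor : (w - u ≈ 0#) ⊎ (w - v ≈ 0#) → (w ≈ u) ⊎ (w ≈ v)
        by-factor (inj₁ z) = inj₁ (zero-difference z)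
        by-factor (inj₂ z) = inj₂ (zero-difference z)

      -- In F ⊕ F a solution of the quadratic equation has both coordinates among u and v, which
      -- leaves four candidates. conj τ is neither of the two scalars, nor τ = (u , v), so it is (v
      -- , u) = T - τ.
      conj-τ-split : conj τ ≈ᴱ ι T -ᴱ τ
      conj-τ-split = by-roots (roots _ (proj₁ (φ-root _ conj-τ²)))
        (roots _ (proj₂ (φ-root _ conj-τ²)))
        where
        complement : ∀ {a b c t} → a ≈ b → c + b ≈ T → t ≈ T → a ≈ t - c
        complement {a} {b} {c} {t} a≈b sum t≈T = combine₃ 1# 1# (- 1#) a≈b sum t≈T
          (solve 5 (λ a b c t T → a :- (t :- c) :=
          :1 :* (a :- b) :+ :1 :* (c :+ b :- T) :+ (:- :1) :* (t :- T)) refl a b c t T)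
        by-roots : (proj₁ (φ (conj τ)) ≈ u) ⊎ (proj₁ (φ (conj τ)) ≈ v) →
          (proj₂ (φ (conj τ)) ≈ u) ⊎ (proj₂ (φ (conj τ)) ≈ v) → conj τ ≈ᴱ ι T -ᴱ τ
        by-roots (inj₁ e₁) (inj₁ e₂) = ⊥-elim (conj-τ-not-scalar u (φ-scalar e₁ e₂))
        by-roots (inj₂ e₁) (inj₂ e₂) = ⊥-elim (conj-τ-not-scalar v (φ-scalar e₁ e₂))
        by-roots (inj₁ e₁) (inj₂ e₂) = ⊥-elim (conj-τ≉τ (Φ.injective (e₁ , e₂)))
        by-roots (inj₂ e₁) (inj₁ e₂) = Φ.injective
          ( trans (complement e₁ u+v≈T (proj₁ (diagonal T)))
            (sym (trans (proj₁ (Φ.+-homo _ _)) (+-congˡ (proj₁ (Φ.-‿homo τ)))))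
          , trans (complement e₂ (trans (+-comm v u) u+v≈T) (proj₂ (diagonal T)))
            (sym (trans (proj₂ (Φ.+-homo _ _)) (+-congˡ (proj₂ (Φ.-‿homo τ))))))

  module Arithmetic (unr : E.Unramified) where
    norm : Carrier → Carrier → Carrier
    norm a b = a * a + T * (a * b) + N * (b * b)

    :norm : ∀ {n} (T N a b : Polynomial n) → Polynomial n
    :norm T N a b = a :* a :+ T :* (a :* b) :+ N :* (b :* b)

    abstract
      conj-τ : conj τ ≈ᴱ ι T -ᴱ τ
      conj-τ = by-type unr
        where
        by-type : E.Unramified → conj τ ≈ᴱ ι T -ᴱ τ
        by-type (inj₁ isField) = conj-τ-field (E.IsUnramifiedField.isField isField)
        by-type (inj₂ isSplit) = Split.conj-τ-split isSplit

      conj-pair′ : ∀ a b → conj (pair a b) ≈ᴱ pair (a + T * b) (- b)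
      conj-pair′ a b = E.trans (conj-pair a b) (E.trans (E.+-congˡ (E.*-congˡ conj-τ)) (E.trans
        (solveᴱ 4 (λ a b T t → a ⊞ b ⊠ (T ⊟ t) ≐ (a ⊞ T ⊠ b) ⊞ (⊟ b) ⊠ t) E.refl (ι a) (ι b)
          (ι T) τ)
        (E.sym (E.+-cong (E.trans (ι-+ _ _) (E.+-congˡ (ι-* T b))) (E.*-congʳ (ι-neg b))))))

      pair-* : ∀ a b c d → pair a b *ᴱ pair c d ≈ᴱ pair (a * c - N * (b * d))
        (a * d + b * c + T * (b * d))
      pair-* a b c d = E.trans
        (combineᴱ₁ (ι b *ᴱ ι d) τ² (solveᴱ 7 (λ a b c d T N t →
          (a ⊞ b ⊠ t) ⊠ (c ⊞ d ⊠ t) ⊟ ((a ⊠ c ⊟ N ⊠ (b ⊠ d)) ⊞ (a ⊠ d ⊞ b ⊠ c ⊞ T ⊠ (b ⊠ d)) ⊠ t)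
            ≐ (b ⊠ d) ⊠ (t ⊠ t ⊟ (T ⊠ t ⊟ N)))
          E.refl (ι a) (ι b) (ι c) (ι d) (ι T) (ι N) τ))
        (E.sym (E.+-cong
          (E.trans (ι-sub _ _) (E.+-cong (ι-* a c)
            (E.-‿cong (E.trans (ι-* _ _) (E.*-congˡ (ι-* b d))))))
          (E.*-congʳ (E.trans (ι-+ _ _) (E.+-cong (E.trans (ι-+ _ _) (E.+-cong (ι-* a d) (ι-* b c)))
            (E.trans (ι-* _ _) (E.*-congˡ (ι-* b d))))))))

      pair-norm : ∀ a b → pair a b *ᴱ conj (pair a b) ≈ᴱ ι (norm a b)
      pair-norm a b = E.trans (E.*-congˡ (conj-pair′ a b))
        (E.trans (pair-* a b _ _) (E.trans (pair-cong
        (solve 4 (λ a b T N → a :* (a :+ T :* b) :- N :* (b :* (:- b)) := :norm T N a b) refl a b T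
          N)
        (solve 4 (λ a b T N → a :* (:- b) :+ b :* (a :+ T :* b) :+ T :* (b :* (:- b)) := :0) refl a
          b T N)) (pair-scalar _)))

      norm-* : ∀ a b c d → norm a b * norm c d ≈ norm (a * c - N * (b * d))
        (a * d + b * c + T * (b * d))
      norm-* a b c d = solve 6 (λ a b c d T N → :norm T N a b :* (:norm T N c d)
        := (a :* c :- N :* (b :* d)) :* (a :* c :- N :* (b :* d)) :+ T
          :* ((a :* c :- N :* (b :* d)) :* (a :* d :+ b :* c :+ T :* (b :* d)))
           :+ N :* ((a :* d :+ b :* c :+ T :* (b :* d)) :* (a :* d :+ b :* c :+ T :* (b :* d))))
             refl a b c d T N

      norm-cong : ∀ {a b c d} → a ≈ c → b ≈ d → norm a b ≈ norm c d
      norm-cong e f = +-cong (+-cong (*-cong e e) (*-congˡ (*-cong e f))) (*-congˡ (*-cong f f))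

      norm-scale : ∀ c a b → norm (c * a) (c * b) ≈ c * c * norm a b
      norm-scale c a b = solve 5 (λ c a b T N → :norm T N (c :* a) (c :* b)
        := c :* c :* :norm T N a b) refl c a b T N

      evalMonic-conj : ∀ cs x → conj (E.evalMonic cs x) ≈ᴱ E.evalMonic cs (conj x)
      evalMonic-conj []       x = C.1#-homo
      evalMonic-conj (c ∷ cs) x = E.trans (C.+-homo _ _)
        (E.+-cong (E.conj-fixes-F c) (E.trans (C.*-homo _ _) (E.*-congˡ (evalMonic-conj cs x))))

      𝔒ᴱ-conj : ∀ {x} → 𝔒ᴱ x → 𝔒ᴱ (conj x)
      𝔒ᴱ-conj {x} (cs , 𝔒cs , e) = cs , 𝔒cs ,
        E.trans (E.sym (evalMonic-conj cs x)) (E.trans (C.⟦⟧-cong e) C.0#-homo)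

      𝔒ᴱ⇒𝔒 : ∀ {a b} → 𝔒ᴱ (pair a b) → 𝔒 a × 𝔒 b
      𝔒ᴱ⇒𝔒 {a} {b} o = unpack (Equivalence.to (sum (pair a b)) o)
        where
        unpack : (∃₂ λ c d → 𝔒 c × 𝔒 d × (pair a b ≈ᴱ ι c +ᴱ ι d *ᴱ τ)) → 𝔒 a × 𝔒 b
        unpack (c , d , 𝔒c , 𝔒d , e) = 𝔒-resp (sym (proj₁ (pair-injective e))) 𝔒c ,
          𝔒-resp (sym (proj₂ (pair-injective e))) 𝔒d

      evalMonic-cong : ∀ cs {x y} → x ≈ᴱ y → E.evalMonic cs x ≈ᴱ E.evalMonic cs y
      evalMonic-cong []       e = E.refl
      evalMonic-cong (c ∷ cs) e = E.+-congˡ (E.*-cong e (evalMonic-cong cs e))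

      𝔒ᴱ-resp : ∀ {x y} → x ≈ᴱ y → 𝔒ᴱ x → 𝔒ᴱ y
      𝔒ᴱ-resp e (cs , 𝔒cs , z) = cs , 𝔒cs , E.trans (evalMonic-cong cs (E.sym e)) z

      𝔒⇒𝔒ᴱ : ∀ {a b} → 𝔒 a → 𝔒 b → 𝔒ᴱ (pair a b)
      𝔒⇒𝔒ᴱ {a} {b} 𝔒a 𝔒b = Equivalence.from (sum (pair a b)) (a , b , 𝔒a , 𝔒b , E.refl)

      𝔒ᴱτ : 𝔒ᴱ τ
      𝔒ᴱτ = 𝔒ᴱ-resp pair-τ (𝔒⇒𝔒ᴱ 𝔒0 𝔒1)

      -- conj τ = T - τ is integral along with τ, and integral elements have integral coordinates.
      𝔒T : 𝔒 T
      𝔒T = 𝔒-resp (solve 1 (λ T → :0 :+ T :* :1 := T) refl T)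
        (proj₁ (𝔒ᴱ⇒𝔒 (𝔒ᴱ-resp (E.trans (C.⟦⟧-cong (E.sym pair-τ)) (conj-pair′ 0# 1#))
          (𝔒ᴱ-conj 𝔒ᴱτ))))

      -- If N ∉ 𝔒 then y = 1/τ satisfies y² = a y + b with a , b ∈ 𝔪, and a monic
      -- equation of τ, divided by its leading power, puts 1 in y 𝔒[y].
      𝔒N : 𝔒 N
      𝔒N = by-cases (decide (𝔒 N))
        where
        module _ (N′ : Carrier) (𝔪N′ : 𝔪 N′) (NN′≈1 : N * N′ ≈ 1#) where
          y : Carrierᴱ
          y = pair (T * N′) (- N′)

          ιNN′ : ι N *ᴱ ι N′ ≈ᴱ 1ᴱ
          ιNN′ = E.trans (E.sym (ι-* N N′)) (E.trans (ι-cong NN′≈1) ι-1)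

          y≈ : y ≈ᴱ ι N′ *ᴱ (ι T -ᴱ τ)
          y≈ = E.trans (E.+-cong (ι-* T N′) (E.*-congʳ (ι-neg N′)))
            (solveᴱ 3 (λ T n t → T ⊠ n ⊞ (⊟ n) ⊠ t ≐ n ⊠ (T ⊟ t)) E.refl (ι T) (ι N′) τ)

          yτ : y *ᴱ τ ≈ᴱ 1ᴱ
          yτ = E.trans (E.*-congʳ y≈) (combineᴱ₂ (-ᴱ ι N′) 1ᴱ τ² ιNN′ (solveᴱ 4 (λ T N n t →
            (n ⊠ (T ⊟ t)) ⊠ t ⊟ 𝟙 ≐ (⊟ n) ⊠ (t ⊠ t ⊟ (T ⊠ t ⊟ N)) ⊞ 𝟙 ⊠ (N ⊠ n ⊟ 𝟙)) E.refl (ι T)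
              (ι N) (ι N′) τ))

          y² : y *ᴱ y ≈ᴱ (ι T *ᴱ ι N′) *ᴱ y -ᴱ ι N′
          y² = E.trans (E.*-congˡ y≈) (combineᴱ₁ (-ᴱ ι N′) yτ (solveᴱ 4 (λ T n t y →
            y ⊠ (n ⊠ (T ⊟ t)) ⊟ ((T ⊠ n) ⊠ y ⊟ n) ≐ (⊟ n) ⊠ (y ⊠ t ⊟ 𝟙)) E.refl (ι T) (ι N′) τ y))

          -- This is y 𝔒[y]: by the quadratic equation of y two generators suffice.
          W : Carrierᴱ → Set
          W z = ∃₂ λ A B → 𝔒 A × 𝔒 B × (z ≈ᴱ ι A *ᴱ y +ᴱ ι B *ᴱ (y *ᴱ y))

          W-+ : ∀ {x z} → W x → W z → W (x +ᴱ z)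
          W-+ (A , B , 𝔒A , 𝔒B , e) (A′ , B′ , 𝔒A′ , 𝔒B′ , e′) = A + A′ , B + B′ , 𝔒-+ 𝔒A 𝔒A′ ,
            𝔒-+ 𝔒B 𝔒B′ ,
            E.trans (E.+-cong e e′) (E.trans
              (solveᴱ 6 (λ A B A′ B′ y z → (A ⊠ y ⊞ B ⊠ z) ⊞ (A′ ⊠ y ⊞ B′ ⊠ z)
              ≐ (A ⊞ A′) ⊠ y ⊞ (B ⊞ B′) ⊠ z) E.refl (ι A) (ι B) (ι A′) (ι B′) y (y *ᴱ y))
              (E.+-cong (E.*-congʳ (E.sym (ι-+ A A′))) (E.*-congʳ (E.sym (ι-+ B B′)))))

          W-scale : ∀ {c z} → 𝔒 c → W z → W (ι c *ᴱ z)
          W-scale {c} 𝔒c (A , B , 𝔒A , 𝔒B , e) = c * A , c * B , 𝔒-* 𝔒c 𝔒A , 𝔒-* 𝔒c 𝔒B ,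
            E.trans (E.*-congˡ e) (E.trans
              (solveᴱ 5 (λ c A B y z → c ⊠ (A ⊠ y ⊞ B ⊠ z) ≐ (c ⊠ A) ⊠ y ⊞ (c ⊠ B) ⊠ z) E.refl (ι c)
              (ι A) (ι B) y (y *ᴱ y))
              (E.+-cong (E.*-congʳ (E.sym (ι-* c A))) (E.*-congʳ (E.sym (ι-* c B)))))

          W-0 : W 0ᴱ
          W-0 = 0# , 0# , 𝔒0 , 𝔒0 , E.sym (E.trans (E.+-cong (vanish y) (vanish (y *ᴱ y)))
            (E.+-identityˡ 0ᴱ))
            where vanish : ∀ x → ι 0# *ᴱ x ≈ᴱ 0ᴱ
                  vanish x = E.trans (E.*-congʳ ι-0) (E.zeroˡ x)

          W-y : W y
          W-y = 1# , 0# , 𝔒1 , 𝔒0 , E.sym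
            (E.trans (E.+-cong (E.trans (E.*-congʳ ι-1) (E.*-identityˡ y))
            (E.trans (E.*-congʳ ι-0) (E.zeroˡ _))) (E.+-identityʳ y))

          W-y* : ∀ {z} → W z → W (y *ᴱ z)
          W-y* (A , B , 𝔒A , 𝔒B , e) = - (B * N′) , A + B * (T * N′) , 𝔒-neg (𝔒-* 𝔒B 𝔒N′) ,
            𝔒-+ 𝔒A (𝔒-* 𝔒B (𝔒-* 𝔒T 𝔒N′)) ,
            E.trans (E.*-congˡ e) (E.trans
              (combineᴱ₁ (ι B *ᴱ y) y² (solveᴱ 5
                (λ A B y T n → y ⊠ (A ⊠ y ⊞ B ⊠ (y ⊠ y))
                ⊟ ((⊟ (B ⊠ n)) ⊠ y ⊞ (A ⊞ B ⊠ (T ⊠ n)) ⊠ (y ⊠ y))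
                ≐ (B ⊠ y) ⊠ (y ⊠ y ⊟ ((T ⊠ n) ⊠ y ⊟ n))) E.refl (ι A) (ι B) y (ι T) (ι N′)))
              (E.sym (E.+-cong (E.*-congʳ (E.trans (ι-neg _) (E.-‿cong (ι-* B N′))))
                (E.*-congʳ (E.trans (ι-+ _ _)
                  (E.+-congˡ (E.trans (ι-* _ _) (E.*-congˡ (ι-* T N′)))))))))
            where 𝔒N′ : 𝔒 N′
                  𝔒N′ = 𝔪⇒𝔒 𝔪N′

          power : List Carrier → Carrierᴱ
          power []       = 1ᴱ
          power (_ ∷ cs) = y *ᴱ power cs

          W-power : ∀ c cs → W (power (c ∷ cs))
          W-power c []        = resp (E.sym (E.*-identityʳ y)) W-y
            where resp : ∀ {x z} → x ≈ᴱ z → W x → W z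
                  resp e (A , B , 𝔒A , 𝔒B , f) = A , B , 𝔒A , 𝔒B , E.trans (E.sym e) f
          W-power c (c′ ∷ cs) = W-y* (W-power c′ cs)

          -- Horner's scheme, with one factor y cancelling one factor τ at each coefficient; only
          -- the leading term of the polynomial contributes 1.
          divided : ∀ cs → All 𝔒 cs → ∃ λ z → W z × (power cs *ᴱ E.evalMonic cs τ ≈ᴱ 1ᴱ +ᴱ z)
          divided [] [] = 0ᴱ , W-0 , E.trans (E.*-identityˡ 1ᴱ) (E.sym (E.+-identityʳ 1ᴱ))
          divided (c ∷ cs) (𝔒c ∷ 𝔒cs) = step (divided cs 𝔒cs)
            where
            step : (∃ λ z → W z × (power cs *ᴱ E.evalMonic cs τ ≈ᴱ 1ᴱ +ᴱ z)) →
                   ∃ λ z → W z × (power (c ∷ cs) *ᴱ E.evalMonic (c ∷ cs) τ ≈ᴱ 1ᴱ +ᴱ z)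
            step (z , Wz , e) = ι c *ᴱ power (c ∷ cs) +ᴱ z , W-+ (W-scale 𝔒c (W-power c cs)) Wz ,
              combineᴱ₂ (power cs *ᴱ E.evalMonic cs τ) 1ᴱ yτ e (solveᴱ 6 (λ c y p t m z →
                (y ⊠ p) ⊠ (c ⊞ t ⊠ m) ⊟ (𝟙 ⊞ (c ⊠ (y ⊠ p) ⊞ z))
                  ≐ (p ⊠ m) ⊠ (y ⊠ t ⊟ 𝟙) ⊞ 𝟙 ⊠ (p ⊠ m ⊟ (𝟙 ⊞ z)))
                E.refl (ι c) y (power cs) τ (E.evalMonic cs τ) z)

          -- In coordinates, the coefficient of τ in 1 + z is (A + B T N′)(- N′). Once it vanishes,
          -- the coefficient of 1 leaves 1 = B N′, an element of 𝔪.
          not-in-W : ∀ z → 1ᴱ +ᴱ z ≈ᴱ 0ᴱ → ¬ W z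
          not-in-W z 1+z≈0 (A , B , 𝔒A , 𝔒B , z≈) =
            ¬𝔪1 (𝔪-resp (combine₂ 1# T (sym (proj₁ zeros)) (sym (proj₂ zeros))
              (solve 4 (λ A B T n → B :* n :- :1
                := :1 :* (:0 :- ((:1 :- B :* n) :+ (A :+ B :* (T :* n)) :* (T :* n)))
                :+ T :* (:0 :- (A :+ B :* (T :* n)) :* (:- n))) refl A B T N′)) (𝔪-*ʳ 𝔒B 𝔪N′))
            where
            expanded : pair (1# - B * N′) 0# +ᴱ ι (A + B * (T * N′)) *ᴱ y ≈ᴱ 0ᴱ
            expanded = E.trans (E.+-cong
              (E.trans (pair-scalar _) (E.trans (ι-sub _ _) (E.+-cong ι-1 (E.-‿cong (ι-* B N′)))))
                (E.*-congʳ (E.trans (ι-+ _ _)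
                  (E.+-congˡ (E.trans (ι-* _ _) (E.*-congˡ (ι-* T N′)))))))
              (combineᴱ₃ 1ᴱ (-ᴱ 1ᴱ) (-ᴱ ι B) 1+z≈0 z≈ y² (solveᴱ 6 (λ A B y T n z →
                ((𝟙 ⊟ B ⊠ n) ⊞ (A ⊞ B ⊠ (T ⊠ n)) ⊠ y) ⊟ 𝟘
                ≐ 𝟙 ⊠ (𝟙 ⊞ z ⊟ 𝟘) ⊞ (⊟ 𝟙) ⊠ (z ⊟ (A ⊠ y ⊞ B ⊠ (y ⊠ y))) ⊞ (⊟ B)
                  ⊠ (y ⊠ y ⊟ ((T ⊠ n) ⊠ y ⊟ n)))
                E.refl (ι A) (ι B) y (ι T) (ι N′) z))
            zeros : ((1# - B * N′) + (A + B * (T * N′)) * (T * N′) ≈ 0#) ×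
              ((A + B * (T * N′)) * (- N′) ≈ 0#)
            zeros = let (e , f) = pair-zero
                          (E.trans (E.sym (E.trans (E.+-congˡ (pair-scale _ _ _)) (pair-+ _ _ _ _)))
                          expanded)
                    in e , trans (sym (+-identityˡ _)) f

          contradiction : 𝔒ᴱ τ → ⊥
          contradiction (cs , 𝔒cs , e) = finish (divided cs 𝔒cs)
            where
            finish : (∃ λ z → W z × (power cs *ᴱ E.evalMonic cs τ ≈ᴱ 1ᴱ +ᴱ z)) → ⊥
            finish (z , Wz , f) = not-in-W z (E.trans (E.sym f) (E.trans (E.*-congˡ e) (E.zeroʳ _)))
              Wz

        by-cases : Dec (𝔒 N) → 𝔒 N
        by-cases (yes o) = o
        by-cases (no ¬o) = let (N′ , 𝔪N′ , e) = nonintegral-inverse ¬o in ⊥-elim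
          (contradiction N′ 𝔪N′ e 𝔒ᴱτ)

      unit-pair : ∀ {a b} → ¬ (norm a b ≈ 0#) → E.IsUnit (pair a b)
      unit-pair {a} {b} n≉0 = conj (pair a b) *ᴱ ι k , left , E.trans (E.*-comm _ _) left
        where
        k : Carrier
        k = proj₁ (inverse-of (norm a b) n≉0)
        left : (conj (pair a b) *ᴱ ι k) *ᴱ pair a b ≈ᴱ 1ᴱ
        left = E.trans (solveᴱ 3 (λ x c k → (c ⊠ k) ⊠ x ≐ (x ⊠ c) ⊠ k) E.refl (pair a b)
          (conj (pair a b)) (ι k))
          (E.trans (E.*-congʳ (pair-norm a b))
            (E.trans (E.sym (ι-* _ _)) (E.trans (ι-cong (proj₂ (inverse-of (norm a b) n≉0))) ι-1)))

      𝔒-norm : ∀ {a b} → 𝔒 a → 𝔒 b → 𝔒 (norm a b)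
      𝔒-norm a b = 𝔒-+ (𝔒-+ (𝔒-* a a) (𝔒-* 𝔒T (𝔒-* a b))) (𝔒-* 𝔒N (𝔒-* b b))

    discriminant : Carrier
    discriminant = T * T - (N + N + N + N)

    open Neighbours lem F T N 𝔒T 𝔒N using (Splitting; inert; split) public

    IsNorm : Carrier → Set
    IsNorm x = ∃₂ λ a b → norm a b ≈ x

    IsIntegralNorm : Carrier → Set
    IsIntegralNorm x = ∃₂ λ a b → 𝔒 a × 𝔒 b × (norm a b ≈ x)

    module FieldCase (isField : E.IsUnramifiedField) where
      open E.IsUnramifiedField isField using (unramified)

      abstract
        -- By unramifiedness an integral element is a unit or divisible by ϖ. A primitive pair is
        -- not divisible, and the norm of a unit is a unit by multiplicativity.
        norm-unit : ∀ {a b} → 𝔒 a → 𝔒 b → ¬ (𝔪 a × 𝔪 b) → ¬ 𝔪 (norm a b)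
        norm-unit {a} {b} 𝔒a 𝔒b nonzero = by-case (unramified (pair a b) (𝔒⇒𝔒ᴱ 𝔒a 𝔒b))
          where
          Coordinates : Carrierᴱ → Set
          Coordinates y = ∃₂ λ c d → y ≈ᴱ pair c d

          by-case : E.𝔒ᴱ-unit (pair a b) ⊎ (∃ λ y → 𝔒ᴱ y × (pair a b ≈ᴱ ι ϖ *ᴱ y)) → ¬ 𝔪 (norm a b)
          by-case (inj₁ (_ , y , 𝔒y , ab*y≈1)) = use (pair-spanning y)
            where
            use : Coordinates y → ¬ 𝔪 (norm a b)
            use (c , d , y≈) = unit (𝔒-norm (proj₁ 𝔒cd) (proj₂ 𝔒cd))
              (trans (norm-* a b c d) (trans (norm-cong (proj₁ one) (proj₂ one))
                (solve 2 (λ T N → :norm T N :1 :0 := :1) refl T N)))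
              where
              𝔒cd : 𝔒 c × 𝔒 d
              𝔒cd = 𝔒ᴱ⇒𝔒 (𝔒ᴱ-resp y≈ 𝔒y)
              one : (a * c - N * (b * d) ≈ 1#) × (a * d + b * c + T * (b * d) ≈ 0#)
              one = pair-injective (E.trans (E.sym (pair-* a b c d))
                (E.trans (E.*-congˡ (E.sym y≈))
                (E.trans ab*y≈1 (E.sym (E.trans (pair-scalar 1#) ι-1)))))
          by-case (inj₂ (y , 𝔒y , ab≈ϖy)) = use (pair-spanning y)
            where
            use : Coordinates y → ¬ 𝔪 (norm a b)
            use (c , d , y≈) _ = nonzero (𝔪-resp (sym (proj₁ eqs)) (ϖ-𝔪 (proj₁ 𝔒cd)) ,
              𝔪-resp (sym (proj₂ eqs)) (ϖ-𝔪 (proj₂ 𝔒cd)))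
              where
              𝔒cd : 𝔒 c × 𝔒 d
              𝔒cd = 𝔒ᴱ⇒𝔒 (𝔒ᴱ-resp y≈ 𝔒y)
              eqs : (a ≈ ϖ * c) × (b ≈ ϖ * d)
              eqs = pair-injective (E.trans ab≈ϖy (E.trans (E.*-congˡ y≈) (pair-scale ϖ c d)))

        norm-𝔪 : ∀ {a b} → 𝔒 a → 𝔒 b → 𝔪 (norm a b) → 𝔪 a × 𝔪 b
        norm-𝔪 𝔒a 𝔒b m = stable (λ nonzero → norm-unit 𝔒a 𝔒b nonzero m)

        -- After scaling by ϖⁿ⁺¹ the norm lies in 𝔪, so both scaled coordinates do, and one factor ϖ
        -- can be removed. Repeating this clears the whole scaling.
        norm-𝔒 : ∀ {a b} → 𝔒 (norm a b) → 𝔒 a × 𝔒 b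
        norm-𝔒 {a} {b} o = let (n , 𝔒a , 𝔒b) = scale₂ a b in descend n 𝔒a 𝔒b
          where
          descend : ∀ n → 𝔒 (ϖ^ n * a) → 𝔒 (ϖ^ n * b) → 𝔒 a × 𝔒 b
          descend zero    𝔒a 𝔒b = 𝔒-resp (*-identityˡ a) 𝔒a , 𝔒-resp (*-identityˡ b) 𝔒b
          descend (suc n) 𝔒a 𝔒b = descend n (divide (proj₁ small)) (divide (proj₂ small))
            where
            divide : ∀ {x} → 𝔪 (ϖ^ suc n * x) → 𝔒 (ϖ^ n * x)
            divide m = 𝔪-ϖ (𝔪-resp (*-assoc _ _ _) m)
            small : 𝔪 (ϖ^ suc n * a) × 𝔪 (ϖ^ suc n * b)
            small = norm-𝔪 𝔒a 𝔒b (𝔪-resp (sym (norm-scale (ϖ^ suc n) a b))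
              (𝔪-*ˡ (𝔪-*ˡ (ϖ-𝔪 (𝔒ϖ^ n)) (𝔒ϖ^ (suc n))) o))

        -- A norm in 𝔪 comes from coordinates divisible by ϖ, so it is divisible by ϖ².
        ϖu-not-norm : ∀ {u} → 𝔒 u → ¬ 𝔪 u → ¬ IsNorm (ϖ * u)
        ϖu-not-norm {u} 𝔒u ¬𝔪u (a , b , e) = divide (𝔪-divide (proj₁ small))
          (𝔪-divide (proj₂ small))
          where
          𝔒ab : 𝔒 a × 𝔒 b
          𝔒ab = norm-𝔒 (𝔒-resp (sym e) (𝔒-* 𝔒ϖ 𝔒u))
          small : 𝔪 a × 𝔪 b
          small = norm-𝔪 (proj₁ 𝔒ab) (proj₂ 𝔒ab) (𝔪-resp (sym e) (ϖ-𝔪 𝔒u))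
          divide : (∃ λ c → 𝔒 c × (a ≈ ϖ * c)) → (∃ λ d → 𝔒 d × (b ≈ ϖ * d)) → ⊥
          divide (c , 𝔒c , a≈) (d , 𝔒d , b≈) =
            ¬𝔪u (𝔪-resp (*-cancel ϖ ϖ≉0 (trans (sym (*-assoc _ _ _))
            (trans (sym (norm-scale ϖ c d)) (trans (norm-cong (sym a≈) (sym b≈)) e))))
              (ϖ-𝔪 (𝔒-norm 𝔒c 𝔒d)))

        no-root : ∀ y → 𝔒 y → ¬ 𝔪 (y * y - T * y + N)
        no-root y 𝔒y m = norm-unit (𝔒-neg 𝔒y) 𝔒1 (λ (_ , m1) → ¬𝔪1 m1) (𝔪-resp (solve 3 (λ y T N →
          y :* y :- T :* y :+ N := :norm T N (:- y) :1) refl y T N) m)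

        -- Otherwise the residue field has characteristic 2 and T ∈ 𝔪, so τ is
        -- congruent to a square root of -N, which exists as squaring is injective.
        discriminant-unit : ¬ 𝔪 discriminant
        discriminant-unit m = collision (Fin.pigeonhole (ℕ.n<1+n q) square)
          where
          -- The negative of the discriminant is the norm of - T + 2 τ, so `norm-𝔪` puts both
          -- coordinates in 𝔪.
          small : 𝔪 (- T) × 𝔪 (1# + 1#)
          small = norm-𝔪 (𝔒-neg 𝔒T) (𝔒-+ 𝔒1 𝔒1)
            (𝔪-resp (solve 2 (λ T N → :- (T :* T :- (N :+ N :+ N :+ N)) :=
            :norm T N (:- T) (:1 :+ :1)) refl T N) (𝔪-neg m))
          -- q + 1 elements in q residue classes. If - N meets a square, the polynomial has a root
          -- modulo 𝔪; if two squares meet, then so do their roots, since 2 is in 𝔪.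
          target : Fin (suc q) → Carrier
          target zero    = - N
          target (suc i) = residue i * residue i
          𝔒target : ∀ i → 𝔒 (target i)
          𝔒target zero    = 𝔒-neg 𝔒N
          𝔒target (suc i) = 𝔒-* (residue-𝔒 i) (residue-𝔒 i)
          square : Fin (suc q) → Fin q
          square i = nearest (target i) (𝔒target i)
          close : ∀ {i j} → square i ≡ square j → 𝔪 (target j - target i)
          close {i} {j} e = 𝔪-resp (solve 3 (λ a b c → (c :- a) :- (c :- b) := b :- a) refl
            (target i) (target j) (residue (square i)))
            (𝔪-- (nearest-close (target i) (𝔒target i)) (≡.subst (λ k → 𝔪 (residue k - target j))
              (≡.sym e) (nearest-close (target j) (𝔒target j))))
          collision : (∃₂ λ i j → (i Fin.< j) × (square i ≡ square j)) → ⊥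
          collision (zero , suc j , _ , e) = no-root (- residue j) (𝔒-neg (residue-𝔒 j))
            (𝔪-resp (solve 3 (λ r T N →
              (r :* r :- (:- N)) :- (:- T) :* r := (:- r) :* (:- r) :- T :* (:- r) :+ N) refl
                (residue j) T N)
            (𝔪-- (close {zero} {suc j} e) (𝔪-*ˡ (proj₁ small) (residue-𝔒 j))))
          collision (suc i , suc j , i<j , e) =
            Fin.<⇒≢ i<j (≡.cong suc (≡.sym (residue-unique j i (𝔪-square (𝔪-resp (solve 2 (λ a b →
              (b :* b :- a :* a) :- (:1 :+ :1) :* (a :* (b :- a)) := (b :- a) :* (b :- a)) refl
                (residue i) (residue j))
            (𝔪-- (close {suc i} {suc j} e)
              (𝔪-*ˡ (proj₂ small) (𝔒-* (residue-𝔒 i) (𝔒-- (residue-𝔒 j) (residue-𝔒 i))))))))))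

    module SplitCase (isSplit : E.IsSplit) where
      open Split isSplit
      open E.IsSplit isSplit
      private module Φ = RingMorphisms.IsRingIsomorphism iso

      abstract
        𝔒u : 𝔒 u
        𝔒u = root-𝔒 𝔒T (𝔒-neg 𝔒N) (proj₁ (φ-root τ τ²))

        𝔒v : 𝔒 v
        𝔒v = root-𝔒 𝔒T (𝔒-neg 𝔒N) (proj₂ (φ-root τ τ²))

        -- The idempotent (1 , 0) is a root of X² - X, hence integral, hence a + b τ with b
        -- integral. Its two components give a + b u = 1 and a + b v = 0.
        u-v-inverse : ∃ λ b → 𝔒 b × ((u - v) * b ≈ 1#)
        u-v-inverse = use (pair-spanning e)
          where
          e : Carrierᴱ
          e = proj₁ (Φ.surjective (1# , 0#))
          φe : (proj₁ (φ e) ≈ 1#) × (proj₂ (φ e) ≈ 0#)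
          φe = proj₂ (Φ.surjective (1# , 0#)) E.refl
          e² : e *ᴱ e ≈ᴱ e
          e² = Φ.injective (trans (proj₁ (Φ.*-homo e e))
            (trans (*-congˡ (proj₁ φe)) (*-identityʳ _)) ,
                            trans (proj₂ (Φ.*-homo e e))
                              (trans (*-congˡ (proj₂ φe)) (trans (zeroʳ _) (sym (proj₂ φe)))))
          𝔒e : 𝔒ᴱ e
          𝔒e = 0# ∷ - 1# ∷ [] , 𝔒0 ∷ 𝔒-neg 𝔒1 ∷ [] ,
            E.trans (E.+-cong ι-0 (E.*-congˡ (E.+-congʳ (E.trans (ι-neg 1#) (E.-‿cong ι-1)))))
            (combineᴱ₁ 1ᴱ e² (solveᴱ 1 (λ e → (𝟘 ⊞ e ⊠ ((⊟ 𝟙) ⊞ e ⊠ 𝟙)) ⊟ 𝟘 ≐ 𝟙 ⊠ (e ⊠ e ⊟ e))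
              E.refl e))
          use : (∃₂ λ a b → e ≈ᴱ pair a b) → ∃ λ b → 𝔒 b × ((u - v) * b ≈ 1#)
          use (a , b , e≈) = b , proj₂ (𝔒ᴱ⇒𝔒 (𝔒ᴱ-resp e≈ 𝔒e)) ,
            combine₂ 1# (- 1#) (trans (sym (proj₁ (φ-pair a b)))
              (trans (proj₁ (Φ.⟦⟧-cong (E.sym e≈))) (proj₁ φe)))
                               (trans (sym (proj₂ (φ-pair a b)))
                                 (trans (proj₂ (Φ.⟦⟧-cong (E.sym e≈))) (proj₂ φe)))
              (solve 4 (λ a b u v → (u :- v) :* b :- :1
                := :1 :* (a :+ b :* u :- :1) :+ (:- :1) :* (a :+ b :* v :- :0)) refl a b u v)

        u-v-unit : ¬ 𝔪 (u - v)
        u-v-unit = let (b , 𝔒b , e) = u-v-inverse in unit 𝔒b e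

        discriminant-unit : ¬ 𝔪 discriminant
        discriminant-unit m = u-v-unit
          (𝔪-square (𝔪-resp (combine₂ (- (u + v + T)) (1# + 1# + 1# + 1#) u+v≈T uv≈N
          (solve 4 (λ u v T N →
          (T :* T :- (N :+ N :+ N :+ N)) :- (u :- v) :* (u :- v)
            := (:- (u :+ v :+ T)) :* (u :+ v :- T) :+ (:1 :+ :1 :+ :1 :+ :1) :* (u :* v :- N)) refl
            u v T N)) m))

        -- x is the norm of the element with components (x , 1); a and b solve a + b u = x and a + b
        -- v = 1.
        surjective-norm : ∀ x → ∃₂ λ a b → (norm a b ≈ x) × (𝔒 x → 𝔒 a × 𝔒 b)
        surjective-norm x = use u-v-inverse
          where
          use : (∃ λ b → 𝔒 b × ((u - v) * b ≈ 1#)) → ∃₂ λ a b → (norm a b ≈ x) × (𝔒 x → 𝔒 a × 𝔒 b)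
          use (k , 𝔒k , e) = 1# - ((x - 1#) * k) * v , (x - 1#) * k ,
            trans (combine₂ (- (a * b)) (- (b * b)) u+v≈T uv≈N (solve 6 (λ a b u v T N →
                :norm T N a b :- (a :+ b :* u) :* (a :+ b :* v)
                := (:- (a :* b)) :* (u :+ v :- T) :+ (:- (b :* b)) :* (u :* v :- N)) refl a b u v T
                  N))
              (combine₁ (x - 1#) e (solve 4 (λ x k u v →
                ((:1 :- ((x :- :1) :* k) :* v) :+ ((x :- :1) :* k) :* u)
                  :* ((:1 :- ((x :- :1) :* k) :* v) :+ ((x :- :1) :* k) :* v) :- x
                := (x :- :1) :* ((u :- v) :* k :- :1)) refl x k u v)) ,
            λ 𝔒x → 𝔒-- 𝔒1 (𝔒-* (𝔒-* (𝔒-- 𝔒x 𝔒1) 𝔒k) 𝔒v) , 𝔒-* (𝔒-- 𝔒x 𝔒1) 𝔒k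
            where
            b a : Carrier
            b = (x - 1#) * k
            a = 1# - b * v

    abstract
      discriminant-unit : ¬ 𝔪 discriminant
      discriminant-unit = by-type unr
        where
        by-type : E.Unramified → ¬ 𝔪 discriminant
        by-type (inj₁ isField) = FieldCase.discriminant-unit isField
        by-type (inj₂ isSplit) = SplitCase.discriminant-unit isSplit

    module Character (ε : Fˣ → Sign) (isNormCharacter : E.IsNormCharacter ε) where
      private module N = E.IsNormCharacter isNormCharacter

      abstract
        ε-norm : ∀ x → IsNorm (proj₁ x) → ε x ≡ Sign.+
        ε-norm (x , x≉0) (a , b , e) = Equivalence.from (N.kernel (x , x≉0))
          (pair a b , unit-pair (λ z → x≉0 (trans (sym e) z)) ,
            E.trans (ι-cong (sym e)) (E.sym (pair-norm a b)))

        norm-ε : ∀ x → ε x ≡ Sign.+ → IsNorm (proj₁ x)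
        norm-ε x e = use (Equivalence.to (N.kernel x) e)
          where
          use : (∃ λ y → E.IsUnit y × E.HasNorm y (proj₁ x)) → IsNorm (proj₁ x)
          use (y , _ , h) = coordinates (pair-spanning y)
            where
            coordinates : (∃₂ λ a b → y ≈ᴱ pair a b) → IsNorm (proj₁ x)
            coordinates (a , b , y≈) = a , b ,
              ι-injective (E.trans (E.sym (pair-norm a b))
              (E.trans (E.*-cong (E.sym y≈) (C.⟦⟧-cong (E.sym y≈))) (E.sym h)))

      ϖˣ : Fˣ
      ϖˣ = ϖ , ϖ≉0

      κ : Sign
      κ = ε ϖˣ

      abstract
        ε-field : E.IsUnramifiedField → ∀ u (u≉0 : ¬ (u ≈ 0#)) → 𝔒 u → ¬ 𝔪 u → ε (ϖˣ *ˣ (u , u≉0)) ≡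
          Sign.-
        ε-field isField u u≉0 𝔒u ¬𝔪u = by-sign (ε (ϖˣ *ˣ (u , u≉0))) ≡.refl
          where
          by-sign : ∀ s → ε (ϖˣ *ˣ (u , u≉0)) ≡ s → ε (ϖˣ *ˣ (u , u≉0)) ≡ Sign.-
          by-sign Sign.- e = e
          by-sign Sign.+ e = ⊥-elim (FieldCase.ϖu-not-norm isField 𝔒u ¬𝔪u
            (norm-ε (ϖˣ *ˣ (u , u≉0)) e))

        κ-field : E.IsUnramifiedField → κ ≡ Sign.-
        κ-field isField = ≡.trans (N.cong ϖˣ (ϖˣ *ˣ (1# , 1≉0)) (sym (*-identityʳ ϖ)))
          (ε-field isField 1# 1≉0 𝔒1 ¬𝔪1)

        -- If u were not a norm then ϖ u would be one, as ε takes only two values; so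
        -- Hensel's lemma is not needed for the surjectivity of the norm on units.
        ε-unit-field : E.IsUnramifiedField → ∀ u (u≉0 : ¬ (u ≈ 0#)) → 𝔒 u → ¬ 𝔪 u → ε (u , u≉0) ≡
          Sign.+
        ε-unit-field isField u u≉0 𝔒u ¬𝔪u = by-sign (ε (u , u≉0))
          (≡.trans (≡.sym (N.homo ϖˣ (u , u≉0))) (ε-field isField u u≉0 𝔒u ¬𝔪u))
          where
          by-sign : ∀ s → κ Sign.* s ≡ Sign.- → s ≡ Sign.+
          by-sign Sign.+ e = ≡.refl
          by-sign Sign.- e with () ← ≡.trans (≡.sym e) (≡.cong (Sign._* Sign.-) (κ-field isField))

        splitting : Splitting κ
        splitting = by-type unr
          where
          by-type : E.Unramified → Splitting κ
          by-type (inj₁ isField) = ≡.subst Splitting (≡.sym (κ-field isField))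
            (inert (FieldCase.no-root isField))
          by-type (inj₂ isSplit) = ≡.subst Splitting
            (≡.sym (ε-norm ϖˣ (let (a , b , e , _) = SplitCase.surjective-norm isSplit ϖ in a , b ,
            e)))
            (split (Split.u isSplit) (Split.v isSplit) (SplitCase.𝔒u isSplit) (SplitCase.𝔒v isSplit)
              (Split.u+v≈T isSplit) (Split.uv≈N isSplit) (SplitCase.u-v-unit isSplit))

        -- Integral coordinates matter, and not only ε = +, because `factorization-unit` uses them
        -- to build a matrix over 𝔒.
        unit-norm : ∀ u → 𝔒 u → ¬ 𝔪 u → IsIntegralNorm u
        unit-norm u 𝔒u ¬𝔪u = by-type unr
          where
          by-type : E.Unramified → IsIntegralNorm u
          by-type (inj₁ isField) = let (a , b , e) = norm-ε (u , ¬𝔪⇒≉0 ¬𝔪u)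
                                         (ε-unit-field isField u (¬𝔪⇒≉0 ¬𝔪u) 𝔒u ¬𝔪u)
                                       (𝔒a , 𝔒b) = FieldCase.norm-𝔒 isField (𝔒-resp (sym e) 𝔒u) in
                                         a , b , 𝔒a , 𝔒b , e
          by-type (inj₂ isSplit) = let (a , b , e , o) = SplitCase.surjective-norm isSplit u in a ,
            b , proj₁ (o 𝔒u) , proj₂ (o 𝔒u) , e

-- Test functions on spaces and on their quotients

record IsTopology (X : Space) : Set₁ where
  open Space X
  field
    whole     : IsOpen (λ _ → ⊤)
    intersect : ∀ {U V} → IsOpen U → IsOpen V → IsOpen (λ x → U x × V x)
    -- Closure under unions in pointwise form, which is how local constancy delivers its
    -- neighbourhoods.
    local     : ∀ P → (∀ x → P x → Σ (Pred Pt 0ℓ) λ U → IsOpen U × U x × (∀ y → U y → P y)) →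
      IsOpen P

module TestFunctions (X : Space) (top : IsTopology X) where
  open Space X
  open IsTopology top

  IsTest : (Pt → ℚ) → Set₁
  IsTest f = LocallyConstant X f × Compact X (λ x → f x ≢ 0ℚ)

  toTest : ∀ {f} → IsTest f → TestFunction X
  toTest {f} (l , c) = test f l c

  constant-on : ∀ {f} → LocallyConstant X f → ∀ v → IsOpen (λ x → f x ≡ v)
  constant-on {f} l v = local (λ x → f x ≡ v) neighbourhood
    where
    neighbourhood : ∀ x → f x ≡ v → Σ (Pred Pt 0ℓ) λ U → IsOpen U × U x × (∀ y → U y → f y ≡ v)
    neighbourhood x e = let (U , open-U , Ux , const) = l x in U , open-U , Ux ,
      λ y Uy → ≡.trans (const y Uy) e

  -- A closed subset of a compact set is compact: the open set where f vanishes joins the cover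
  -- under the index `nothing` and is discarded afterwards.
  compact-support : ∀ {f C} → LocallyConstant X f → Compact X C → (∀ x → f x ≢ 0ℚ → C x) →
    Compact X (λ x → f x ≢ 0ℚ)
  compact-support {f} {C} l compact sub I U opens covers =
    let (is , covered) = compact (Maybe I) U⁺ opens⁺ (λ x _ → covers⁺ x (f x ℚ.≟ 0ℚ)) in
    catMaybes is , λ x f≢0 → clean is x f≢0 (covered x (sub x f≢0))
    where
    U⁺ : Maybe I → Pred Pt 0ℓ
    U⁺ nothing  x = f x ≡ 0ℚ
    U⁺ (just i) x = U i x
    opens⁺ : ∀ i → IsOpen (U⁺ i)
    opens⁺ nothing  = constant-on l 0ℚ
    opens⁺ (just i) = opens i
    covers⁺ : ∀ x → Dec (f x ≡ 0ℚ) → ∃ λ i → U⁺ i x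
    covers⁺ x (yes e)  = nothing , e
    covers⁺ x (no f≢0) = let (i , u) = covers x f≢0 in just i , u
    clean : ∀ is x → f x ≢ 0ℚ → Any (λ i → U⁺ i x) is → Any (λ i → U i x) (catMaybes is)
    clean (nothing ∷ is) x f≢0 (here e)  = ⊥-elim (f≢0 e)
    clean (nothing ∷ is) x f≢0 (there a) = clean is x f≢0 a
    clean (just i ∷ is)  x f≢0 (here u)  = here u
    clean (just i ∷ is)  x f≢0 (there a) = there (clean is x f≢0 a)

  compact-∪ : ∀ {C D} → Compact X C → Compact X D → Compact X (λ x → C x ⊎ D x)
  compact-∪ {C} {D} compact-C compact-D I U opens covers =
    let (is , covered-C) = compact-C I U opens (λ x c → covers x (inj₁ c))
        (js , covered-D) = compact-D I U opens (λ x d → covers x (inj₂ d)) in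
    is ++ js , λ { x (inj₁ c) → Any.++⁺ˡ (covered-C x c) ; x (inj₂ d) →
      Any.++⁺ʳ is (covered-D x d) }

  isTest-cong : ∀ {f g} → (∀ x → f x ≡ g x) → IsTest f → IsTest g
  isTest-cong {f} {g} e (l , c) = l′ ,
    compact-support l′ c (λ x g≢0 f≡0 → g≢0 (≡.trans (≡.sym (e x)) f≡0))
    where
    l′ : LocallyConstant X g
    l′ x = let (U , open-U , Ux , const) = l x in
           U , open-U , Ux , λ y Uy → ≡.trans (≡.sym (e y)) (≡.trans (const y Uy) (e x))

  isTest-zero : IsTest (λ _ → 0ℚ)
  isTest-zero = (λ x → (λ _ → ⊤) , whole , tt , λ _ _ → ≡.refl) ,
                (λ I U opens covers → [] , λ x 0≢0 → ⊥-elim (0≢0 ≡.refl))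

  isTest-+ : ∀ {f g} → IsTest f → IsTest g → IsTest (λ x → f x ℚ.+ g x)
  isTest-+ {f} {g} (l , c) (l′ , c′) = l⁺ ,
    compact-support l⁺ (compact-∪ c c′) (λ x ≢0 → one-nonzero x ≢0 (f x ℚ.≟ 0ℚ))
    where
    l⁺ : LocallyConstant X (λ x → f x ℚ.+ g x)
    l⁺ x = let (U , open-U , Ux , const) = l x
               (V , open-V , Vx , const′) = l′ x in
           (λ y → U y × V y) , intersect open-U open-V , (Ux , Vx) ,
           λ y (Uy , Vy) → ≡.cong₂ ℚ._+_ (const y Uy) (const′ y Vy)
    one-nonzero : ∀ x → f x ℚ.+ g x ≢ 0ℚ → Dec (f x ≡ 0ℚ) → (f x ≢ 0ℚ) ⊎ (g x ≢ 0ℚ)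
    one-nonzero x ≢0 (no f≢0) = inj₁ f≢0
    one-nonzero x ≢0 (yes f≡0) = inj₂ (λ g≡0 → ≢0 (≡.cong₂ ℚ._+_ f≡0 g≡0))

  isTest-* : ∀ c {f} → IsTest f → IsTest (λ x → c ℚ.* f x)
  isTest-* k {f} (l , c) = l′ ,
    compact-support l′ c (λ x ≢0 f≡0 → ≢0 (≡.trans (≡.cong (k ℚ.*_) f≡0) (ℚ.*-zeroʳ k)))
    where
    l′ : LocallyConstant X (λ x → k ℚ.* f x)
    l′ x = let (U , open-U , Ux , const) = l x in U , open-U , Ux ,
      λ y Uy → ≡.cong (k ℚ.*_) (const y Uy)

  module Integration (μ : Measure X) where
    open Measure μ
    open TestFunction

    -- A test function carries its proofs; homogeneity with factor 1 shows that the integral sees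
    -- the values alone.
    ∫-cong : ∀ φ ψ → (∀ x → fun φ x ≡ fun ψ x) → ∫ φ ≡ ∫ ψ
    ∫-cong φ ψ e = ≡.trans (homogeneous 1ℚ ψ φ
      (λ x → ≡.trans (e x) (≡.sym (ℚ.*-identityˡ (fun ψ x))))) (ℚ.*-identityˡ (∫ ψ))

    ∫-zero : ∀ φ → (∀ x → fun φ x ≡ 0ℚ) → ∫ φ ≡ 0ℚ
    ∫-zero φ e = ≡.trans (homogeneous 0ℚ φ φ (λ x → ≡.trans (e x) (≡.sym (ℚ.*-zeroˡ (fun φ x)))))
      (ℚ.*-zeroˡ (∫ φ))

module _ (lem : ExcludedMiddle 0ℓ) (X : Space) (top : IsTopology X) where
  open Space X
  open Counting lem
  open TestFunctions X top

  isTest-∑ : ∀ n {f : Fin n → Pt → ℚ} → (∀ i → IsTest (f i)) → IsTest (λ x → ∑ n (λ i → f i x))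
  isTest-∑ zero    t = isTest-zero
  isTest-∑ (suc n) t = isTest-+ (t zero) (isTest-∑ n (t ∘ suc))

  ∫-∑ : ∀ (μ : Measure X) n {f : Fin n → Pt → ℚ} (t : ∀ i → IsTest (f i)) →
        Measure.∫ μ (toTest (isTest-∑ n t)) ≡ ∑ n (λ i → Measure.∫ μ (toTest (t i)))
  ∫-∑ μ zero    t = Integration.∫-zero μ (toTest isTest-zero) (λ _ → ≡.refl)
  ∫-∑ μ (suc n) t = ≡.trans (Measure.additive μ (toTest (t zero)) (toTest (isTest-∑ n (t ∘ suc)))
    (toTest (isTest-∑ (suc n) t)) (λ _ → ≡.refl))
    (≡.cong (Measure.∫ μ (toTest (t zero)) ℚ.+_) (∫-∑ μ n (t ∘ suc)))

module _ {X Y : Space} (topX : IsTopology X) (topY : IsTopology Y) where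
  private
    module X = Space X
    module Y = Space Y
    module TX = TestFunctions X topX
    module TY = TestFunctions Y topY

  -- g and h need to be mutually inverse only as far as open sets can tell, since points are
  -- representatives whose matrix entries agree only up to the equality of F.
  isTest-pullback : (g : X.Pt → Y.Pt) (h : Y.Pt → X.Pt) →
    (∀ {U} → Y.IsOpen U → X.IsOpen (U ∘ g)) → (∀ {U} → X.IsOpen U → Y.IsOpen (U ∘ h)) →
    (∀ {U} → X.IsOpen U → ∀ x → U (h (g x)) → U x) →
      (∀ {U} → Y.IsOpen U → ∀ y → U y → U (g (h y))) →
    ∀ {f} → TY.IsTest f → TX.IsTest (f ∘ g)
  isTest-pullback g h g-cont h-cont hg gh {f} (l , c) = l′ , c′
    where
    l′ : LocallyConstant X (f ∘ g)
    l′ x = let (U , open-U , Ux , const) = l (g x) in U ∘ g , g-cont open-U , Ux , λ y → const (g y)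
    fgh : ∀ y → f (g (h y)) ≡ f y
    fgh y = let (U , open-U , Uy , const) = l y in const (g (h y)) (gh open-U y Uy)
    c′ : Compact X (λ x → f (g x) ≢ 0ℚ)
    c′ I U opens covers =
      let (is , covered) = c I (λ i → U i ∘ h) (λ i → h-cont (opens i))
            (λ y f≢0 → covers (h y) (λ e → f≢0 (≡.trans (≡.sym (fgh y)) e))) in
      is , λ x f≢0 → Any.map (λ {i} → hg (opens i) x) (covered (g x) f≢0)

module Topology (lem : ExcludedMiddle 0ℓ) (F : LocalField) where
  open LocalField F hiding (zero)
  open Matrices F
  open Valuation lem F
  open IntegerCoefficients commRing

  ≈ᴹ-sym : ∀ {A B} → A ≈ᴹ B → B ≈ᴹ A
  ≈ᴹ-sym (a , b , c , d) = sym a , sym b , sym c , sym d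

  ≈ᴹ-trans : ∀ {A B C} → A ≈ᴹ B → B ≈ᴹ C → A ≈ᴹ C
  ≈ᴹ-trans (a , b , c , d) (a′ , b′ , c′ , d′) = trans a a′ , trans b b′ , trans c c′ , trans d d′

  ≈ᴹ-refl : ∀ {A} → A ≈ᴹ A
  ≈ᴹ-refl = refl , refl , refl , refl

  abstract
    ⊓-positive : ∀ {δ δ′} → 0ℚ ℚ.< δ → 0ℚ ℚ.< δ′ → 0ℚ ℚ.< δ ℚ.⊓ δ′
    ⊓-positive {δ} {δ′} a b = by-case (ℚ.⊓-sel δ δ′)
      where
      by-case : (δ ℚ.⊓ δ′ ≡ δ) ⊎ (δ ℚ.⊓ δ′ ≡ δ′) → 0ℚ ℚ.< δ ℚ.⊓ δ′
      by-case (inj₁ e) = ≡.subst (0ℚ ℚ.<_) (≡.sym e) a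
      by-case (inj₂ e) = ≡.subst (0ℚ ℚ.<_) (≡.sym e) b

    close-mono : ∀ {δ δ′ A B} → δ ℚ.≤ δ′ → Close δ A B → Close δ′ A B
    close-mono le (a , b , c , d) = ℚ.<-≤-trans a le , ℚ.<-≤-trans b le , ℚ.<-≤-trans c le ,
      ℚ.<-≤-trans d le

    equal-close : ∀ {δ A B} → 0ℚ ℚ.< δ → A ≈ᴹ B → Close δ A B
    equal-close {δ} pos (a , b , c , d) = small a , small b , small c , small d
      where
      small : ∀ {x y} → x ≈ y → ∣ x - y ∣ ℚ.< δ
      small {x} {y} e = ≡.subst (ℚ._< δ)
        (≡.sym (≡.trans (∣∣-cong (trans (+-congʳ e) (-‿inverseʳ y))) ∣0∣)) pos

  module Subspace (A : Set) (entries : A → Mat) where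
    open Space (subspace A entries)

    isTopology : IsTopology (subspace A entries)
    isTopology = record
      { whole     = λ _ _ → 1ℚ , ℚ.positive⁻¹ 1ℚ , λ _ _ → tt
      ; intersect = λ open-U open-V x (Ux , Vx) →
          let (δ , pos , u) = open-U x Ux
              (δ′ , pos′ , v) = open-V x Vx in
          δ ℚ.⊓ δ′ , ⊓-positive pos pos′ , λ y close →
            u y (close-mono (ℚ.p⊓q≤p δ δ′) close) , v y (close-mono (ℚ.p⊓q≤q δ δ′) close)
      ; local     = λ P nbhd x Px →
          let (U , open-U , Ux , sub) = nbhd x Px
              (δ , pos , u) = open-U x Ux in
          δ , pos , λ y close → sub y (u y close)
      }

    open-resp : ∀ {U} → IsOpen U → ∀ {x y} → entries x ≈ᴹ entries y → U x → U y
    open-resp open-U {x} {y} e Ux = let (δ , pos , u) = open-U x Ux in u y (equal-close pos e)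

    Continuous : (A → Carrier) → Set
    Continuous f = ∀ x η → 0ℚ ℚ.< η → ∃ λ δ → (0ℚ ℚ.< δ) × (∀ y → Close δ (entries x) (entries y) →
      ∣ f x - f y ∣ ℚ.< η)

    abstract
      m₁₁-continuous : Continuous (m₁₁ ∘ entries)
      m₁₁-continuous x η pos = η , pos , λ y (a , _ , _ , _) → a

      m₁₂-continuous : Continuous (m₁₂ ∘ entries)
      m₁₂-continuous x η pos = η , pos , λ y (_ , a , _ , _) → a

      m₂₁-continuous : Continuous (m₂₁ ∘ entries)
      m₂₁-continuous x η pos = η , pos , λ y (_ , _ , a , _) → a

      m₂₂-continuous : Continuous (m₂₂ ∘ entries)
      m₂₂-continuous x η pos = η , pos , λ y (_ , _ , _ , a) → a

      const-continuous : ∀ c → Continuous (λ _ → c)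
      const-continuous c x η pos = η , pos ,
        λ y _ → ≡.subst (ℚ._< η) (≡.sym (≡.trans (∣∣-cong (-‿inverseʳ c)) ∣0∣)) pos

      +-continuous : ∀ {f g} → Continuous f → Continuous g → Continuous (λ x → f x + g x)
      +-continuous {f} {g} cf cg x η pos =
        let (δ , pos₁ , u) = cf x η pos
            (δ′ , pos₂ , v) = cg x η pos in
        δ ℚ.⊓ δ′ , ⊓-positive pos₁ pos₂ , λ y close →
          ≡.subst (ℚ._< η) (∣∣-cong (solve 4 (λ a b c d → (a :- c) :+ (b :- d)
            := (a :+ b) :- (c :+ d)) refl (f x) (g x) (f y) (g y)))
            (∣x+y∣< _ _ (u y (close-mono (ℚ.p⊓q≤p δ δ′) close))
              (v y (close-mono (ℚ.p⊓q≤q δ δ′) close)))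

      neg-continuous : ∀ {f} → Continuous f → Continuous (λ x → - f x)
      neg-continuous {f} cf x η pos = let (δ , pos₁ , u) = cf x η pos in δ , pos₁ , λ y close →
        ≡.subst (ℚ._< η) (≡.trans (≡.sym (∣-x∣ _))
          (∣∣-cong (solve 2 (λ a b → :- (a :- b) := (:- a) :- (:- b)) refl (f x) (f y))))
          (u y close)

      *-continuous : ∀ {f g} → Continuous f → Continuous g → Continuous (λ x → f x * g x)
      *-continuous {f} {g} cf cg x η pos =
        let (n , 𝔒fx , 𝔒gx) = scale₂ (f x) (g x)
            -- ∣f x∣ and ∣g x∣ are at most ∣ϖⁿ∣⁻¹. The extra factor ϖ makes the final bound strict
            -- even when f x or g x is zero.
            η₁ = η ℚ.* ∣ ϖ^ suc n ∣
            pos₁ = positive-product η ∣ ϖ^ suc n ∣ pos (∣x∣>0 (ϖ^≉0 (suc n)))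
            (δ₁ , p₁ , u₁) = cf x η₁ pos₁
            (δ₂ , p₂ , u₂) = cf x 1ℚ (ℚ.positive⁻¹ 1ℚ)
            (δ₃ , p₃ , u₃) = cg x η₁ pos₁
            (δ₄ , p₄ , u₄) = cg x η pos
            δ = (δ₁ ℚ.⊓ δ₂) ℚ.⊓ (δ₃ ℚ.⊓ δ₄)
            ≤₁ = ℚ.p⊓q≤p (δ₁ ℚ.⊓ δ₂) (δ₃ ℚ.⊓ δ₄)
            ≤₂ = ℚ.p⊓q≤q (δ₁ ℚ.⊓ δ₂) (δ₃ ℚ.⊓ δ₄)
        in
        δ , ⊓-positive (⊓-positive p₁ p₂) (⊓-positive p₃ p₄) , λ y close →
          estimate n y 𝔒fx 𝔒gx
            (u₁ y (close-mono (ℚ.≤-trans ≤₁ (ℚ.p⊓q≤p δ₁ δ₂)) close))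
            (u₂ y (close-mono (ℚ.≤-trans ≤₁ (ℚ.p⊓q≤q δ₁ δ₂)) close))
            (u₃ y (close-mono (ℚ.≤-trans ≤₂ (ℚ.p⊓q≤p δ₃ δ₄)) close))
            (u₄ y (close-mono (ℚ.≤-trans ≤₂ (ℚ.p⊓q≤q δ₃ δ₄)) close))
        where
        positive-product : ∀ p q → 0ℚ ℚ.< p → 0ℚ ℚ.< q → 0ℚ ℚ.< p ℚ.* q
        positive-product p q 0<p 0<q =
          ℚ.positive⁻¹ (p ℚ.* q) {{ℚ.pos*pos⇒pos p {{ℚ.positive 0<p}} q {{ℚ.positive 0<q}}}}

        scaled : ∀ n a b → 𝔒 (ϖ^ n * a) → ∣ b ∣ ℚ.< η ℚ.* ∣ ϖ^ suc n ∣ → ∣ a * b ∣ ℚ.< η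
        scaled n a b 𝔒a small = ℚ.≤-<-trans
          (≡.subst₂ ℚ._≤_ (≡.sym (∣∣-mult a b)) rearranged
            (ℚ.*-monoˡ-≤-nonNeg ∣ a ∣ {{ℚ.nonNegative (∣∣-nonneg a)}} (ℚ.<⇒≤ small)))
          (≡.subst (η ℚ.* ∣ ϖ^ suc n * a ∣ ℚ.<_) (ℚ.*-identityʳ η)
            (ℚ.*-monoʳ-<-pos η {{ℚ.positive pos}} (𝔪-resp (sym (*-assoc ϖ (ϖ^ n) a)) (ϖ-𝔪 𝔒a))))
          where
          rearranged : ∣ a ∣ ℚ.* (η ℚ.* ∣ ϖ^ suc n ∣) ≡ η ℚ.* ∣ ϖ^ suc n * a ∣
          rearranged = ≡.trans (rearrange ∣ a ∣ η ∣ ϖ^ suc n ∣)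
            (≡.cong (η ℚ.*_) (≡.sym (∣∣-mult (ϖ^ suc n) a)))
            where
            module Q = IntegerCoefficients ℚ.+-*-commutativeRing
            rearrange : ∀ a b c → a ℚ.* (b ℚ.* c) ≡ b ℚ.* (c ℚ.* a)
            rearrange = Q.solve 3 (λ a b c → a Q.:* (b Q.:* c) Q.:= b Q.:* (c Q.:* a)) ≡.refl

        estimate : ∀ n y → 𝔒 (ϖ^ n * f x) → 𝔒 (ϖ^ n * g x) →
          ∣ f x - f y ∣ ℚ.< η ℚ.* ∣ ϖ^ suc n ∣ → ∣ f x - f y ∣ ℚ.< 1ℚ →
          ∣ g x - g y ∣ ℚ.< η ℚ.* ∣ ϖ^ suc n ∣ → ∣ g x - g y ∣ ℚ.< η → ∣ f x * g x - f y * g y ∣ ℚ.<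
            η
        estimate n y 𝔒fx 𝔒gx a₁ a₂ b₁ b₂ = ≡.subst (ℚ._< η)
          (∣∣-cong (solve 4 (λ a b c d →
            (a :* (b :- d) :+ b :* (a :- c)) :+ (:- ((a :- c) :* (b :- d))) := a :* b :- c :* d)
            refl (f x) (g x) (f y) (g y)))
          (∣x+y∣< _ _ (∣x+y∣< _ _ (scaled n (f x) (g x - g y) 𝔒fx b₁)
            (scaled n (g x) (f x - f y) 𝔒gx a₁)) (≡.subst (ℚ._< η) (≡.sym (∣-x∣ _)) product))
          where
          product : ∣ (f x - f y) * (g x - g y) ∣ ℚ.< η
          product = ℚ.≤-<-trans (≡.subst₂ ℚ._≤_ (≡.sym (∣∣-mult (f x - f y) (g x - g y)))
            (ℚ.*-identityˡ ∣ g x - g y ∣)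
            (ℚ.*-monoʳ-≤-nonNeg ∣ g x - g y ∣ {{ℚ.nonNegative (∣∣-nonneg (g x - g y))}} (ℚ.<⇒≤ a₂)))
              b₂

    map-continuous : ∀ {B : Set} {entries′ : B → Mat} (h : A → B) →
      Continuous (m₁₁ ∘ entries′ ∘ h) → Continuous (m₁₂ ∘ entries′ ∘ h) →
        Continuous (m₂₁ ∘ entries′ ∘ h) → Continuous (m₂₂ ∘ entries′ ∘ h) →
      ∀ {U} → Space.IsOpen (subspace B entries′) U → IsOpen (U ∘ h)
    map-continuous h c₁₁ c₁₂ c₂₁ c₂₂ open-U x Ux =
      let (η , pos , u) = open-U (h x) Ux
          (δ₁ , p₁ , u₁) = c₁₁ x η pos
          (δ₂ , p₂ , u₂) = c₁₂ x η pos
          (δ₃ , p₃ , u₃) = c₂₁ x η pos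
          (δ₄ , p₄ , u₄) = c₂₂ x η pos
          ≤₁ = ℚ.p⊓q≤p (δ₁ ℚ.⊓ δ₂) (δ₃ ℚ.⊓ δ₄)
          ≤₂ = ℚ.p⊓q≤q (δ₁ ℚ.⊓ δ₂) (δ₃ ℚ.⊓ δ₄)
      in (δ₁ ℚ.⊓ δ₂) ℚ.⊓ (δ₃ ℚ.⊓ δ₄) , ⊓-positive (⊓-positive p₁ p₂) (⊓-positive p₃ p₄) ,
        λ y close → u (h y)
        ( u₁ y (close-mono (ℚ.≤-trans ≤₁ (ℚ.p⊓q≤p δ₁ δ₂)) close)
        , u₂ y (close-mono (ℚ.≤-trans ≤₁ (ℚ.p⊓q≤q δ₁ δ₂)) close)
        , u₃ y (close-mono (ℚ.≤-trans ≤₂ (ℚ.p⊓q≤p δ₃ δ₄)) close)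
        , u₄ y (close-mono (ℚ.≤-trans ≤₂ (ℚ.p⊓q≤q δ₃ δ₄)) close))

    quotient-isTopology : ∀ (Γ : Set) (_•_ : Γ → A → A) →
      IsTopology (quotient (subspace A entries) Γ _•_)
    quotient-isTopology Γ _•_ = record
      { whole     = whole , λ _ _ → mk⇔ (λ _ → tt) (λ _ → tt)
      ; intersect = λ (open-U , stable-U) (open-V , stable-V) → intersect open-U open-V , λ γ x →
          mk⇔ (λ (u , v) → Equivalence.to (stable-U γ x) u , Equivalence.to (stable-V γ x) v)
              (λ (u , v) → Equivalence.from (stable-U γ x) u , Equivalence.from (stable-V γ x) v)
      ; local     = λ P nbhd →
          local P (λ x Px → let (U , (open-U , _) , Ux , sub) = nbhd x Px in U , open-U , Ux ,
            sub) ,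
          λ γ x → mk⇔ (λ Px → let (U , (_ , stable-U) , Ux , sub) = nbhd x Px in sub (γ • x)
            (Equivalence.to (stable-U γ x) Ux))
                      (λ Pγx → let (U , (_ , stable-U) , Uγx , sub) = nbhd (γ • x) Pγx in sub x
                        (Equivalence.from (stable-U γ x) Uγx))
      }
      where open IsTopology isTopology

-- Matrices, and τ in the basis of a lattice

module MatrixAlgebra (F : LocalField) where
  open LocalField F hiding (zero)
  open Matrices F
  open IntegerCoefficients commRing
  open LinearCombination commRing

  abstract
    ·-cong : ∀ {A B A′ B′} → A ≈ᴹ A′ → B ≈ᴹ B′ → (A · B) ≈ᴹ (A′ · B′)
    ·-cong (a , b , c , d) (e , f , g , h) =
      +-cong (*-cong a e) (*-cong b g) , +-cong (*-cong a f) (*-cong b h) ,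
      +-cong (*-cong c e) (*-cong d g) , +-cong (*-cong c f) (*-cong d h)

    det-cong : ∀ {A B} → A ≈ᴹ B → det A ≈ det B
    det-cong (a , b , c , d) = +-cong (*-cong a d) (-‿cong (*-cong b c))

    ·-assoc : ∀ A B C → ((A · B) · C) ≈ᴹ (A · (B · C))
    ·-assoc (mat a b c d) (mat e f g h) (mat i j k l) = entry a b i k , entry a b j l ,
      entry c d i k , entry c d j l
      where
      entry : ∀ a b i k → (a * e + b * g) * i + (a * f + b * h) * k ≈
        a * (e * i + f * k) + b * (g * i + h * k)
      entry a b i k = solve 8 (λ a b e f g h i k →
        (a :* e :+ b :* g) :* i :+ (a :* f :+ b :* h) :* k
        := a :* (e :* i :+ f :* k) :+ b :* (g :* i :+ h :* k)) refl a b e f g h i k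

  inverseᴳ : GL₂ → GL₂
  inverseᴳ x = inverse x , λ z →
    proj₁ isField (trans (sym (det-inverse x)) (trans (*-congʳ z) (zeroˡ _)))

  abstract
    ·-inverseʳ : ∀ A (g : GL₂) → ((A · proj₁ g) · inverse g) ≈ᴹ A
    ·-inverseʳ (mat a b c d) g@(mat e f g′ h , _) = row a b , row′ a b , row c d , row′ c d
      where
      k : Carrier
      k = inv (detᴳ g)
      row : ∀ a b → (a * e + b * g′) * (k * h) + (a * f + b * h) * (k * - g′) ≈ a
      row a b = combine₁ a (inv-left (detᴳ g)) (solve 7 (λ a b e f g h k →
        ((a :* e :+ b :* g) :* (k :* h) :+ (a :* f :+ b :* h) :* (k :* (:- g))) :- a
          := a :* (k :* (e :* h :- f :* g) :- :1)) refl a b e f g′ h k)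
      row′ : ∀ a b → (a * e + b * g′) * (k * - f) + (a * f + b * h) * (k * e) ≈ b
      row′ a b = combine₁ b (inv-left (detᴳ g)) (solve 7 (λ a b e f g h k →
        ((a :* e :+ b :* g) :* (k :* (:- f)) :+ (a :* f :+ b :* h) :* (k :* e)) :- b
          := b :* (k :* (e :* h :- f :* g) :- :1)) refl a b e f g′ h k)

    ·-inverseˡ : ∀ A (g : GL₂) → ((A · inverse g) · proj₁ g) ≈ᴹ A
    ·-inverseˡ (mat a b c d) g@(mat e f g′ h , _) = row a b , row′ a b , row c d , row′ c d
      where
      k : Carrier
      k = inv (detᴳ g)
      row : ∀ a b → (a * (k * h) + b * (k * - g′)) * e + (a * (k * - f) + b * (k * e)) * g′ ≈ a
      row a b = combine₁ a (inv-left (detᴳ g)) (solve 7 (λ a b e f g h k →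
        ((a :* (k :* h) :+ b :* (k :* (:- g))) :* e :+ (a :* (k :* (:- f)) :+ b :* (k :* e)) :* g)
          :- a := a :* (k :* (e :* h :- f :* g) :- :1)) refl a b e f g′ h k)
      row′ : ∀ a b → (a * (k * h) + b * (k * - g′)) * f + (a * (k * - f) + b * (k * e)) * h ≈ b
      row′ a b = combine₁ b (inv-left (detᴳ g)) (solve 7 (λ a b e f g h k →
        ((a :* (k :* h) :+ b :* (k :* (:- g))) :* f :+ (a :* (k :* (:- f)) :+ b :* (k :* e)) :* h)
          :- b := b :* (k :* (e :* h :- f :* g) :- :1)) refl a b e f g′ h k)

module Lattices (lem : ExcludedMiddle 0ℓ) (F : LocalField) (E : QuadraticAlgebra F)
                (τ : QuadraticAlgebra.Carrier E) (gen : QuadraticAlgebra.IsIntegralGenerator E τ)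
                (unr : QuadraticAlgebra.Unramified E) where
  open LocalField F hiding (zero)
  open IntegerCoefficients commRing
  open LinearCombination commRing
  open Valuation lem F
  open MatrixAlgebra F
  open Topology lem F
  open Basis lem F E τ gen
  open Arithmetic unr
  open Endoscopy lem F E τ hiding (T)
  private module Nb = Neighbours lem F T N 𝔒T 𝔒N

  multiplication : Carrier → Carrier → Mat
  multiplication a b = mat a (- (N * b)) b (a + T * b)

  abstract
    det-multiplication : ∀ a b → det (multiplication a b) ≈ norm a b
    det-multiplication a b = solve 4 (λ a b T N → a :* (a :+ T :* b) :- (:- (N :* b)) :* b
      := :norm T N a b) refl a b T N

    multiplication-τ : ∀ a b → QuadraticAlgebra._≈_ E (pair (- (N * b)) (a + T * b))
      (QuadraticAlgebra._*_ E (pair a b) τ)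
    multiplication-τ a b = E.sym
      (E.trans (E.*-congˡ (E.sym pair-τ)) (E.trans (pair-* a b 0# 1#) (pair-cong
      (solve 3 (λ a b N → a :* :0 :- N :* (b :* :1) := :- (N :* b)) refl a b N)
      (solve 3 (λ a b T → a :* :1 :+ b :* :0 :+ T :* (b :* :1) := a :+ T :* b) refl a b T))))
      where module E = QuadraticAlgebra E

    multiplication-represents : ∀ a b → Represents (multiplication a b) (pair a b)
    multiplication-represents a b = QuadraticAlgebra.refl E , multiplication-τ a b

    -- The first column already determines γ, and `Represents` then dictates the second.
    torus-multiplication : ∀ {A} → InTorus A → A ≈ᴹ multiplication (m₁₁ A) (m₂₁ A)
    torus-multiplication {A} (γ , _ , col₁ , col₂) = refl , proj₁ second , refl , proj₂ second
      where
      module E = QuadraticAlgebra E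
      second : (m₁₂ A ≈ - (N * m₂₁ A)) × (m₂₂ A ≈ m₁₁ A + T * m₂₁ A)
      second = pair-injective (E.trans col₂
        (E.trans (E.*-congʳ (E.sym col₁)) (E.sym (multiplication-τ (m₁₁ A) (m₂₁ A)))))

  :p :p′ : ∀ {n} (T N k x₁ x₂ x₃ x₄ : Polynomial n) → Polynomial n
  :p  T N k x₁ x₂ x₃ x₄ = :- (k :* (N :* (x₃ :* x₄) :+ x₁ :* x₂ :+ T :* (x₂ :* x₃)))
  :p′ T N k x₁ x₂ x₃ x₄ = k :* (N :* (x₃ :* x₄) :+ x₁ :* x₂ :+ T :* (x₁ :* x₄))

  module _ (x : GL₂) where
    private
      x₁ x₂ x₃ x₄ : Carrier
      x₁ = m₁₁ (proj₁ x)
      x₂ = m₁₂ (proj₁ x)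
      x₃ = m₂₁ (proj₁ x)
      x₄ = m₂₂ (proj₁ x)

    -- x⁻¹ C x = [[p , r] , [s , p′]] for C the matrix of multiplication by τ.
    k p r s p′ : Carrier
    k  = inv (detᴳ x)
    p  = - (k * (N * (x₃ * x₄) + x₁ * x₂ + T * (x₂ * x₃)))
    r  = - (k * norm x₂ x₄)
    s  = k * norm x₁ x₃
    p′ = k * (N * (x₃ * x₄) + x₁ * x₂ + T * (x₁ * x₄))

    abstract
      k-det : k * (x₁ * x₄ - x₂ * x₃) ≈ 1#
      k-det = inv-left (detᴳ x)

      trace : p + p′ ≈ T
      trace = combine₁ T k-det (solve 7 (λ x₁ x₂ x₃ x₄ k T N →
        (:p T N k x₁ x₂ x₃ x₄ :+ :p′ T N k x₁ x₂ x₃ x₄) :- T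
        := T :* (k :* (x₁ :* x₄ :- x₂ :* x₃) :- :1)) refl x₁ x₂ x₃ x₄ k T N)

      determinant : p * p′ - r * s ≈ N
      determinant = combine₁ (N * (k * (x₁ * x₄ - x₂ * x₃) + 1#)) k-det
        (solve 7 (λ x₁ x₂ x₃ x₄ k T N →
        (:p T N k x₁ x₂ x₃ x₄ :* :p′ T N k x₁ x₂ x₃ x₄
          :- (:- (k :* :norm T N x₂ x₄)) :* (k :* :norm T N x₁ x₃)) :- N
        := (N :* (k :* (x₁ :* x₄ :- x₂ :* x₃) :+ :1)) :* (k :* (x₁ :* x₄ :- x₂ :* x₃) :- :1)) refl
          x₁ x₂ x₃ x₄ k T N)

      conjugate-entries : ∀ {A a b} → A ≈ᴹ multiplication a b → ((inverse x · A) · proj₁ x) ≈ᴹ mat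
        (a + b * p) (b * r) (b * s) (a + b * p′)
      conjugate-entries {A} {a} {b} e =
        ≈ᴹ-trans (·-cong (·-cong (≈ᴹ-refl {inverse x}) e) (≈ᴹ-refl {proj₁ x}))
        ( combine₁ a k-det (solve 9 (λ x₁ x₂ x₃ x₄ k T N a b →
            (((k :* x₄) :* a :+ (k :* (:- x₂)) :* b) :* x₁
              :+ ((k :* x₄) :* (:- (N :* b)) :+ (k :* (:- x₂)) :* (a :+ T :* b)) :* x₃)
              :- (a :+ b :* :p T N k x₁ x₂ x₃ x₄)
            := a :* (k :* (x₁ :* x₄ :- x₂ :* x₃) :- :1)) refl x₁ x₂ x₃ x₄ k T N a b)
        , solve 9 (λ x₁ x₂ x₃ x₄ k T N a b →
            (((k :* x₄) :* a :+ (k :* (:- x₂)) :* b) :* x₂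
              :+ ((k :* x₄) :* (:- (N :* b)) :+ (k :* (:- x₂)) :* (a :+ T :* b)) :* x₄)
            := b :* (:- (k :* :norm T N x₂ x₄))) refl x₁ x₂ x₃ x₄ k T N a b
        , solve 9 (λ x₁ x₂ x₃ x₄ k T N a b →
            (((k :* (:- x₃)) :* a :+ (k :* x₁) :* b) :* x₁
              :+ ((k :* (:- x₃)) :* (:- (N :* b)) :+ (k :* x₁) :* (a :+ T :* b)) :* x₃)
            := b :* (k :* :norm T N x₁ x₃)) refl x₁ x₂ x₃ x₄ k T N a b
        , combine₁ a k-det (solve 9 (λ x₁ x₂ x₃ x₄ k T N a b →
            (((k :* (:- x₃)) :* a :+ (k :* x₁) :* b) :* x₂
              :+ ((k :* (:- x₃)) :* (:- (N :* b)) :+ (k :* x₁) :* (a :+ T :* b)) :* x₄)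
              :- (a :+ b :* :p′ T N k x₁ x₂ x₃ x₄)
            := a :* (k :* (x₁ :* x₄ :- x₂ :* x₃) :- :1)) refl x₁ x₂ x₃ x₄ k T N a b))

  -- The lattice spanned by the columns of x is stable under 𝔒 + ϖⁿ 𝔒ᴱ; the
  -- diagonal entries of ϖⁿ x⁻¹ C x are integral when the others are.
  S : ℕ → GL₂ → Set
  S n x = 𝔒 (ϖ^ n * r x) × 𝔒 (ϖ^ n * s x)

  column₁ column₂ : Mat → Carrier
  column₁ A = norm (m₁₁ A) (m₂₁ A)
  column₂ A = norm (m₁₂ A) (m₂₂ A)

  abstract
    k-ratio : ∀ x y m → det (proj₁ y) ≈ m * det (proj₁ x) → ∀ a → k y * (m * a) ≈ k x * a
    k-ratio x y m e a = combine₃ (k x * a) (- (k y * m * a)) (- (k x * a * k y)) (k-det y) (k-det x)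
      e (solve 6 (λ kx ky Dx Dy m a →
      (ky :* (m :* a)) :- kx :* a := (kx :* a) :* (ky :* Dy :- :1) :+ (:- (ky :* m :* a))
        :* (kx :* Dx :- :1) :+ (:- (kx :* a :* ky)) :* (Dy :- m :* Dx))
      refl (k x) (k y) (det (proj₁ x)) (det (proj₁ y)) m a)

    rs-invariant : ∀ x y m → det (proj₁ y) ≈ m * det (proj₁ x) → column₁ (proj₁ y) ≈
      m * column₁ (proj₁ x) → column₂ (proj₁ y) ≈ m * column₂ (proj₁ x) →
      (r y ≈ r x) × (s y ≈ s x)
    rs-invariant x y m e e₁ e₂ = -‿cong (trans (*-congˡ e₂) (k-ratio x y m e _)) ,
      trans (*-congˡ e₁) (k-ratio x y m e _)

    S-resp : ∀ n {x y} → (r y ≈ r x) × (s y ≈ s x) → S n x → S n y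
    S-resp n (er , es) (a , b) = 𝔒-resp (*-congˡ (sym er)) a , 𝔒-resp (*-congˡ (sym es)) b

    rs-cong : ∀ x y → proj₁ x ≈ᴹ proj₁ y → (r y ≈ r x) × (s y ≈ s x)
    rs-cong x y e@(a , b , c , d) =
      rs-invariant x y 1# (trans (det-cong (≈ᴹ-sym e)) (sym (*-identityˡ _)))
      (trans (norm-cong (sym a) (sym c)) (sym (*-identityˡ _)))
        (trans (norm-cong (sym b) (sym d)) (sym (*-identityˡ _)))

    -- Multiplication by γ multiplies the norms of both columns and the determinant by the same
    -- norm, while r and s are quotients of these. This is what makes fₙ a function on the quotient
    -- by T̃.
    rs-torus : ∀ γ x → InTorus (proj₁ γ) → (r (γ ·ᴳ x) ≈ r x) × (s (γ ·ᴳ x) ≈ s x)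
    rs-torus γ@(A , _) x@(mat x₁ x₂ x₃ x₄ , _) t = rs-invariant x (γ ·ᴳ x) (norm a c)
        (trans (det-· A (proj₁ x)) (*-congʳ (trans (det-cong A≈) (det-multiplication a c))))
        (column x₁ x₃) (column x₂ x₄)
      where
      a c : Carrier
      a = m₁₁ A
      c = m₂₁ A
      A≈ : A ≈ᴹ multiplication a c
      A≈ = torus-multiplication t
      column : ∀ y z → norm (m₁₁ A * y + m₁₂ A * z) (m₂₁ A * y + m₂₂ A * z) ≈ norm a c * norm y z
      column y z = trans (norm-cong
          (trans (+-congˡ (*-congʳ (proj₁ (proj₂ A≈))))
            (solve 5 (λ a c N y z → a :* y :+ (:- (N :* c)) :* z := a :* y :- N :* (c :* z)) refl a
            c N y z))
          (trans (+-congˡ (*-congʳ (proj₂ (proj₂ (proj₂ A≈)))))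
            (solve 5 (λ a c T y z → c :* y :+ (a :+ T :* c) :* z
            := a :* z :+ c :* y :+ T :* (c :* z)) refl a c T y z)))
        (sym (norm-* a c y z))

  -- The q + 1 neighbours of the lattice of x in the tree are the lattices of the
  -- x h, for h one of the steps.
  finiteStep : Fin q → GL₂
  finiteStep i = mat ϖ (residue i) 0# 1# ,
    λ z → ϖ≉0 (trans (solve 2 (λ ϖ e → ϖ := ϖ :* :1 :- e :* :0) refl ϖ (residue i)) z)

  infiniteStep : GL₂
  infiniteStep = mat 1# 0# 0# ϖ ,
    λ z → ϖ≉0 (trans (solve 1 (λ ϖ → ϖ := :1 :* ϖ :- :0 :* :0) refl ϖ) z)

  abstract
    det-step : ∀ (x h : GL₂) → det (proj₁ h) ≈ ϖ → det (proj₁ (x ·ᴳ h)) ≈ det (proj₁ x) * ϖ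
    det-step x h e = trans (det-· (proj₁ x) (proj₁ h)) (*-congˡ e)

    det-finiteStep : ∀ i → det (proj₁ (finiteStep i)) ≈ ϖ
    det-finiteStep i = solve 2 (λ ϖ e → ϖ :* :1 :- e :* :0 := ϖ) refl ϖ (residue i)

    det-infiniteStep : det (proj₁ infiniteStep) ≈ ϖ
    det-infiniteStep = solve 1 (λ ϖ → :1 :* ϖ :- :0 :* :0 := ϖ) refl ϖ

    k-step : ∀ x h → det (proj₁ h) ≈ ϖ → ϖ * k (x ·ᴳ h) ≈ k x
    k-step x h e = trans (*-comm _ _) (trans (*-congˡ (sym (*-identityʳ ϖ)))
      (trans (k-ratio x (x ·ᴳ h) ϖ (trans (det-step x h e) (*-comm _ _)) 1#) (*-identityʳ _)))

    -- The step is the unipotent matrix with entry e followed by diag(ϖ , 1). Conjugation by the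
    -- first turns r into Q e; by the second it divides the upper right entry by ϖ and multiplies
    -- the lower left by ϖ.
    ϖr-finiteStep : ∀ x i → ϖ * r (x ·ᴳ finiteStep i) ≈ Nb.Q (p x) (r x) (s x) (p′ x) (trace x)
      (determinant x) (residue i)
    ϖr-finiteStep x i = combine₁ (- norm (m₁₁ (proj₁ x) * residue i + m₁₂ (proj₁ x) * 1#)
      (m₂₁ (proj₁ x) * residue i + m₂₂ (proj₁ x) * 1#)) (k-step x (finiteStep i) (det-finiteStep i))
      (solve 10 (λ x₁ x₂ x₃ x₄ k k′ T N ϖ e →
        ϖ :* (:- (k′ :* :norm T N (x₁ :* e :+ x₂ :* :1) (x₃ :* e :+ x₄ :* :1)))
        :- (((:- (k :* :norm T N x₂ x₄)) :+ e :* (:p T N k x₁ x₂ x₃ x₄ :- :p′ T N k x₁ x₂ x₃ x₄))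
          :- e :* e :* (k :* :norm T N x₁ x₃))
        := (:- :norm T N (x₁ :* e :+ x₂ :* :1) (x₃ :* e :+ x₄ :* :1)) :* (ϖ :* k′ :- k))
        refl (m₁₁ (proj₁ x)) (m₁₂ (proj₁ x)) (m₂₁ (proj₁ x)) (m₂₂ (proj₁ x)) (k x)
          (k (x ·ᴳ finiteStep i)) T N ϖ (residue i))

    s-finiteStep : ∀ x i → s (x ·ᴳ finiteStep i) ≈ ϖ * s x
    s-finiteStep x i = combine₁ (ϖ * norm (m₁₁ (proj₁ x)) (m₂₁ (proj₁ x)))
      (k-step x (finiteStep i) (det-finiteStep i))
      (solve 9 (λ x₁ x₂ x₃ x₄ k k′ T N ϖ →
        k′ :* (:norm T N (x₁ :* ϖ :+ x₂ :* :0) (x₃ :* ϖ :+ x₄ :* :0))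
        :- ϖ :* (k :* :norm T N x₁ x₃)
        := (ϖ :* :norm T N x₁ x₃) :* (ϖ :* k′ :- k))
        refl (m₁₁ (proj₁ x)) (m₁₂ (proj₁ x)) (m₂₁ (proj₁ x)) (m₂₂ (proj₁ x)) (k x)
          (k (x ·ᴳ finiteStep i)) T N ϖ)

    r-infiniteStep : ∀ x → r (x ·ᴳ infiniteStep) ≈ ϖ * r x
    r-infiniteStep x = combine₁ (- (ϖ * norm (m₁₂ (proj₁ x)) (m₂₂ (proj₁ x))))
      (k-step x infiniteStep det-infiniteStep)
      (solve 9 (λ x₁ x₂ x₃ x₄ k k′ T N ϖ →
        (:- (k′ :* :norm T N (x₁ :* :0 :+ x₂ :* ϖ) (x₃ :* :0 :+ x₄ :* ϖ)))
        :- ϖ :* (:- (k :* :norm T N x₂ x₄))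
        := (:- (ϖ :* :norm T N x₂ x₄)) :* (ϖ :* k′ :- k))
        refl (m₁₁ (proj₁ x)) (m₁₂ (proj₁ x)) (m₂₁ (proj₁ x)) (m₂₂ (proj₁ x)) (k x)
          (k (x ·ᴳ infiniteStep)) T N ϖ)

    ϖs-infiniteStep : ∀ x → ϖ * s (x ·ᴳ infiniteStep) ≈ s x
    ϖs-infiniteStep x = combine₁ (norm (m₁₁ (proj₁ x)) (m₂₁ (proj₁ x)))
      (k-step x infiniteStep det-infiniteStep)
      (solve 9 (λ x₁ x₂ x₃ x₄ k k′ T N ϖ →
        ϖ :* (k′ :* :norm T N (x₁ :* :1 :+ x₂ :* :0) (x₃ :* :1 :+ x₄ :* :0))
        :- k :* (:norm T N x₁ x₃)
        := :norm T N x₁ x₃ :* (ϖ :* k′ :- k))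
        refl (m₁₁ (proj₁ x)) (m₁₂ (proj₁ x)) (m₂₁ (proj₁ x)) (m₂₂ (proj₁ x)) (k x)
          (k (x ·ᴳ infiniteStep)) T N ϖ)


    𝔪-scaled : ∀ n {a b} → ϖ * a ≈ b → (𝔒 (ϖ^ n * a) → 𝔪 (ϖ^ n * b)) × (𝔪 (ϖ^ n * b) → 𝔒 (ϖ^ n * a))
    𝔪-scaled n {a} {b} e = (λ o → 𝔪-resp eq (ϖ-𝔪 o)) , (λ m → 𝔪-ϖ (𝔪-resp (sym eq) m))
      where
      eq : ϖ * (ϖ^ n * a) ≈ ϖ^ n * b
      eq = trans (solve 3 (λ ϖ c a → ϖ :* (c :* a) := c :* (ϖ :* a)) refl ϖ (ϖ^ n) a) (*-congˡ e)

    𝔒-scaled : ∀ n {a b} → a ≈ ϖ * b → (𝔒 (ϖ^ n * a) → 𝔒 (ϖ^ suc n * b)) ×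
      (𝔒 (ϖ^ suc n * b) → 𝔒 (ϖ^ n * a))
    𝔒-scaled n {a} {b} e = 𝔒-resp eq , 𝔒-resp (sym eq)
      where
      eq : ϖ^ n * a ≈ ϖ^ suc n * b
      eq = trans (*-congˡ e) (solve 3 (λ ϖ c b → c :* (ϖ :* b) := (ϖ :* c) :* b) refl ϖ (ϖ^ n) b)

  module At (x : GL₂) where
    FiniteNeighbour : ℕ → Fin q → Set
    FiniteNeighbour = Nb.FiniteNeighbour (p x) (r x) (s x) (p′ x) (trace x) (determinant x)

    InfiniteNeighbour : ℕ → Set
    InfiniteNeighbour = Nb.InfiniteNeighbour (p x) (r x) (s x) (p′ x) (trace x) (determinant x)

    abstract
      finiteStep-S : ∀ n i → (S n (x ·ᴳ finiteStep i) → FiniteNeighbour n i) ×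
        (FiniteNeighbour n i → S n (x ·ᴳ finiteStep i))
      finiteStep-S n i =
        (λ (a , b) → proj₁ (𝔪-scaled n (ϖr-finiteStep x i)) a ,
          proj₁ (𝔒-scaled n (s-finiteStep x i)) b) ,
        (λ (a , b) → proj₂ (𝔪-scaled n (ϖr-finiteStep x i)) a ,
          proj₂ (𝔒-scaled n (s-finiteStep x i)) b)

      infiniteStep-S : ∀ n → (S n (x ·ᴳ infiniteStep) → InfiniteNeighbour n) ×
        (InfiniteNeighbour n → S n (x ·ᴳ infiniteStep))
      infiniteStep-S n =
        (λ (a , b) → proj₁ (𝔪-scaled n (ϖs-infiniteStep x)) b ,
          proj₁ (𝔒-scaled n (r-infiniteStep x)) a) ,
        (λ (a , b) → proj₂ (𝔒-scaled n (r-infiniteStep x)) b ,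
          proj₂ (𝔪-scaled n (ϖs-infiniteStep x)) a)

-- Lattices stable under the maximal order lie in T̃ K

module Factorizations (lem : ExcludedMiddle 0ℓ) (F : LocalField) (E : QuadraticAlgebra F)
                      (τ : QuadraticAlgebra.Carrier E)
                        (gen : QuadraticAlgebra.IsIntegralGenerator E τ)
                      (unr : QuadraticAlgebra.Unramified E)
                      (ε : LocalField.Fˣ F → Sign)
                        (isNormCharacter : QuadraticAlgebra.IsNormCharacter E ε) where
  open LocalField F hiding (zero)
  open IntegerCoefficients commRing
  open LinearCombination commRing
  open Valuation lem F
  open MatrixAlgebra F
  open Topology lem F
  open Basis lem F E τ gen
  open Arithmetic unr
  open Character ε isNormCharacter
  open Endoscopy lem F E τ renaming (T to Torus)
  open Lattices lem F E τ gen unr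
  private
    module Nb = Neighbours lem F T N 𝔒T 𝔒N
    module E = QuadraticAlgebra E

  abstract
    integral-· : ∀ {A B} → Integral A → Integral B → Integral (A · B)
    integral-· (a , b , c , d) (e , f , g , h) =
      𝔒-+ (𝔒-* a e) (𝔒-* b g) , 𝔒-+ (𝔒-* a f) (𝔒-* b h) , 𝔒-+ (𝔒-* c e) (𝔒-* d g) ,
        𝔒-+ (𝔒-* c f) (𝔒-* d h)

    integral-resp : ∀ {A B} → A ≈ᴹ B → Integral A → Integral B
    integral-resp (e₁ , e₂ , e₃ , e₄) (a , b , c , d) = 𝔒-resp e₁ a , 𝔒-resp e₂ b , 𝔒-resp e₃ c ,
      𝔒-resp e₄ d

    multiplication-cong : ∀ {a b c d} → a ≈ c → b ≈ d → multiplication a b ≈ᴹ multiplication c d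
    multiplication-cong e f = e , -‿cong (*-congˡ f) , f , +-cong e (*-congˡ f)

    multiplication-· : ∀ a b c d → (multiplication a b · multiplication c d) ≈ᴹ multiplication
      (a * c - N * (b * d)) (a * d + b * c + T * (b * d))
    multiplication-· a b c d =
      solve 6 (λ a b c d T N → a :* c :+ (:- (N :* b)) :* d := a :* c :- N :* (b :* d)) refl a b c d
        T N ,
      solve 6 (λ a b c d T N → a :* (:- (N :* d)) :+ (:- (N :* b)) :* (c :+ T :* d)
        := :- (N :* (a :* d :+ b :* c :+ T :* (b :* d)))) refl a b c d T N ,
      solve 6 (λ a b c d T N → b :* c :+ (a :+ T :* b) :* d := a :* d :+ b :* c :+ T :* (b :* d))
        refl a b c d T N ,
      solve 6 (λ a b c d T N → b :* (:- (N :* d)) :+ (a :+ T :* b) :* (c :+ T :* d)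
        := (a :* c :- N :* (b :* d)) :+ T :* (a :* d :+ b :* c :+ T :* (b :* d))) refl a b c d T N

    integral-multiplication : ∀ {a b} → 𝔒 a → 𝔒 b → Integral (multiplication a b)
    integral-multiplication 𝔒a 𝔒b = 𝔒a , 𝔒-neg (𝔒-* 𝔒N 𝔒b) , 𝔒b , 𝔒-+ 𝔒a (𝔒-* 𝔒T 𝔒b)

    S₀-integral : ∀ x → S 0 x → 𝔒 (r x) × 𝔒 (s x) × 𝔒 (p x) × 𝔒 (p′ x)
    S₀-integral x (a , b) = 𝔒-resp (*-identityˡ _) a , 𝔒-resp (*-identityˡ _) b ,
      𝔒-resp (*-identityˡ _) (Nb.diagonal-integral (p x) (r x) (s x) (p′ x) (trace x)
        (determinant x) 𝔒1 a b) ,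
      𝔒-resp (*-identityˡ _) (Nb.diagonal-integral′ (p x) (r x) (s x) (p′ x) (trace x)
        (determinant x) 𝔒1 a b)

    S₀-intro : ∀ x → 𝔒 (r x) → 𝔒 (s x) → S 0 x
    S₀-intro x a b = 𝔒-resp (sym (*-identityˡ _)) a , 𝔒-resp (sym (*-identityˡ _)) b

    S₀-SL₂ : ∀ κ → SL₂⟨𝔒⟩ κ → S 0 (SL₂→GL₂ κ)
    S₀-SL₂ κ@(A , detA) (a , b , c , d) = S₀-intro (SL₂→GL₂ κ)
        (𝔒-neg (𝔒-* 𝔒k (𝔒-norm b d))) (𝔒-* 𝔒k (𝔒-norm a c))
      where
      𝔒k : 𝔒 (k (SL₂→GL₂ κ))
      𝔒k = 𝔒-resp (trans (sym (k-det (SL₂→GL₂ κ))) (trans (*-congˡ detA) (*-identityʳ _))) 𝔒1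

  -- Membership in T̃ K. Keeping the equality of norm and determinant shows later that ε(det x) = +,
  -- and that the torus factor has norm one when x is in SL₂.
  Factorization : GL₂ → Set
  Factorization x = ∃₂ λ a c → Σ SL₂ λ κ → (norm a c ≈ det (proj₁ x)) × SL₂⟨𝔒⟩ κ ×
    (proj₁ x ≈ᴹ (multiplication a c · proj₁ κ))

  abstract
    factorization-unit : ∀ x → S 0 x → ¬ 𝔪 (s x) → Factorization x
    factorization-unit x Sx ¬𝔪s = use (unit-inverse ¬𝔪s)
      where
      x₁ x₂ x₃ x₄ : Carrier
      x₁ = m₁₁ (proj₁ x)
      x₂ = m₁₂ (proj₁ x)
      x₃ = m₂₁ (proj₁ x)
      x₄ = m₂₂ (proj₁ x)
      𝔒s : 𝔒 (s x)
      𝔒s = proj₁ (proj₂ (S₀-integral x Sx))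
      𝔒p : 𝔒 (p x)
      𝔒p = proj₁ (proj₂ (proj₂ (S₀-integral x Sx)))

      use : (∃ λ η → 𝔒 η × (s x * η ≈ 1#)) → Factorization x
      use (η , 𝔒η , sη≈1) = finish (unit-norm η 𝔒η (unit 𝔒s (trans (*-comm _ _) sη≈1)))
        where
        finish : IsIntegralNorm η → Factorization x
        finish (α , β , 𝔒α , 𝔒β , n≈η) = a , c , (D · B , cancel-det) , norm≈det ,
          integral-· 𝔒D 𝔒B , x≈
          where
          -- Write z₁ for the first column as an element of E. Multiplication by z₁ followed by B
          -- would already give x, but B has determinant η. So z₁ is replaced by z₁ (α + β τ), with
          -- N(α + β τ) = η, and D is multiplication by the inverse of α + β τ.
          a c : Carrier
          a = x₁ * α - N * (x₃ * β)
          c = x₁ * β + x₃ * α + T * (x₃ * β)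
          B D : Mat
          B = mat 1# (- (p x * η)) 0# η
          D = multiplication (s x * (α + T * β)) (s x * - β)
          𝔒B : Integral B
          𝔒B = 𝔒1 , 𝔒-neg (𝔒-* 𝔒p 𝔒η) , 𝔒0 , 𝔒η
          𝔒D : Integral D
          𝔒D = integral-multiplication (𝔒-* 𝔒s (𝔒-+ 𝔒α (𝔒-* 𝔒T 𝔒β))) (𝔒-* 𝔒s (𝔒-neg 𝔒β))

          -- From τ z₁ = p z₁ + s z₂ follows z₂ = - p η z₁ + η τ z₁, which is the second column of
          -- B.
          lower : proj₁ x ≈ᴹ (multiplication x₁ x₃ · B)
          lower = solve 2 (λ a b → a := a :* :1 :+ b :* :0) refl x₁ (- (N * x₃)) ,
            sym (combine₂ x₂ (η * (N * x₃)) sη≈1 (k-det x) (solve 8 (λ x₁ x₂ x₃ x₄ k T N η →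
              (x₁ :* (:- (:p T N k x₁ x₂ x₃ x₄ :* η)) :+ (:- (N :* x₃)) :* η) :- x₂
              := x₂ :* ((k :* :norm T N x₁ x₃) :* η :- :1) :+ (η :* (N :* x₃))
                :* (k :* (x₁ :* x₄ :- x₂ :* x₃) :- :1))
              refl x₁ x₂ x₃ x₄ (k x) T N η)) ,
            solve 2 (λ a b → a := a :* :1 :+ b :* :0) refl x₃ (x₁ + T * x₃) ,
            sym (combine₂ x₄ (- (η * (x₁ + T * x₃))) sη≈1 (k-det x)
              (solve 8 (λ x₁ x₂ x₃ x₄ k T N η →
              (x₃ :* (:- (:p T N k x₁ x₂ x₃ x₄ :* η)) :+ (x₁ :+ T :* x₃) :* η) :- x₄
              := x₄ :* ((k :* :norm T N x₁ x₃) :* η :- :1) :+ (:- (η :* (x₁ :+ T :* x₃)))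
                :* (k :* (x₁ :* x₄ :- x₂ :* x₃) :- :1))
              refl x₁ x₂ x₃ x₄ (k x) T N η))

          upper : multiplication x₁ x₃ ≈ᴹ (multiplication a c · D)
          upper = ≈ᴹ-trans (multiplication-cong
              (sym (combine₂ (s x * x₁) x₁ n≈η sη≈1 (solve 8 (λ x₁ x₃ α β s η T N →
                ((x₁ :* α :- N :* (x₃ :* β)) :* (s :* (α :+ T :* β)) :- N
                  :* ((x₁ :* β :+ x₃ :* α :+ T :* (x₃ :* β)) :* (s :* (:- β)))) :- x₁
                := (s :* x₁) :* (:norm T N α β :- η) :+ x₁ :* (s :* η :- :1)) refl x₁ x₃ α β
                  (s x) η T N)))
              (sym (combine₂ (s x * x₃) x₃ n≈η sη≈1 (solve 8 (λ x₁ x₃ α β s η T N →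
                ((x₁ :* α :- N :* (x₃ :* β)) :* (s :* (:- β))
                  :+ (x₁ :* β :+ x₃ :* α :+ T :* (x₃ :* β)) :* (s :* (α :+ T :* β)) :+ T
                  :* ((x₁ :* β :+ x₃ :* α :+ T :* (x₃ :* β)) :* (s :* (:- β)))) :- x₃
                := (s :* x₃) :* (:norm T N α β :- η) :+ x₃ :* (s :* η :- :1)) refl x₁ x₃ α β
                  (s x) η T N))))
            (≈ᴹ-sym (multiplication-· a c _ _))

          x≈ : proj₁ x ≈ᴹ (multiplication a c · (D · B))
          x≈ = ≈ᴹ-trans lower (≈ᴹ-trans (·-cong upper (≈ᴹ-refl {B}))
            (·-assoc (multiplication a c) D B))

          norm≈det : norm a c ≈ det (proj₁ x)
          norm≈det = trans (sym (norm-* x₁ x₃ α β)) (trans (*-congˡ n≈η)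
            (combine₂ (det (proj₁ x)) (- (norm x₁ x₃ * η)) sη≈1 (k-det x) (solve 4 (λ n η D k →
              n :* η :- D := D :* ((k :* n) :* η :- :1) :+ (:- (n :* η)) :* (k :* D :- :1)) refl
                (norm x₁ x₃) η (det (proj₁ x)) (k x))))

          cancel-det : det (D · B) ≈ 1#
          cancel-det = *-cancel (det (proj₁ x)) (proj₂ x)
            (trans (trans (trans (*-congʳ (sym (trans (det-multiplication a c) norm≈det)))
            (sym (det-· (multiplication a c) (D · B)))) (det-cong (≈ᴹ-sym x≈)))
              (sym (*-identityʳ _)))

    k-special : ∀ x u → det (proj₁ u) ≈ 1# → k (x ·ᴳ u) ≈ k x
    k-special x u e = trans (trans (sym (*-identityʳ _)) (*-congˡ (sym (*-identityʳ 1#))))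
      (trans (k-ratio x (x ·ᴳ u) 1#
        (trans (det-· (proj₁ x) (proj₁ u)) (trans (*-congˡ e) (*-comm _ _))) 1#) (*-identityʳ _))

    -- The form v ↦ N(v) / det x on the lattice. Its values are the candidates for s after a change
    -- of basis of determinant one.
    norm-combination : ∀ x a c → let open Mat (proj₁ x) renaming
                                       (m₁₁ to x₁; m₁₂ to x₂; m₂₁ to x₃; m₂₂ to x₄) in
      k x * norm (x₁ * a + x₂ * c) (x₃ * a + x₄ * c) ≈ a * a * s x + a * c * (p′ x - p x) - c * c
        * r x
    norm-combination x a c = solve 9 (λ x₁ x₂ x₃ x₄ k T N a c →
      k :* :norm T N (x₁ :* a :+ x₂ :* c) (x₃ :* a :+ x₄ :* c)
      := a :* a :* (k :* :norm T N x₁ x₃)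
         :+ a :* c :* (:p′ T N k x₁ x₂ x₃ x₄ :- :p T N k x₁ x₂ x₃ x₄)
         :- c :* c :* (:- (k :* :norm T N x₂ x₄)))
      refl (m₁₁ (proj₁ x)) (m₁₂ (proj₁ x)) (m₂₁ (proj₁ x)) (m₂₂ (proj₁ x)) (k x) T N a c

    s-special : ∀ x u → det (proj₁ u) ≈ 1# → let (mat a _ c _) = proj₁ u in
      s (x ·ᴳ u) ≈ a * a * s x + a * c * (p′ x - p x) - c * c * r x
    s-special x u e = trans (*-congʳ (k-special x u e))
      (norm-combination x (m₁₁ (proj₁ u)) (m₂₁ (proj₁ u)))

    r-special : ∀ x u → det (proj₁ u) ≈ 1# → let (mat _ b _ d) = proj₁ u in
      r (x ·ᴳ u) ≈ - (b * b * s x + b * d * (p′ x - p x) - d * d * r x)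
    r-special x u e = -‿cong (trans (*-congʳ (k-special x u e))
      (norm-combination x (m₁₂ (proj₁ u)) (m₂₂ (proj₁ u))))

    S₀-special : ∀ x (u : GL₂) → det (proj₁ u) ≈ 1# → Integral (proj₁ u) → S 0 x → S 0 (x ·ᴳ u)
    S₀-special x u e (a , b , c , d) Sx = S₀-intro (x ·ᴳ u)
        (𝔒-resp (sym (r-special x u e))
          (𝔒-neg (𝔒-- (𝔒-+ (𝔒-* (𝔒-* b b) 𝔒s) (𝔒-* (𝔒-* b d) 𝔒g)) (𝔒-* (𝔒-* d d) 𝔒r))))
        (𝔒-resp (sym (s-special x u e)) (𝔒-- (𝔒-+ (𝔒-* (𝔒-* a a) 𝔒s) (𝔒-* (𝔒-* a c) 𝔒g))
          (𝔒-* (𝔒-* c c) 𝔒r)))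
      where
      𝔒r : 𝔒 (r x)
      𝔒r = proj₁ (S₀-integral x Sx)
      𝔒s : 𝔒 (s x)
      𝔒s = proj₁ (proj₂ (S₀-integral x Sx))
      𝔒g : 𝔒 (p′ x - p x)
      𝔒g = 𝔒-- (proj₂ (proj₂ (proj₂ (S₀-integral x Sx)))) (proj₁ (proj₂ (proj₂ (S₀-integral x Sx))))

    -- The inverse is given without division, so that integrality of its entries is immediate.
    adjugate : (u : SL₂) → SL₂⟨𝔒⟩ u → Σ SL₂ λ v → SL₂⟨𝔒⟩ v × (∀ A → ((A · proj₁ u) · proj₁ v) ≈ᴹ A)
    adjugate (mat a b c d , e) (𝔒a , 𝔒b , 𝔒c , 𝔒d) =
      (mat d (- b) (- c) a , trans (solve 4 (λ a b c d → d :* a :- (:- b) :* (:- c)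
        := a :* d :- b :* c) refl a b c d) e) ,
      (𝔒d , 𝔒-neg 𝔒b , 𝔒-neg 𝔒c , 𝔒a) ,
      λ (mat x₁ x₂ x₃ x₄) → row x₁ x₂ , row′ x₁ x₂ , row x₃ x₄ , row′ x₃ x₄
      where
      row : ∀ x y → (x * a + y * c) * d + (x * b + y * d) * - c ≈ x
      row x y = combine₁ x e (solve 6 (λ a b c d x y →
        ((x :* a :+ y :* c) :* d :+ (x :* b :+ y :* d) :* (:- c)) :- x
        := x :* ((a :* d :- b :* c) :- :1)) refl a b c d x y)
      row′ : ∀ x y → (x * a + y * c) * - b + (x * b + y * d) * a ≈ y
      row′ x y = combine₁ y e (solve 6 (λ a b c d x y →
        ((x :* a :+ y :* c) :* (:- b) :+ (x :* b :+ y :* d) :* a) :- y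
        := y :* ((a :* d :- b :* c) :- :1)) refl a b c d x y)

    factorization-special : ∀ x (u : SL₂) → SL₂⟨𝔒⟩ u → Factorization (x ·ᴳ SL₂→GL₂ u) →
      Factorization x
    factorization-special x u 𝔒u (a , c , κ , n≈ , 𝔒κ , xu≈) = finish (adjugate u 𝔒u)
      where
      finish : (Σ SL₂ λ v → SL₂⟨𝔒⟩ v × (∀ A → ((A · proj₁ u) · proj₁ v) ≈ᴹ A)) → Factorization x
      finish (v , 𝔒v , undo) = a , c , κ ·ˢ v ,
        trans n≈ (trans (det-· (proj₁ x) (proj₁ u)) (trans (*-congˡ (proj₂ u)) (*-identityʳ _))) ,
        integral-· 𝔒κ 𝔒v , ≈ᴹ-trans (≈ᴹ-sym (undo (proj₁ x)))
          (≈ᴹ-trans (·-cong xu≈ (≈ᴹ-refl {proj₁ v}))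
          (·-assoc (multiplication a c) (proj₁ κ) (proj₁ v)))

    -- A lattice stable under 𝔒[τ] has a basis of the form v , τ v: as the
    -- discriminant is a unit, v can be taken among z₁ , z₂ and z₁ + z₂, for z₁
    -- and z₂ the columns of x.
    factorization : ∀ x → S 0 x → Factorization x
    factorization x Sx = by-case (decide (𝔪 (s x))) (decide (𝔪 (r x)))
      where
      rotate shear : SL₂
      rotate = mat 0# (- 1#) 1# 0# , solve 0 (:0 :* :0 :- (:- :1) :* :1 := :1) refl
      shear = mat 1# 0# 1# 1# , solve 0 (:1 :* :1 :- :0 :* :1 := :1) refl
      𝔒rotate : SL₂⟨𝔒⟩ rotate
      𝔒rotate = 𝔒0 , 𝔒-neg 𝔒1 , 𝔒1 , 𝔒0
      𝔒shear : SL₂⟨𝔒⟩ shear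
      𝔒shear = 𝔒1 , 𝔒0 , 𝔒1 , 𝔒1

      via : (u : SL₂) → SL₂⟨𝔒⟩ u → ¬ 𝔪 (s (x ·ᴳ SL₂→GL₂ u)) → Factorization x
      via u 𝔒u ¬𝔪 = factorization-special x u 𝔒u
        (factorization-unit (x ·ᴳ SL₂→GL₂ u) (S₀-special x (SL₂→GL₂ u) (proj₂ u) 𝔒u Sx) ¬𝔪)

      by-case : Dec (𝔪 (s x)) → Dec (𝔪 (r x)) → Factorization x
      by-case (no ¬𝔪s) _ = factorization-unit x Sx ¬𝔪s
      by-case (yes 𝔪s) (no ¬𝔪r) = via rotate 𝔒rotate (λ m → ¬𝔪r (𝔪-resp
        (trans (-‿cong (s-special x (SL₂→GL₂ rotate) (proj₂ rotate))) (solve 3 (λ r s g →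
          :- (:0 :* :0 :* s :+ :0 :* :1 :* g :- :1 :* :1 :* r) := r) refl (r x) (s x) (p′ x - p x)))
        (𝔪-neg m)))
      -- If the form took values in 𝔪 at z₁, z₂ and z₁ + z₂, then p′ - p would lie in 𝔪, and with it
      -- the discriminant (p′ - p)² + 4 r s.
      by-case (yes 𝔪s) (yes 𝔪r) = via shear 𝔒shear (λ m → discriminant-unit (𝔪-resp
        (combine₂ (p x + p′ x + T) (- (1# + 1# + 1# + 1#)) (trace x) (determinant x)
          (solve 6 (λ p r s p′ T N →
          ((p′ :- p) :* (p′ :- p) :+ (:1 :+ :1 :+ :1 :+ :1) :* (r :* s))
            :- (T :* T :- (N :+ N :+ N :+ N))
          := (p :+ p′ :+ T) :* (p :+ p′ :- T) :+ (:- (:1 :+ :1 :+ :1 :+ :1))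
            :* (p :* p′ :- r :* s :- N)) refl (p x) (r x) (s x) (p′ x) T N))
        (𝔪-+ (𝔪-*ˡ (𝔪g m) (𝔪⇒𝔒 (𝔪g m))) (𝔪-*ʳ (𝔒-+ (𝔒-+ (𝔒-+ 𝔒1 𝔒1) 𝔒1) 𝔒1) (𝔪-*ˡ 𝔪r (𝔪⇒𝔒 𝔪s))))))
        where
        𝔪g : 𝔪 (s (x ·ᴳ SL₂→GL₂ shear)) → 𝔪 (p′ x - p x)
        𝔪g m = 𝔪-resp (trans (+-congʳ (+-congʳ (s-special x (SL₂→GL₂ shear) (proj₂ shear))))
          (solve 3 (λ r s g →
            ((:1 :* :1 :* s :+ :1 :* :1 :* g :- :1 :* :1 :* r) :- s) :+ r := g) refl (r x) (s x)
              (p′ x - p x)))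
          (𝔪-+ (𝔪-- m 𝔪s) 𝔪r)

-- The integral of f₀ and its test function property

module BaseCase (lem : ExcludedMiddle 0ℓ) (F : LocalField) (E : QuadraticAlgebra F)
                (τ : QuadraticAlgebra.Carrier E) (gen : QuadraticAlgebra.IsIntegralGenerator E τ)
                (unr : QuadraticAlgebra.Unramified E)
                (ε : LocalField.Fˣ F → Sign) (isNormCharacter : QuadraticAlgebra.IsNormCharacter E
                  ε)
                (M : Endoscopy.Measures lem F E τ) where
  open LocalField F hiding (zero)
  open IntegerCoefficients commRing
  open LinearCombination commRing
  open Valuation lem F
  open MatrixAlgebra F
  open Topology lem F
  open Counting lem
  open Basis lem F E τ gen
  open Arithmetic unr
  open Endoscopy lem F E τ renaming (T to Torus)
  open Lattices lem F E τ gen unr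
  open Factorizations lem F E τ gen unr ε isNormCharacter
  open Measures M
  private module E = QuadraticAlgebra E

  entryᵃ entryᶜ : Torus → Carrier
  entryᵃ t = m₁₁ (proj₁ (proj₁ t))
  entryᶜ t = m₂₁ (proj₁ (proj₁ t))

  torus : ∀ a c → norm a c ≈ 1# → Torus
  torus a c e = (multiplication a c , trans (det-multiplication a c) e) , pair a c ,
    unit-pair (λ z → 1≉0 (trans (sym e) z)) , multiplication-represents a c

  torus̃ : ∀ a c → ¬ (norm a c ≈ 0#) → T̃
  torus̃ a c n≉0 = (multiplication a c , λ z → n≉0 (trans (sym (det-multiplication a c)) z)) ,
    pair a c , unit-pair n≉0 , multiplication-represents a c

  abstract
    torus≈ : (t : Torus) → proj₁ (proj₁ t) ≈ᴹ multiplication (entryᵃ t) (entryᶜ t)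
    torus≈ t = torus-multiplication (proj₂ t)

    norm-torus : (t : Torus) → norm (entryᵃ t) (entryᶜ t) ≈ 1#
    norm-torus t = trans (sym (det-multiplication (entryᵃ t) (entryᶜ t)))
      (trans (det-cong (≈ᴹ-sym (torus≈ t))) (proj₂ (proj₁ t)))

    norm-conj : ∀ a c → norm (a + T * c) (- c) ≈ norm a c
    norm-conj a c = solve 4 (λ a c T N → :norm T N (a :+ T :* c) (:- c)
      := :norm T N a c) refl a c T N

    element≈ : (t : Torus) → pair (entryᵃ t) (entryᶜ t) E.≈ element t
    element≈ (_ , _ , _ , col₁ , _) = col₁

    element-norm : (t : Torus) → element t E.* E.conj (element t) E.≈ E.ι 1#
    element-norm t = E.trans (E.*-cong (E.sym (element≈ t)) (conj-cong (E.sym (element≈ t))))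
      (E.trans (pair-norm (entryᵃ t) (entryᶜ t)) (ι-cong (norm-torus t)))

    -- For norm one the conjugate is the inverse, and it is integral too.
    integral⇒T⟨𝔒⟩ : (t : Torus) → E.𝔒ᴱ (element t) → T⟨𝔒⟩ t
    integral⇒T⟨𝔒⟩ t o = (o , E.conj (element t) , 𝔒ᴱ-conj o , E.trans (element-norm t) ι-1) ,
      E.sym (element-norm t)

    entries⇒T⟨𝔒⟩ : (t : Torus) → 𝔒 (entryᵃ t) → 𝔒 (entryᶜ t) → T⟨𝔒⟩ t
    entries⇒T⟨𝔒⟩ t 𝔒a 𝔒c = integral⇒T⟨𝔒⟩ t (𝔒ᴱ-resp (element≈ t) (𝔒⇒𝔒ᴱ 𝔒a 𝔒c))

    T⟨𝔒⟩⇒entries : (t : Torus) → T⟨𝔒⟩ t → 𝔒 (entryᵃ t) × 𝔒 (entryᶜ t)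
    T⟨𝔒⟩⇒entries t ((o , _) , _) = 𝔒ᴱ⇒𝔒 (𝔒ᴱ-resp (E.sym (element≈ t)) o)

    T⟨𝔒⟩⇒integral : (t : Torus) → T⟨𝔒⟩ t → Integral (proj₁ (proj₁ t))
    T⟨𝔒⟩⇒integral t o = let (𝔒a , 𝔒c) = T⟨𝔒⟩⇒entries t o in integral-resp (≈ᴹ-sym (torus≈ t))
      (integral-multiplication 𝔒a 𝔒c)

  inverseᵀ : Torus → Torus
  inverseᵀ t = torus (entryᵃ t + T * entryᶜ t) (- entryᶜ t) (trans (norm-conj (entryᵃ t) (entryᶜ t))
    (norm-torus t))

  abstract
    multiplication-conj : ∀ {a c} → norm a c ≈ 1# → ∀ B →
      (multiplication (a + T * c) (- c) · (multiplication a c · B)) ≈ᴹ B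
    multiplication-conj {a} {c} e B = ≈ᴹ-trans (≈ᴹ-sym (·-assoc _ _ B))
      (≈ᴹ-trans (·-cong (multiplication-· _ _ a c) (≈ᴹ-refl {B}))
        (row (m₁₁ B) (m₂₁ B) , row (m₁₂ B) (m₂₂ B) , row′ (m₁₁ B) (m₂₁ B) , row′ (m₁₂ B) (m₂₂ B)))
      where
      row : ∀ x y → ((a + T * c) * a - N * (- c * c)) * x
        + (- (N * ((a + T * c) * c + - c * a + T * (- c * c)))) * y ≈ x
      row x y = combine₁ x e (solve 6 (λ a c T N x y →
        (((a :+ T :* c) :* a :- N :* ((:- c) :* c)) :* x
        :+ (:- (N :* ((a :+ T :* c) :* c :+ (:- c) :* a :+ T :* ((:- c) :* c)))) :* y) :- x
        := x :* (:norm T N a c :- :1)) refl a c T N x y)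
      row′ : ∀ x y → ((a + T * c) * c + - c * a + T * (- c * c)) * x
        + (((a + T * c) * a - N * (- c * c)) + T * ((a + T * c) * c + - c * a + T * (- c * c))) * y
        ≈ y
      row′ x y = combine₁ y e (solve 6 (λ a c T N x y →
        (((a :+ T :* c) :* c :+ (:- c) :* a :+ T :* ((:- c) :* c)) :* x
        :+ (((a :+ T :* c) :* a :- N :* ((:- c) :* c)) :+ T
        :* ((a :+ T :* c) :* c :+ (:- c) :* a :+ T :* ((:- c) :* c))) :* y) :- y
        := y :* (:norm T N a c :- :1)) refl a c T N x y)

    multiplication-comm : ∀ a b c d → (multiplication a b · multiplication c d) ≈ᴹ
      (multiplication c d · multiplication a b)
    multiplication-comm a b c d = ≈ᴹ-trans (multiplication-· a b c d) (≈ᴹ-trans (multiplication-cong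
      (solve 5 (λ a b c d N → a :* c :- N :* (b :* d) := c :* a :- N :* (d :* b)) refl a b c d N)
      (solve 5 (λ a b c d T → a :* d :+ b :* c :+ T :* (b :* d)
        := c :* b :+ d :* a :+ T :* (d :* b)) refl a b c d T)) (≈ᴹ-sym (multiplication-· c d a b)))

  module GLˢ = Subspace GL₂ proj₁
  module SLˢ = Subspace SL₂ proj₁
  module Tˢ = Subspace Torus (λ t → proj₁ (proj₁ t))

  T̃\GL₂-top : IsTopology T̃\GL₂
  T̃\GL₂-top = GLˢ.quotient-isTopology T̃ (λ t x → proj₁ t ·ᴳ x)

  T\SL₂-top : IsTopology T\SL₂
  T\SL₂-top = SLˢ.quotient-isTopology Torus (λ t x → proj₁ t ·ˢ x)

  module G = TestFunctions T̃\GL₂ T̃\GL₂-top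
  module T-test = TestFunctions T-space Tˢ.isTopology

  abstract
    translate-open : ∀ g {U} → Space.IsOpen T̃\GL₂ U → Space.IsOpen T̃\GL₂ (λ x → U (x ·ᴳ g))
    translate-open g@(B , _) {U} (open-U , stable-U) =
      GLˢ.map-continuous (_·ᴳ g) (row m₁₁-continuous m₁₂-continuous)
        (row m₁₁-continuous m₁₂-continuous)
        (row m₂₁-continuous m₂₂-continuous) (row m₂₁-continuous m₂₂-continuous) open-U ,
      λ γ x → mk⇔
        (λ u → GLˢ.open-resp open-U (≈ᴹ-sym (·-assoc (proj₁ (proj₁ γ)) (proj₁ x) B))
          (Equivalence.to (stable-U γ (x ·ᴳ g)) u))
        (λ u → Equivalence.from (stable-U γ (x ·ᴳ g))
          (GLˢ.open-resp open-U (·-assoc (proj₁ (proj₁ γ)) (proj₁ x) B) u))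
      where
      open GLˢ
      row : ∀ {f h b d} → Continuous f → Continuous h → Continuous (λ x → f x * b + h x * d)
      row {f} {h} {b} {d} cf ch = +-continuous (*-continuous cf (const-continuous b))
        (*-continuous ch (const-continuous d))

    isTest-translate : ∀ g {f} → G.IsTest f → G.IsTest (λ x → f (x ·ᴳ g))
    isTest-translate g = isTest-pullback T̃\GL₂-top T̃\GL₂-top (_·ᴳ g) (_·ᴳ inverseᴳ g)
      (translate-open g) (translate-open (inverseᴳ g))
      (λ (open-U , _) x → GLˢ.open-resp open-U (·-inverseʳ (proj₁ x) g))
      (λ (open-U , _) y → GLˢ.open-resp open-U (≈ᴹ-sym (·-inverseˡ (proj₁ y) g)))

    abs-close : ∀ {a b} → ∣ a - b ∣ ℚ.< ∣ a ∣ → ∣ b ∣ ≡ ∣ a ∣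
    abs-close {a} {b} close = ℚ.≤-antisym b≤a (ℚ.≮⇒≥ ¬b<a)
      where
      b≤a : ∣ b ∣ ℚ.≤ ∣ a ∣
      b≤a = ℚ.≤-trans (≡.subst (ℚ._≤ ∣ a ∣ ℚ.⊔ ∣ - (a - b) ∣)
        (∣∣-cong (solve 2 (λ a b → a :+ (:- (a :- b)) := b) refl a b))
        (∣∣-ultrametric a (- (a - b))))
        (ℚ.⊔-lub ℚ.≤-refl (≡.subst (ℚ._≤ ∣ a ∣) (≡.sym (∣-x∣ (a - b))) (ℚ.<⇒≤ close)))
      ¬b<a : ¬ (∣ b ∣ ℚ.< ∣ a ∣)
      ¬b<a lt = ℚ.<-irrefl ≡.refl
        (≡.subst (ℚ._< ∣ a ∣) (∣∣-cong (solve 2 (λ a b → b :+ (a :- b) := a) refl a b))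
        (∣x+y∣< b (a - b) lt close))

    abs-perturb : ∀ {a b d} → ∣ a - b ∣ ℚ.< d → ∣ a ∣ ℚ.≤ d → ∣ b ∣ ℚ.≤ d
    abs-perturb {a} {b} {d} close a≤d = ℚ.≤-trans
      (≡.subst (ℚ._≤ ∣ a ∣ ℚ.⊔ ∣ - (a - b) ∣)
        (∣∣-cong (solve 2 (λ a b → a :+ (:- (a :- b)) := b) refl a b))
        (∣∣-ultrametric a (- (a - b))))
      (ℚ.⊔-lub a≤d (≡.subst (ℚ._≤ d) (≡.sym (∣-x∣ (a - b))) (ℚ.<⇒≤ close)))

    k-abs : ∀ x n → (𝔒 (k x * n) → ∣ n ∣ ℚ.≤ ∣ det (proj₁ x) ∣) × (∣ n ∣ ℚ.≤ ∣ det (proj₁ x) ∣ →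
      𝔒 (k x * n))
    k-abs x n =
      (λ o → ≡.subst₂ ℚ._≤_ (≡.trans (≡.sym (∣∣-mult D (k x * n))) (∣∣-cong undo))
        (ℚ.*-identityʳ ∣ D ∣)
        (ℚ.*-monoˡ-≤-nonNeg ∣ D ∣ {{ℚ.nonNegative (∣∣-nonneg D)}} o)) ,
      (λ le → ≡.subst₂ ℚ._≤_ (≡.sym (∣∣-mult (k x) n))
        (≡.trans (≡.sym (∣∣-mult (k x) D)) (≡.trans (∣∣-cong (k-det x)) ∣1∣))
        (ℚ.*-monoˡ-≤-nonNeg ∣ k x ∣ {{ℚ.nonNegative (∣∣-nonneg (k x))}} le))
      where
      D : Carrier
      D = det (proj₁ x)
      undo : D * (k x * n) ≈ n
      undo = combine₁ n (k-det x) (solve 3 (λ D k n → D :* (k :* n) :- n := n :* (k :* D :- :1))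
        refl D (k x) n)

    S₀-abs : ∀ x → (S 0 x → (∣ column₁ (proj₁ x) ∣ ℚ.≤ ∣ det (proj₁ x) ∣) ×
      (∣ column₂ (proj₁ x) ∣ ℚ.≤ ∣ det (proj₁ x) ∣)) ×
      ((∣ column₁ (proj₁ x) ∣ ℚ.≤ ∣ det (proj₁ x) ∣) ×
        (∣ column₂ (proj₁ x) ∣ ℚ.≤ ∣ det (proj₁ x) ∣) → S 0 x)
    S₀-abs x =
      (λ Sx → let (𝔒r , 𝔒s , _) = S₀-integral x Sx in
        proj₁ (k-abs x _) 𝔒s , proj₁ (k-abs x _) (𝔒-resp (solve 1 (λ y → :- (:- y) := y) refl _)
          (𝔒-neg 𝔒r))) ,
      (λ (c₁ , c₂) → S₀-intro x (𝔒-neg (proj₂ (k-abs x _) c₂)) (proj₂ (k-abs x _) c₁))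

    -- By `S₀-abs` the condition compares ∣N(column)∣ with ∣det x∣. These are polynomial in the
    -- entries, and a change of all three by less than ∣det x∣ leaves the comparison as it was.
    S₀-locally-constant : ∀ x → ∃ λ δ → (0ℚ ℚ.< δ) × (∀ y → Close δ (proj₁ x) (proj₁ y) →
      (S 0 x → S 0 y) × (S 0 y → S 0 x))
    S₀-locally-constant x =
      let (δ₁ , pos₁ , u₁) = det-continuous x ∣ det (proj₁ x) ∣ (∣x∣>0 (proj₂ x))
          (δ₂ , pos₂ , u₂) = norm-continuous m₁₁-continuous m₂₁-continuous x ∣ det (proj₁ x) ∣
            (∣x∣>0 (proj₂ x))
          (δ₃ , pos₃ , u₃) = norm-continuous m₁₂-continuous m₂₂-continuous x ∣ det (proj₁ x) ∣
            (∣x∣>0 (proj₂ x))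
      in δ₁ ℚ.⊓ (δ₂ ℚ.⊓ δ₃) , ⊓-positive pos₁ (⊓-positive pos₂ pos₃) , λ y close → compare y
        (u₁ y (close-mono (ℚ.p⊓q≤p δ₁ (δ₂ ℚ.⊓ δ₃)) close))
        (u₂ y (close-mono (ℚ.≤-trans (ℚ.p⊓q≤q δ₁ (δ₂ ℚ.⊓ δ₃)) (ℚ.p⊓q≤p δ₂ δ₃)) close))
        (u₃ y (close-mono (ℚ.≤-trans (ℚ.p⊓q≤q δ₁ (δ₂ ℚ.⊓ δ₃)) (ℚ.p⊓q≤q δ₂ δ₃)) close))
      where
      open GLˢ
      det-continuous : Continuous (det ∘ proj₁)
      det-continuous = +-continuous (*-continuous m₁₁-continuous m₂₂-continuous)
        (neg-continuous (*-continuous m₁₂-continuous m₂₁-continuous))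
      norm-continuous : ∀ {f g} → Continuous f → Continuous g → Continuous (λ x → norm (f x) (g x))
      norm-continuous cf cg = +-continuous
        (+-continuous (*-continuous cf cf) (*-continuous (const-continuous T) (*-continuous cf cg)))
        (*-continuous (const-continuous N) (*-continuous cg cg))
      flip : ∀ a b {d} → ∣ a - b ∣ ℚ.< d → ∣ b - a ∣ ℚ.< d
      flip a b {d} = ≡.subst (ℚ._< d)
        (≡.trans (≡.sym (∣-x∣ (a - b)))
        (∣∣-cong (solve 2 (λ a b → :- (a :- b) := b :- a) refl a b)))
      compare : ∀ y → ∣ det (proj₁ x) - det (proj₁ y) ∣ ℚ.< ∣ det (proj₁ x) ∣ →
        ∣ column₁ (proj₁ x) - column₁ (proj₁ y) ∣ ℚ.< ∣ det (proj₁ x) ∣ →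
          ∣ column₂ (proj₁ x) - column₂ (proj₁ y) ∣ ℚ.< ∣ det (proj₁ x) ∣ →
        (S 0 x → S 0 y) × (S 0 y → S 0 x)
      compare y cd c₁ c₂ =
        (λ Sx → let (a , b) = proj₁ (S₀-abs x) Sx in proj₂ (S₀-abs y) (
          ≡.subst (∣ column₁ (proj₁ y) ∣ ℚ.≤_) (≡.sym same) (abs-perturb c₁ a) ,
            ≡.subst (∣ column₂ (proj₁ y) ∣ ℚ.≤_) (≡.sym same) (abs-perturb c₂ b))) ,
        (λ Sy → let (a , b) = proj₁ (S₀-abs y) Sy in proj₂ (S₀-abs x) (
          abs-perturb (flip _ _ c₁) (≡.subst (∣ column₁ (proj₁ y) ∣ ℚ.≤_) same a) ,
            abs-perturb (flip _ _ c₂) (≡.subst (∣ column₂ (proj₁ y) ∣ ℚ.≤_) same b)))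
        where
        same : ∣ det (proj₁ y) ∣ ≡ ∣ det (proj₁ x) ∣
        same = abs-close cd

    S₀-torus : ∀ (γ : T̃) x → (S 0 x → S 0 (proj₁ γ ·ᴳ x)) × (S 0 (proj₁ γ ·ᴳ x) → S 0 x)
    S₀-torus γ x = let (er , es) = rs-torus (proj₁ γ) x (proj₂ γ) in S-resp 0 (er , es) ,
      S-resp 0 (sym er , sym es)

    ⟦⟧≢0 : ∀ {P} → ⟦ P ⟧ ≢ 0ℚ → P
    ⟦⟧≢0 {P} ≢0 = stable (λ ¬p → ≢0 (⟦⟧-false ¬p))

    ⟦⟧≢0-intro : ∀ {P} → P → ⟦ P ⟧ ≢ 0ℚ
    ⟦⟧≢0-intro p e with () ← ≡.trans (≡.sym (⟦⟧-true p)) e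

  -- The sign ε(det x) is left out, being + wherever `S 0 x` holds; `f-zero` restores it.
  f₀ : GL₂ → ℚ
  f₀ x = ⟦ S 0 x ⟧

  -- `HasIntegral` includes compactness of the support, so the volume hypothesis supplies
  -- compactness of K.
  K-compact : Compact SL₂-space (λ x → indicator lem SL₂⟨𝔒⟩ x ≢ 0ℚ)
  K-compact = proj₁ (proj₂ vol-SL₂)

  abstract
    isTest-f₀ : G.IsTest f₀
    isTest-f₀ = locally , compact
      where
      locally : LocallyConstant T̃\GL₂ f₀
      locally x = U , (open-U , stable-U) , ((λ z → z) , (λ z → z)) ,
        λ y (to , from) → ⟦⟧-cong from to
        where
        U : Pred GL₂ 0ℓ
        U y = (S 0 x → S 0 y) × (S 0 y → S 0 x)
        open-U : Space.IsOpen GL₂-space U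
        open-U y (to , from) = let (δ , pos , u) = S₀-locally-constant y in δ , pos , λ z close →
          (λ Sx → proj₁ (u z close) (to Sx)) , (λ Sz → from (proj₂ (u z close) Sz))
        stable-U : ∀ (γ : T̃) y → U y ⇔ U (proj₁ γ ·ᴳ y)
        stable-U γ y = let (there′ , back) = S₀-torus γ y in mk⇔
          (λ (to , from) → (λ Sx → there′ (to Sx)) , (λ Sz → from (back Sz)))
          (λ (to , from) → (λ Sx → back (to Sx)) , (λ Sz → from (there′ Sz)))
      compact : Compact T̃\GL₂ (λ x → f₀ x ≢ 0ℚ)
      -- The support is T̃ K. A finite cover of K suffices because the open sets of the quotient are
      -- stable under T̃.
      compact I U opens covers =
        let (is , covered) = K-compact I (λ i κ → U i (SL₂→GL₂ κ))
              (λ i κ u → proj₁ (opens i) (SL₂→GL₂ κ) u .proj₁ ,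
                proj₁ (proj₂ (proj₁ (opens i) (SL₂→GL₂ κ) u)) ,
                λ y close → proj₂ (proj₂ (proj₁ (opens i) (SL₂→GL₂ κ) u)) (SL₂→GL₂ y) close)
              (λ κ κ∈K → covers (SL₂→GL₂ κ) (⟦⟧≢0-intro (S₀-SL₂ κ (⟦⟧≢0 κ∈K))))
        in is , λ x ≢0 → move is covered x (factorization x (⟦⟧≢0 ≢0))
        where
        move : ∀ is → (∀ κ → indicator lem SL₂⟨𝔒⟩ κ ≢ 0ℚ → Any (λ i → U i (SL₂→GL₂ κ)) is) → ∀ x →
          Factorization x → Any (λ i → U i x) is
        move is covered x (a , c , κ , n≈ , 𝔒κ , x≈) = Any.map (λ {i} u →
            GLˢ.open-resp (proj₁ (opens i)) (≈ᴹ-sym x≈)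
              (Equivalence.to (proj₂ (opens i) (torus̃ a c n≉0) (SL₂→GL₂ κ)) u))
          (covered κ (⟦⟧≢0-intro 𝔒κ))
          where n≉0 : ¬ (norm a c ≈ 0#)
                n≉0 z = proj₂ x (trans (sym n≈) z)

  ψ₀ : SL₂ → ℚ
  ψ₀ x = f₀ (SL₂→GL₂ x)

  module S-test = TestFunctions T\SL₂ T\SL₂-top

  toT̃ : Torus → T̃
  toT̃ (t , γ) = SL₂→GL₂ t , γ

  abstract
    isTest-ψ₀ : S-test.IsTest ψ₀
    isTest-ψ₀ = locally , compact
      where
      locally : LocallyConstant T\SL₂ ψ₀
      locally x = let (U , (open-U , stable-U) , Ux , const) = proj₁ isTest-f₀ (SL₂→GL₂ x) in
        (λ y → U (SL₂→GL₂ y)) ,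
        ((λ y u → let (δ , pos , v) = open-U (SL₂→GL₂ y) u in δ , pos ,
          λ z close → v (SL₂→GL₂ z) close) ,
         λ γ y → mk⇔ (λ u → GLˢ.open-resp open-U ≈ᴹ-refl
           (Equivalence.to (stable-U (toT̃ γ) (SL₂→GL₂ y)) u))
                     (λ u → Equivalence.from (stable-U (toT̃ γ) (SL₂→GL₂ y))
                       (GLˢ.open-resp open-U ≈ᴹ-refl u))) ,
        Ux , λ y u → const (SL₂→GL₂ y) u
      compact : Compact T\SL₂ (λ x → ψ₀ x ≢ 0ℚ)
      compact I U opens covers =
        let (is , covered) = K-compact I U (λ i → proj₁ (opens i))
              (λ κ κ∈K → covers κ (⟦⟧≢0-intro (S₀-SL₂ κ (⟦⟧≢0 κ∈K))))
        in is , λ x ≢0 → move is covered x (factorization (SL₂→GL₂ x) (⟦⟧≢0 ≢0))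
        where
        move : ∀ is → (∀ κ → indicator lem SL₂⟨𝔒⟩ κ ≢ 0ℚ → Any (λ i → U i κ) is) → ∀ x →
          Factorization (SL₂→GL₂ x) → Any (λ i → U i x) is
        move is covered x (a , c , κ , n≈ , 𝔒κ , x≈) = Any.map (λ {i} u →
            SLˢ.open-resp (proj₁ (opens i)) (≈ᴹ-sym x≈)
              (Equivalence.to (proj₂ (opens i) (torus a c (trans n≈ (proj₂ x))) κ) u))
          (covered κ (⟦⟧≢0-intro 𝔒κ))

  fibre : SL₂ → Torus → ℚ
  fibre x t = indicator lem SL₂⟨𝔒⟩ (proj₁ t ·ˢ x)

  abstract
    -- If x = t₀ κ with κ in K, then t x lies in K exactly when t₀ t lies in T(𝔒), so the fibre is a
    -- translate of a set of volume 1. Without such a factorization the fibre is empty.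
    torus-orbit : ∀ x → HasIntegral T-space μ-T (fibre x) (ψ₀ x)
    torus-orbit x = by-case (decide (S 0 (SL₂→GL₂ x)))
      where
      outside : ¬ S 0 (SL₂→GL₂ x) → ∀ t → 0ℚ ≡ fibre x t
      outside ¬S t = ≡.sym (⟦⟧-false λ o → ¬S (proj₂ (S₀-torus (toT̃ t) (SL₂→GL₂ x))
        (S-resp 0 (rs-cong (SL₂→GL₂ (proj₁ t ·ˢ x)) (proj₁ (toT̃ t) ·ᴳ SL₂→GL₂ x) ≈ᴹ-refl)
          (S₀-SL₂ (proj₁ t ·ˢ x) o))))

      module _ (a c : Carrier) (κ : SL₂) (n≈1 : norm a c ≈ 1#) (𝔒κ : SL₂⟨𝔒⟩ κ)
        (x≈ : proj₁ x ≈ᴹ (multiplication a c · proj₁ κ)) where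
        t₀ : Torus
        t₀ = torus a c n≈1

        -- Commutativity of the torus moves t₀ to the left of t, where left invariance of the Haar
        -- measure applies.
        swap : ∀ t → (proj₁ (proj₁ t) · multiplication a c) ≈ᴹ
          (multiplication a c · proj₁ (proj₁ t))
        swap t = ≈ᴹ-trans (·-cong (torus≈ t) (≈ᴹ-refl {multiplication a c}))
          (≈ᴹ-trans (multiplication-comm (entryᵃ t) (entryᶜ t) a c)
            (·-cong (≈ᴹ-refl {multiplication a c}) (≈ᴹ-sym (torus≈ t))))

        t·x : ∀ t → (proj₁ (proj₁ t) · proj₁ x) ≈ᴹ
          ((multiplication a c · proj₁ (proj₁ t)) · proj₁ κ)
        t·x t = ≈ᴹ-trans (·-cong (≈ᴹ-refl {proj₁ (proj₁ t)}) x≈)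
          (≈ᴹ-trans (≈ᴹ-sym (·-assoc (proj₁ (proj₁ t)) (multiplication a c) (proj₁ κ)))
          (·-cong (swap t) (≈ᴹ-refl {proj₁ κ})))

        fibre≡ : ∀ t → indicator lem T⟨𝔒⟩ (t₀ ·ᵀ t) ≡ fibre x t
        fibre≡ t = ⟦⟧-cong
          (λ o → integral-resp (≈ᴹ-sym (t·x t)) (integral-· (T⟨𝔒⟩⇒integral (t₀ ·ᵀ t) o) 𝔒κ))
          (λ o → let (v , 𝔒v , undo) = adjugate κ 𝔒κ
                     (𝔒₁₁ , _ , 𝔒₂₁ , _) = integral-resp
                       (undo (multiplication a c · proj₁ (proj₁ t)))
                       (integral-· (integral-resp (t·x t) o) 𝔒v)
                 in entries⇒T⟨𝔒⟩ (t₀ ·ᵀ t) 𝔒₁₁ 𝔒₂₁)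

        left-open : ∀ t {U} → Space.IsOpen T-space U → Space.IsOpen T-space (λ t′ → U (t ·ᵀ t′))
        left-open t = Tˢ.map-continuous (t ·ᵀ_) (row m₁₁-continuous m₂₁-continuous)
          (row m₁₂-continuous m₂₂-continuous)
            (row m₁₁-continuous m₂₁-continuous) (row m₁₂-continuous m₂₂-continuous)
          where
          open Tˢ
          row : ∀ {f h b d} → Continuous f → Continuous h → Continuous (λ t′ → b * f t′ + d * h t′)
          row {f} {h} {b} {d} cf ch = +-continuous (*-continuous (const-continuous b) cf)
            (*-continuous (const-continuous d) ch)

        isTest-fibre : T-test.IsTest (fibre x)
        isTest-fibre = T-test.isTest-cong fibre≡ (isTest-pullback Tˢ.isTopology Tˢ.isTopology
          (t₀ ·ᵀ_) (inverseᵀ t₀ ·ᵀ_)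
          (left-open t₀) (left-open (inverseᵀ t₀))
          (λ open-U t → Tˢ.open-resp open-U (multiplication-conj n≈1 (proj₁ (proj₁ t))))
          (λ open-U t → Tˢ.open-resp open-U (≈ᴹ-sym (≈ᴹ-trans
            (·-cong (multiplication-cong (solve 3 (λ a c T → a := (a :+ T :* c) :+ T :* (:- c)) refl
              a c T) (solve 1 (λ c → c := :- (:- c)) refl c)) ≈ᴹ-refl)
            (multiplication-conj (trans (norm-conj a c) n≈1) (proj₁ (proj₁ t))))))
          (proj₁ vol-T , proj₁ (proj₂ vol-T)))

        inside : S 0 (SL₂→GL₂ x) → HasIntegral T-space μ-T (fibre x) (ψ₀ x)
        inside Sx = proj₁ isTest-fibre , proj₂ isTest-fibre , ≡.trans
          (haar-T t₀ (test (indicator lem T⟨𝔒⟩) (proj₁ vol-T) (proj₁ (proj₂ vol-T)))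
            (T-test.toTest isTest-fibre) (λ t → ≡.sym (fibre≡ t)))
          (≡.trans (proj₂ (proj₂ vol-T)) (≡.sym (⟦⟧-true Sx)))

      by-case : Dec (S 0 (SL₂→GL₂ x)) → HasIntegral T-space μ-T (fibre x) (ψ₀ x)
      by-case (no ¬S) = proj₁ zero-test , proj₂ zero-test ,
        ≡.trans (T-test.Integration.∫-zero μ-T (T-test.toTest zero-test)
          (λ t → ≡.sym (outside ¬S t))) (≡.sym (⟦⟧-false ¬S))
        where zero-test : T-test.IsTest (fibre x)
              zero-test = T-test.isTest-cong (outside ¬S) T-test.isTest-zero
      by-case (yes Sx) = let (a , c , κ , n≈ , 𝔒κ , x≈) = factorization (SL₂→GL₂ x) Sx in inside a c
        κ (trans n≈ (proj₂ x)) 𝔒κ x≈ Sx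

    -- f₀ vanishes off T̃ · SL₂, so it is the extension by zero of ψ₀. By `torus-orbit`, ψ₀
    -- integrates the indicator of K over the fibres of the quotient, and what remains is the volume
    -- of K.
    ∫-f₀ : Measure.∫ μ-T̃\GL₂ (G.toTest isTest-f₀) ≡ 1ℚ
    ∫-f₀ = ≡.trans (extends (S-test.toTest isTest-ψ₀) (G.toTest isTest-f₀) (λ _ → ≡.refl)
        (λ y outside → ⟦⟧-false (λ Sy → outside (coset y (factorization y Sy)))))
      (≡.trans (quotient-measure (test (indicator lem SL₂⟨𝔒⟩) (proj₁ vol-SL₂)
        (proj₁ (proj₂ vol-SL₂))) (S-test.toTest isTest-ψ₀) torus-orbit)
        (proj₂ (proj₂ vol-SL₂)))
      where
      coset : ∀ y → Factorization y → ∃₂ λ (t : T̃) x → proj₁ y ≈ᴹ proj₁ (proj₁ t ·ᴳ SL₂→GL₂ x)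
      coset y (a , c , κ , n≈ , _ , y≈) = torus̃ a c (λ z → proj₂ y (trans (sym n≈) z)) , κ , y≈

-- The Hecke recursion for fₙ and its integral

module Recursion (lem : ExcludedMiddle 0ℓ) (F : LocalField) (E : QuadraticAlgebra F)
                (τ : QuadraticAlgebra.Carrier E) (gen : QuadraticAlgebra.IsIntegralGenerator E τ)
                (unr : QuadraticAlgebra.Unramified E)
                (ε : LocalField.Fˣ F → Sign) (isNormCharacter : QuadraticAlgebra.IsNormCharacter E
                  ε)
                (M : Endoscopy.Measures lem F E τ) where
  open LocalField F hiding (zero)
  open Valuation lem F
  open Counting lem
  open Basis lem F E τ gen
  open Arithmetic unr
  open Character ε isNormCharacter
  open Endoscopy lem F E τ renaming (T to Torus)
  open Lattices lem F E τ gen unr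
  open Factorizations lem F E τ gen unr ε isNormCharacter
  open BaseCase lem F E τ gen unr ε isNormCharacter M
  open Measures M
  open Rational using (fromℕ; _^_)
  private
    module E = QuadraticAlgebra E
    module Nb = Neighbours lem F T N 𝔒T 𝔒N
    module Q = IntegerCoefficients ℚ.+-*-commutativeRing
    module QL = LinearCombination ℚ.+-*-commutativeRing

  sgn : GL₂ → ℚ
  sgn x = signℚ (ε (detᴳ x))

  κℚ qℚ : ℚ
  κℚ = signℚ κ
  qℚ = fromℕ q

  f : ℕ → GL₂ → ℚ
  f n x = sgn x ℚ.* ⟦ S n x ⟧

  signℚ-* : ∀ a b → signℚ (a Sign.* b) ≡ signℚ a ℚ.* signℚ b
  signℚ-* Sign.+ Sign.+ = ≡.refl
  signℚ-* Sign.+ Sign.- = ≡.refl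
  signℚ-* Sign.- Sign.+ = ≡.refl
  signℚ-* Sign.- Sign.- = ≡.refl

  signℚ² : ∀ a → signℚ a ℚ.* signℚ a ≡ 1ℚ
  signℚ² Sign.+ = ≡.refl
  signℚ² Sign.- = ≡.refl

  neighbours : GL₂ → ℕ → ℚ
  neighbours x = Nb.neighbours (p x) (r x) (s x) (p′ x) (trace x) (determinant x)

  hecke : (GL₂ → ℚ) → GL₂ → ℚ
  hecke g x = ∑ q (λ i → g (x ·ᴳ finiteStep i)) ℚ.+ g (x ·ᴳ infiniteStep)

  abstract
    sgn-step : ∀ x h → det (proj₁ h) ≈ ϖ → sgn (x ·ᴳ h) ≡ sgn x ℚ.* κℚ
    sgn-step x h e = ≡.trans (≡.cong signℚ
      (≡.trans (N.cong (detᴳ (x ·ᴳ h)) (detᴳ x *ˣ ϖˣ) (det-step x h e)) (N.homo (detᴳ x) ϖˣ)))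
      (signℚ-* (ε (detᴳ x)) κ)
      where module N = E.IsNormCharacter isNormCharacter

    -- Where `S 0 x` holds, the factorization exhibits det x as a norm.
    f-zero : ∀ x → f₀ x ≡ f 0 x
    f-zero x = by-case (decide (S 0 x))
      where
      by-case : Dec (S 0 x) → f₀ x ≡ f 0 x
      by-case (no ¬S) = ≡.trans (⟦⟧-false ¬S)
        (≡.sym (≡.trans (≡.cong (sgn x ℚ.*_) (⟦⟧-false ¬S)) (ℚ.*-zeroʳ (sgn x))))
      by-case (yes Sx) = ≡.sym (≡.trans
        (≡.cong (λ s → signℚ s ℚ.* ⟦ S 0 x ⟧) (ε-norm (detᴳ x) (is-norm (factorization x Sx))))
        (ℚ.*-identityˡ ⟦ S 0 x ⟧))
        where is-norm : Factorization x → IsNorm (det (proj₁ x))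
              is-norm (a , c , _ , e , _) = a , c , e

    -- Every step has determinant ϖ, so all signs change by the same κ and factor out of the sum.
    hecke-f : ∀ n x → hecke (f n) x ≡ (sgn x ℚ.* κℚ) ℚ.* neighbours x n
    hecke-f n x = ≡.trans (≡.cong₂ ℚ._+_
        (≡.trans (∑-cong q (λ i → ≡.cong₂ ℚ._*_ (sgn-step x (finiteStep i) (det-finiteStep i))
            (⟦⟧-cong (proj₁ (At.finiteStep-S x n i)) (proj₂ (At.finiteStep-S x n i)))))
          (∑-*ˡ q (sgn x ℚ.* κℚ) (λ i → ⟦ At.FiniteNeighbour x n i ⟧)))
        (≡.cong₂ ℚ._*_ (sgn-step x infiniteStep det-infiniteStep)
          (⟦⟧-cong (proj₁ (At.infiniteStep-S x n)) (proj₂ (At.infiniteStep-S x n)))))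
      (≡.sym (ℚ.*-distribˡ-+ (sgn x ℚ.* κℚ) (∑ q (λ i → ⟦ At.FiniteNeighbour x n i ⟧)) ⟦
        At.InfiniteNeighbour x n ⟧))

    f-one : ∀ x → κℚ ℚ.* hecke (f 0) x ℚ.+ (ℚ.- κℚ) ℚ.* f 0 x ≡ f 1 x
    f-one x = ≡.trans (≡.cong (λ h → κℚ ℚ.* h ℚ.+ (ℚ.- κℚ) ℚ.* f 0 x) (≡.trans (hecke-f 0 x)
        (≡.cong ((sgn x ℚ.* κℚ) ℚ.*_) (Nb.neighbours-zero (p x) (r x) (s x) (p′ x) (trace x)
          (determinant x) splitting))))
      (identity (sgn x) κℚ ⟦ S 1 x ⟧ ⟦ S 0 x ⟧ (signℚ² κ))
      where
      identity : ∀ g k a b → k ℚ.* k ≡ 1ℚ → k ℚ.* ((g ℚ.* k) ℚ.* (a ℚ.+ k ℚ.* b)) ℚ.+ (ℚ.- k) ℚ.*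
        (g ℚ.* b) ≡ g ℚ.* a
      identity g k a b e = QL.combine₁ (g ℚ.* (a ℚ.+ k ℚ.* b)) e (Q.solve 4 (λ g k a b →
        (k Q.:* ((g Q.:* k) Q.:* (a Q.:+ k Q.:* b)) Q.:+ (Q.:- k) Q.:* (g Q.:* b)) Q.:- g Q.:* a
        Q.:= (g Q.:* (a Q.:+ k Q.:* b)) Q.:* (k Q.:* k Q.:- Q.:1)) ≡.refl g k a b)

    f-suc : ∀ n x → κℚ ℚ.* hecke (f (suc n)) x ℚ.+ (ℚ.- qℚ) ℚ.* f n x ≡ f (suc (suc n)) x
    f-suc n x = ≡.trans (≡.cong (λ h → κℚ ℚ.* h ℚ.+ (ℚ.- qℚ) ℚ.* f n x) (≡.trans (hecke-f (suc n) x)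
        (≡.cong ((sgn x ℚ.* κℚ) ℚ.*_) (Nb.neighbours-suc (p x) (r x) (s x) (p′ x) (trace x)
          (determinant x) n))))
      (identity (sgn x) κℚ qℚ ⟦ S n x ⟧ ⟦ S (suc (suc n)) x ⟧ (signℚ² κ))
      where
      identity : ∀ g k q a b → k ℚ.* k ≡ 1ℚ → k ℚ.* ((g ℚ.* k) ℚ.* (q ℚ.* a ℚ.+ b)) ℚ.+ (ℚ.- q) ℚ.*
        (g ℚ.* a) ≡ g ℚ.* b
      identity g k q a b e = QL.combine₁ (g ℚ.* (q ℚ.* a ℚ.+ b)) e (Q.solve 5 (λ g k q a b →
        (k Q.:* ((g Q.:* k) Q.:* (q Q.:* a Q.:+ b)) Q.:+ (Q.:- q) Q.:* (g Q.:* a)) Q.:- g Q.:* b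
        Q.:= (g Q.:* (q Q.:* a Q.:+ b)) Q.:* (k Q.:* k Q.:- Q.:1)) ≡.refl g k q a b)

    isTest-hecke : ∀ {g} → G.IsTest g → G.IsTest (hecke g)
    isTest-hecke t = G.isTest-+
      (isTest-∑ lem T̃\GL₂ T̃\GL₂-top q (λ i → isTest-translate (finiteStep i) t))
      (isTest-translate infiniteStep t)

    -- Two consecutive functions are carried along because the recursion has order two. Solving it
    -- for its last term presents fₙ₊₂ as a combination of translates.
    isTest-f : ∀ n → G.IsTest (f n) × G.IsTest (f (suc n))
    isTest-f zero = f0 , G.isTest-cong f-one (G.isTest-+ (G.isTest-* κℚ (isTest-hecke f0))
      (G.isTest-* (ℚ.- κℚ) f0))
      where f0 : G.IsTest (f 0)
            f0 = G.isTest-cong f-zero isTest-f₀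
    isTest-f (suc n) = let (t , t′) = isTest-f n in
      t′ , G.isTest-cong (f-suc n) (G.isTest-+ (G.isTest-* κℚ (isTest-hecke t′))
        (G.isTest-* (ℚ.- qℚ) t))

  open Measure μ-T̃\GL₂ using (∫; additive; homogeneous)
  open G.Integration μ-T̃\GL₂
  open TestFunction

  abstract
    ∫-hecke : ∀ {g} (t : G.IsTest g) → ∫ (G.toTest (isTest-hecke t)) ≡ qℚ ℚ.* ∫ (G.toTest t) ℚ.+ ∫
      (G.toTest t)
    ∫-hecke {g} t = ≡.trans
      (additive (G.toTest (isTest-∑ lem T̃\GL₂ T̃\GL₂-top q translated))
        (G.toTest (isTest-translate infiniteStep t)) (G.toTest (isTest-hecke t)) (λ _ → ≡.refl))
      (≡.cong₂ ℚ._+_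
        (≡.trans (∫-∑ lem T̃\GL₂ T̃\GL₂-top μ-T̃\GL₂ q translated)
          (≡.trans (∑-cong q (λ i → right-invariant (finiteStep i) (G.toTest t)
            (G.toTest (translated i)) (λ _ → ≡.refl))) (∑-const q (∫ (G.toTest t)))))
        (right-invariant infiniteStep (G.toTest t) (G.toTest (isTest-translate infiniteStep t))
          (λ _ → ≡.refl)))
      where
      translated : ∀ i → G.IsTest (λ x → g (x ·ᴳ finiteStep i))
      translated i = isTest-translate (finiteStep i) t

    ∫-combination : ∀ a b φ ψ χ → (∀ x → a ℚ.* fun φ x ℚ.+ b ℚ.* fun ψ x ≡ fun χ x) → ∫ χ ≡
      a ℚ.* ∫ φ ℚ.+ b ℚ.* ∫ ψ
    ∫-combination a b φ ψ χ e = ≡.trans (additive aφ bψ χ (λ x → ≡.sym (e x)))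
      (≡.cong₂ ℚ._+_ (homogeneous a φ aφ (λ _ → ≡.refl)) (homogeneous b ψ bψ (λ _ → ≡.refl)))
      where
      aφ bψ : TestFunction T̃\GL₂
      aφ = G.toTest (G.isTest-* a (locally φ , support φ))
      bψ = G.toTest (G.isTest-* b (locally ψ , support ψ))

    -- Quantified over all proofs t, so that the value applies to any way of seeing fₙ as a test
    -- function.
    ∫-f : ∀ n → (∀ (t : G.IsTest (f n)) → ∫ (G.toTest t) ≡ (κℚ ℚ.* qℚ) ^ n) ×
      (∀ (t : G.IsTest (f (suc n))) → ∫ (G.toTest t) ≡ (κℚ ℚ.* qℚ) ^ suc n)
    ∫-f zero = base , λ t → ≡.trans (∫-combination κℚ (ℚ.- κℚ) (G.toTest (isTest-hecke t₀))
      (G.toTest t₀) (G.toTest t) f-one)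
        (≡.trans (≡.cong₂ (λ u v → κℚ ℚ.* u ℚ.+ (ℚ.- κℚ) ℚ.* v)
          (≡.trans (∫-hecke t₀) (≡.cong (λ u → qℚ ℚ.* u ℚ.+ u) (base t₀))) (base t₀))
          (identity κℚ qℚ))
      where
      t₀ : G.IsTest (f 0)
      t₀ = proj₁ (isTest-f 0)
      base : (t : G.IsTest (f 0)) → ∫ (G.toTest t) ≡ 1ℚ
      base t = ≡.trans (∫-cong (G.toTest t) (G.toTest isTest-f₀) (λ x → ≡.sym (f-zero x))) ∫-f₀
      identity : ∀ k q → k ℚ.* (q ℚ.* 1ℚ ℚ.+ 1ℚ) ℚ.+ (ℚ.- k) ℚ.* 1ℚ ≡ (k ℚ.* q) ℚ.* 1ℚ
      identity = Q.solve 2 (λ k q → k Q.:* (q Q.:* Q.:1 Q.:+ Q.:1) Q.:+ (Q.:- k) Q.:* Q.:1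
        Q.:= (k Q.:* q) Q.:* Q.:1) ≡.refl
    ∫-f (suc n) = proj₂ (∫-f n) ,
      λ t → ≡.trans (∫-combination κℚ (ℚ.- qℚ) (G.toTest (isTest-hecke t₁)) (G.toTest t₀)
      (G.toTest t) (f-suc n))
        (≡.trans (≡.cong₂ (λ u v → κℚ ℚ.* u ℚ.+ (ℚ.- qℚ) ℚ.* v)
          (≡.trans (∫-hecke t₁) (≡.cong (λ u → qℚ ℚ.* u ℚ.+ u) (proj₂ (∫-f n) t₁)))
          (proj₁ (∫-f n) t₀))
          (identity κℚ qℚ ((κℚ ℚ.* qℚ) ^ n) (signℚ² κ)))
      where
      t₀ : G.IsTest (f n)
      t₀ = proj₁ (isTest-f n)
      t₁ : G.IsTest (f (suc n))
      t₁ = proj₂ (isTest-f n)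
      identity : ∀ k q P → k ℚ.* k ≡ 1ℚ → k ℚ.* (q ℚ.* ((k ℚ.* q) ℚ.* P) ℚ.+ (k ℚ.* q) ℚ.* P) ℚ.+
        (ℚ.- q) ℚ.* P ≡ (k ℚ.* q) ℚ.* ((k ℚ.* q) ℚ.* P)
      identity k q P e = QL.combine₁ (q ℚ.* P) e (Q.solve 3 (λ k q P →
        (k Q.:* (q Q.:* ((k Q.:* q) Q.:* P) Q.:+ (k Q.:* q) Q.:* P) Q.:+ (Q.:- q) Q.:* P) Q.:-
          (k Q.:* q) Q.:* ((k Q.:* q) Q.:* P)
        Q.:= (q Q.:* P) Q.:* (k Q.:* k Q.:- Q.:1)) ≡.refl k q P)

-- Orbital integrals, transfer factors and the scalar elements

module Evaluation (lem : ExcludedMiddle 0ℓ) (F : LocalField) (E : QuadraticAlgebra F)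
                (τ : QuadraticAlgebra.Carrier E) (gen : QuadraticAlgebra.IsIntegralGenerator E τ)
                (unr : QuadraticAlgebra.Unramified E)
                (ε : LocalField.Fˣ F → Sign) (isNormCharacter : QuadraticAlgebra.IsNormCharacter E
                  ε)
                (M : Endoscopy.Measures lem F E τ) where
  open LocalField F hiding (zero)
  open IntegerCoefficients commRing
  open LinearCombination commRing
  open Valuation lem F
  open Topology lem F
  open Counting lem
  open Basis lem F E τ gen
  open Arithmetic unr
  open Character ε isNormCharacter
  open Endoscopy lem F E τ renaming (T to Torus)
  open Lattices lem F E τ gen unr
  open Factorizations lem F E τ gen unr ε isNormCharacter
  open BaseCase lem F E τ gen unr ε isNormCharacter M
  open Recursion lem F E τ gen unr ε isNormCharacter M
  open Measures M
  open Rational using (fromℕ; ≤-fromℕ; fromℕ≤^; 2≤fromℕ; _^_; ^-distrib-*; 1^n≡1; square-injective)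
  private
    module E = QuadraticAlgebra E
    module Nb = Neighbours lem F T N 𝔒T 𝔒N
    module Q = IntegerCoefficients ℚ.+-*-commutativeRing

  abstract
    -- Trace and determinant survive conjugation, so t satisfies X² - (2a + T b) X + 1 with integral
    -- coefficients. The other two conditions are the off-diagonal entries b r and b s.
    conjugate-integral : ∀ x (t : Torus) → SL₂⟨𝔒⟩ (conjugate x (proj₁ t)) →
      T⟨𝔒⟩ t × 𝔒 (entryᶜ t * r x) × 𝔒 (entryᶜ t * s x)
    conjugate-integral x t o = integral⇒T⟨𝔒⟩ t integral-element , proj₁ (proj₂ entries) ,
      proj₁ (proj₂ (proj₂ entries))
      where
      a b trace-t : Carrier
      a = entryᵃ t
      b = entryᶜ t
      trace-t = a + a + T * b
      entries : Integral (mat (a + b * p x) (b * r x) (b * s x) (a + b * p′ x))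
      entries = integral-resp (conjugate-entries x (torus≈ t)) o
      𝔒trace : 𝔒 trace-t
      𝔒trace = 𝔒-resp (combine₁ b (trace x) (solve 5 (λ a b p p′ T →
          ((a :+ b :* p) :+ (a :+ b :* p′)) :- (a :+ a :+ T :* b) := b :* (p :+ p′ :- T)) refl a b
            (p x) (p′ x) T))
        (𝔒-+ (proj₁ entries) (proj₂ (proj₂ (proj₂ entries))))
      integral-pair : E.evalMonic (1# ∷ - trace-t ∷ []) (pair a b) E.≈ E.0#
      integral-pair = E.trans (E.+-cong (E.sym (pair-scalar 1#)) (E.trans (E.*-congˡ
            (E.trans (E.+-cong (E.sym (pair-scalar (- trace-t))) (E.*-identityʳ (pair a b)))
              (pair-+ (- trace-t) 0# a b))) (pair-* a b (- trace-t + a) (0# + b))))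
        (E.trans (pair-+ 1# 0# _ _) (E.trans (pair-cong
          (combine₁ (- 1#) (norm-torus t)
            (solve 4 (λ a b T N → (:1 :+ (a :* ((:- (a :+ a :+ T :* b)) :+ a) :- N
            :* (b :* (:0 :+ b)))) :- :0
            := (:- :1) :* (:norm T N a b :- :1)) refl a b T N))
          (solve 3 (λ a b T → :0 :+ (a :* (:0 :+ b) :+ b :* ((:- (a :+ a :+ T :* b)) :+ a) :+ T
            :* (b :* (:0 :+ b))) := :0) refl a b T))
          (E.trans (pair-scalar 0#) ι-0)))
      integral-element : E.𝔒ᴱ (element t)
      integral-element = 𝔒ᴱ-resp (element≈ t) (1# ∷ - trace-t ∷ [] , 𝔒1 ∷ 𝔒-neg 𝔒trace ∷ [] ,
        integral-pair)

    integral-conjugate : ∀ x (t : Torus) → T⟨𝔒⟩ t → 𝔒 (entryᶜ t * r x) → 𝔒 (entryᶜ t * s x) →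
      SL₂⟨𝔒⟩ (conjugate x (proj₁ t))
    integral-conjugate x t o 𝔒br 𝔒bs = integral-resp (≈ᴹ-sym (conjugate-entries x (torus≈ t)))
      ( 𝔒-+ (proj₁ 𝔒ab) (Nb.diagonal-integral (p x) (r x) (s x) (p′ x) (trace x) (determinant x)
        (proj₂ 𝔒ab) 𝔒br 𝔒bs) , 𝔒br , 𝔒bs
      , 𝔒-+ (proj₁ 𝔒ab) (Nb.diagonal-integral′ (p x) (r x) (s x) (p′ x) (trace x) (determinant x)
        (proj₂ 𝔒ab) 𝔒br 𝔒bs))
      where
      𝔒ab : 𝔒 (entryᵃ t) × 𝔒 (entryᶜ t)
      𝔒ab = T⟨𝔒⟩⇒entries t o

    square-one-sign : ∀ {a} → a * a ≈ 1# → (a ≈ 1#) ⊎ (a ≈ - 1#)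
    square-one-sign {a} e = by-factor (integral-domain (combine₁ 1# e (solve 1 (λ a →
        (a :- :1) :* (a :- (:- :1)) :- :0 := :1 :* (a :* a :- :1)) refl a)))
      where
      by-factor : (a - 1# ≈ 0#) ⊎ (a - (- 1#) ≈ 0#) → (a ≈ 1#) ⊎ (a ≈ - 1#)
      by-factor (inj₁ z) = inj₁ (zero-difference z)
      by-factor (inj₂ z) = inj₂ (zero-difference z)

    scalar-multiplication : ∀ {a b c} → a ≈ c → b ≈ 0# → multiplication a b ≈ᴹ scalar c
    scalar-multiplication {a} {b} {c} a≈c b≈0 = a≈c ,
      trans (-‿cong (*-congˡ b≈0)) (solve 1 (λ N → :- (N :* :0) := :0) refl N) , b≈0 ,
      trans (+-cong a≈c (*-congˡ b≈0)) (solve 2 (λ c T → c :+ T :* :0 := c) refl c T)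

    regular⇒b≉0 : (t : Torus) → Regular t → ¬ (entryᶜ t ≈ 0#)
    regular⇒b≉0 t (not-1 , not--1) b≈0 = by-sign (square-one-sign a²≈1)
      where
      a²≈1 : entryᵃ t * entryᵃ t ≈ 1#
      a²≈1 = trans (trans (solve 3 (λ a T N → a :* a := :norm T N a :0) refl (entryᵃ t) T N)
        (norm-cong refl (sym b≈0))) (norm-torus t)
      by-sign : (entryᵃ t ≈ 1#) ⊎ (entryᵃ t ≈ - 1#) → ⊥
      by-sign (inj₁ e) = not-1 (≈ᴹ-trans (torus≈ t) (scalar-multiplication e b≈0))
      by-sign (inj₂ e) = not--1 (≈ᴹ-trans (torus≈ t) (scalar-multiplication e b≈0))

    ∣discriminant∣ : ∣ discriminant ∣ ≡ 1ℚ
    ∣discriminant∣ = ℚ.≤-antisym (𝔒-- (𝔒-* 𝔒T 𝔒T) (𝔒-+ (𝔒-+ (𝔒-+ 𝔒N 𝔒N) 𝔒N) 𝔒N))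
      (ℚ.≮⇒≥ discriminant-unit)

    element-difference : (t : Torus) → element t E.- E.conj (element t) E.≈ pair (- (T * entryᶜ t))
      (entryᶜ t + entryᶜ t)
    element-difference t = E.trans
      (E.+-cong (E.sym (element≈ t))
      (E.-‿cong (E.trans (conj-cong (E.sym (element≈ t))) (conj-pair′ (entryᵃ t) (entryᶜ t)))))
      (E.trans (pair-sub _ _ _ _)
        (pair-cong (solve 3 (λ a b T → a :- (a :+ T :* b) := :- (T :* b)) refl (entryᵃ t) (entryᶜ t)
        T)
        (solve 1 (λ b → b :- (:- b) := b :+ b) refl (entryᶜ t))))

    τ-difference : τ E.- E.conj τ E.≈ pair (- T) (1# + 1#)
    τ-difference = E.trans (E.+-cong (E.sym pair-τ)
      (E.-‿cong (E.trans (conj-cong (E.sym pair-τ)) (conj-pair′ 0# 1#))))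
      (E.trans (pair-sub _ _ _ _) (pair-cong (solve 1 (λ T → :0 :- (:0 :+ T :* :1) := :- T) refl T)
        (solve 0 (:1 :- (:- :1) := :1 :+ :1) refl)))

    difference-norm : ∀ b → norm (- (T * b)) (b + b) ≈ - (b * b * discriminant)
    difference-norm b = solve 3 (λ b T N → :norm T N (:- (T :* b)) (b :+ b)
      := :- (b :* b :* (T :* T :- (N :+ N :+ N :+ N)))) refl b T N

    element-difference-norm : (t : Torus) → E.ι (- (entryᶜ t * entryᶜ t * discriminant)) E.≈
      (element t E.- E.conj (element t)) E.* E.conj (element t E.- E.conj (element t))
    element-difference-norm t = E.trans (ι-cong (sym (difference-norm (entryᶜ t))))
      (E.trans (E.sym (pair-norm _ _))
      (E.*-cong (E.sym (element-difference t)) (conj-cong (E.sym (element-difference t)))))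

    difference-abs : ∀ b → ∣ b ∣ ℚ.* ∣ b ∣ ≡ ∣ - (b * b * discriminant) ∣
    difference-abs b = ≡.sym (≡.trans (∣-x∣ _) (≡.trans (∣∣-mult (b * b) discriminant)
      (≡.trans (≡.cong₂ ℚ._*_ (∣∣-mult b b) ∣discriminant∣) (ℚ.*-identityʳ (∣ b ∣ ℚ.* ∣ b ∣)))))

  bˣ : (t : Torus) → Regular t → Fˣ
  bˣ t reg = entryᶜ t , regular⇒b≉0 t reg

  abstract
    -- γ - γ̄ = b (τ - τ̄), so c is b. The norm of γ - γ̄ is - b² (T² - 4N), of absolute value ∣b∣²
    -- as the discriminant is a unit.
    transferFactor : ∀ t (reg : Regular t) →
      TransferFactor ε t (signℚ (ε (bˣ t reg)) ℚ.* ∣ entryᶜ t ∣)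
    transferFactor t reg = bˣ t reg , ∣ b ∣ ,
      E.trans (E.*-congˡ τ-difference) (E.trans (pair-scale b _ _) (E.trans (pair-cong
        (solve 2 (λ b T → b :* (:- T) := :- (T :* b)) refl b T)
          (solve 1 (λ b → b :* (:1 :+ :1) := b :+ b) refl b))
        (E.sym (element-difference t)))) ,
      (∣∣-nonneg b , - (b * b * discriminant) , element-difference-norm t , difference-abs b) ,
        ≡.refl
      where
      b : Carrier
      b = entryᶜ t

    transferFactor-unique : ∀ t (reg : Regular t) d → TransferFactor ε t d → d ≡
      signℚ (ε (bˣ t reg)) ℚ.* ∣ entryᶜ t ∣
    transferFactor-unique t reg d (c , ρ , c≈ , (0≤ρ , a′ , hasNorm , ρ²) , d≡) =
      ≡.trans d≡ (≡.cong₂ ℚ._*_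
        (≡.cong signℚ (E.IsNormCharacter.cong isNormCharacter c (bˣ t reg) c≈b))
        (square-injective 0≤ρ (∣∣-nonneg b)
          (≡.trans ρ² (≡.trans (∣∣-cong
          (ι-injective (E.trans hasNorm (E.sym (element-difference-norm t)))))
          (≡.sym (difference-abs b))))))
      where
      b : Carrier
      b = entryᶜ t
      coordinates : (proj₁ c * - T ≈ - (T * b)) × (proj₁ c * (1# + 1#) ≈ b + b)
      coordinates = pair-injective (E.trans (E.sym (pair-scale (proj₁ c) (- T) (1# + 1#)))
        (E.trans (E.*-congˡ (E.sym τ-difference)) (E.trans c≈ (element-difference t))))
      c≈b : proj₁ c ≈ b
      -- The coordinates - T and 2 of τ - τ̄ may each vanish, according to the characteristic. Their
      -- combination (- T)(- T) - 2N · 2 is the discriminant, which can always be cancelled.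
      c≈b = *-cancel discriminant (¬𝔪⇒≉0 discriminant-unit)
        (combine₂ (- T) (- (N + N)) (proj₁ coordinates) (proj₂ coordinates) (solve 4 (λ c b T N →
        (T :* T :- (N :+ N :+ N :+ N)) :* c :- (T :* T :- (N :+ N :+ N :+ N)) :* b
        := (:- T) :* (c :* (:- T) :- (:- (T :* b))) :+ (:- (N :+ N))
          :* (c :* (:1 :+ :1) :- (b :+ b))) refl (proj₁ c) b T N))

    -- Units are norms, so only the power of ϖ contributes to the sign.
    ε-valuation : ∀ n {u} (x : Fˣ) → 𝔒 u → ¬ 𝔪 u → proj₁ x ≈ ϖ^ n * u → signℚ (ε x) ≡ κℚ ^ n
    ε-valuation zero {u} x 𝔒u ¬𝔪u e =
      ≡.cong signℚ (ε-norm x (let (a , b , _ , _ , n≈) = unit-norm u 𝔒u ¬𝔪u in a , b ,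
      trans n≈ (sym (trans e (*-identityˡ u)))))
    ε-valuation (suc n) {u} x 𝔒u ¬𝔪u e =
      ≡.trans (≡.cong signℚ (≡.trans (N.cong x (ϖˣ *ˣ y) (trans e (*-assoc ϖ (ϖ^ n) u)))
      (N.homo ϖˣ y)))
      (≡.trans (signℚ-* κ (ε y)) (≡.cong (κℚ ℚ.*_) (ε-valuation n y 𝔒u ¬𝔪u refl)))
      where
      module N = E.IsNormCharacter isNormCharacter
      y : Fˣ
      y = ϖ^ n * u , *-nonzero (ϖ^ n) u (ϖ^≉0 n) (¬𝔪⇒≉0 ¬𝔪u)

  integrand : Torus → GL₂ → ℚ
  integrand t x = signℚ (ε (detᴳ x)) ℚ.* indicator lem SL₂⟨𝔒⟩ (conjugate x (proj₁ t))

  open Measure μ-T̃\GL₂ using (∫)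
  open G.Integration μ-T̃\GL₂

  Evaluation : Torus → Set₁
  Evaluation t = Σ ℚ λ v → OrbitalIntegral M ε t (indicator lem SL₂⟨𝔒⟩) v ×
    (∀ reg → (signℚ (ε (bˣ t reg)) ℚ.* ∣ entryᶜ t ∣) ℚ.* v ≡ indicator lem T⟨𝔒⟩ t)

  abstract
    unit-abs : ∀ {u} → 𝔒 u → ¬ 𝔪 u → ∣ u ∣ ≡ 1ℚ
    unit-abs 𝔒u ¬𝔪u = ℚ.≤-antisym 𝔒u (ℚ.≮⇒≥ ¬𝔪u)

    -- The off-diagonal entries of the conjugate are b r and b s, and b differs from ϖⁿ by a unit;
    -- the diagonal entries follow.
    integrand-f : ∀ t n {u} → T⟨𝔒⟩ t → 𝔒 u → ¬ 𝔪 u → entryᶜ t ≈ ϖ^ n * u → ∀ x → f n x ≡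
      integrand t x
    integrand-f t n {u} o 𝔒u ¬𝔪u e x = ≡.cong (sgn x ℚ.*_) (⟦⟧-cong
        (λ (a , b) → integral-conjugate x t o (multiply a) (multiply b))
        (λ i → let (_ , a , b) = conjugate-integral x t i in divide a , divide b))
      where
      multiply : ∀ {y} → 𝔒 (ϖ^ n * y) → 𝔒 (entryᶜ t * y)
      multiply {y} a = 𝔒-resp (trans (solve 3 (λ u c y → u :* (c :* y) := (c :* u) :* y) refl u
        (ϖ^ n) y) (*-congʳ (sym e))) (𝔒-* 𝔒u a)
      divide : ∀ {y} → 𝔒 (entryᶜ t * y) → 𝔒 (ϖ^ n * y)
      divide {y} a = let (w , 𝔒w , uw≈1) = unit-inverse ¬𝔪u in
        𝔒-resp (trans (*-congˡ (*-congʳ e)) (combine₁ (ϖ^ n * y) uw≈1 (solve 4 (λ w c u y →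
          w :* ((c :* u) :* y) :- c :* y := (c :* y) :* (u :* w :- :1)) refl w (ϖ^ n) u y)))
            (𝔒-* 𝔒w a)

    evaluate : ∀ t → Regular t → Evaluation t
    evaluate t reg = by-case (decide (T⟨𝔒⟩ t))
      where
      b : Carrier
      b = entryᶜ t

      by-case : Dec (T⟨𝔒⟩ t) → Evaluation t
      by-case (no ¬o) = 0ℚ , (proj₁ zero-test , proj₂ zero-test ,
        ∫-zero (G.toTest zero-test) (λ x → ≡.sym (vanishing x))) ,
        λ reg → ≡.trans (ℚ.*-zeroʳ (signℚ (ε (bˣ t reg)) ℚ.* ∣ b ∣)) (≡.sym (⟦⟧-false ¬o))
        where
        vanishing : ∀ x → 0ℚ ≡ integrand t x
        vanishing x = ≡.sym (≡.trans
          (≡.cong (sgn x ℚ.*_) (⟦⟧-false (λ i → ¬o (proj₁ (conjugate-integral x t i)))))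
          (ℚ.*-zeroʳ (sgn x)))
        zero-test : G.IsTest (integrand t)
        zero-test = G.isTest-cong vanishing G.isTest-zero
      by-case (yes o) = by-valuation (valuation b (proj₂ (T⟨𝔒⟩⇒entries t o)) (regular⇒b≉0 t reg))
        where
        by-valuation : HasValuation b → Evaluation t
        by-valuation (n , u , 𝔒u , ¬𝔪u , e) = (κℚ ℚ.* qℚ) ^ n ,
            (proj₁ t-test , proj₂ t-test ,
              ≡.trans (∫-cong (G.toTest t-test) (G.toTest (proj₁ (isTest-f n)))
              (λ x → ≡.sym (integrand-f t n o 𝔒u ¬𝔪u e x))) (proj₁ (∫-f n) (proj₁ (isTest-f n)))) ,
            λ reg → ≡.trans (≡.cong₂ (λ g c → (g ℚ.* c) ℚ.* (κℚ ℚ.* qℚ) ^ n)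
              (ε-valuation n (bˣ t reg) 𝔒u ¬𝔪u e) ∣b∣)
              (≡.trans cancellation (≡.sym (⟦⟧-true o)))
          where
          t-test : G.IsTest (integrand t)
          t-test = G.isTest-cong (integrand-f t n o 𝔒u ¬𝔪u e) (proj₁ (isTest-f n))
          ∣b∣ : ∣ b ∣ ≡ ∣ ϖ^ n ∣
          ∣b∣ = ≡.trans (∣∣-cong e) (≡.trans (∣∣-mult (ϖ^ n) u)
            (≡.trans (≡.cong (∣ ϖ^ n ∣ ℚ.*_) (unit-abs 𝔒u ¬𝔪u)) (ℚ.*-identityʳ ∣ ϖ^ n ∣)))
          cancellation : (κℚ ^ n ℚ.* ∣ ϖ^ n ∣) ℚ.* (κℚ ℚ.* qℚ) ^ n ≡ 1ℚ
          cancellation = ≡.trans (≡.cong ((κℚ ^ n ℚ.* ∣ ϖ^ n ∣) ℚ.*_) (^-distrib-* κℚ qℚ n))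
            (≡.trans (regroup (κℚ ^ n) ∣ ϖ^ n ∣ (qℚ ^ n))
            (≡.cong₂ ℚ._*_ (≡.trans (≡.sym (^-distrib-* κℚ κℚ n))
              (≡.trans (≡.cong (_^ n) (signℚ² κ)) (1^n≡1 n))) (∣ϖ^∣-normalized n)))
            where
            regroup : ∀ a b c → (a ℚ.* b) ℚ.* (a ℚ.* c) ≡ (a ℚ.* a) ℚ.* (b ℚ.* c)
            regroup = Q.solve 3 (λ a b c → (a Q.:* b) Q.:* (a Q.:* c)
              Q.:= (a Q.:* a) Q.:* (b Q.:* c)) ≡.refl

    -- `IsTransfer` provides some d and v; both are determined by t, so their product is the one
    -- already computed.
    evaluation-unique : ∀ t (reg : Regular t) d v → TransferFactor ε t d → OrbitalIntegral M ε t
      (indicator lem SL₂⟨𝔒⟩) v → d ℚ.* v ≡ indicator lem T⟨𝔒⟩ t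
    evaluation-unique t reg d v factor (l , c , ∫≡v) = finish (evaluate t reg)
      where
      finish : Evaluation t → d ℚ.* v ≡ indicator lem T⟨𝔒⟩ t
      finish (v₀ , (l₀ , c₀ , ∫≡v₀) , value) =
        ≡.trans (≡.cong₂ ℚ._*_ (transferFactor-unique t reg d factor)
        (≡.trans (≡.sym ∫≡v) (≡.trans (∫-cong (test (integrand t) l c) (test (integrand t) l₀ c₀)
          (λ _ → ≡.refl)) ∫≡v₀))) (value reg)

    small-power : ∀ δ → 0ℚ ℚ.< δ → ∃ λ n → ∣ ϖ^ n ∣ ℚ.≤ δ
    small-power δ 0<δ = bound (≤-fromℕ (ℚ.1/ δ))
      where
      instance
        δ≢0 : ℚ.NonZero δ
        δ≢0 = ℚ.≢-nonZero (λ e → ℚ.<-irrefl (≡.sym e) 0<δ)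
      bound : (∃ λ n → ℚ.1/ δ ℚ.≤ fromℕ n) → ∃ λ n → ∣ ϖ^ n ∣ ℚ.≤ δ
      bound (n , le) = n , ≡.subst₂ ℚ._≤_
        (≡.trans (regroup δ ∣ ϖ^ n ∣ (ℚ.1/ δ)) (≡.trans (≡.cong (∣ ϖ^ n ∣ ℚ.*_) (ℚ.*-inverseʳ δ))
          (ℚ.*-identityʳ ∣ ϖ^ n ∣)))
        (≡.trans (≡.cong (δ ℚ.*_) (∣ϖ^∣-normalized n)) (ℚ.*-identityʳ δ))
        (ℚ.*-monoˡ-≤-nonNeg δ {{ℚ.nonNegative (ℚ.<⇒≤ 0<δ)}}
          (ℚ.*-monoˡ-≤-nonNeg ∣ ϖ^ n ∣ {{ℚ.nonNegative (∣∣-nonneg (ϖ^ n))}}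
          (ℚ.≤-trans le (proj₁ (fromℕ≤^ (2≤fromℕ q 2≤q) n)))))
        where
        regroup : ∀ a b c → a ℚ.* (b ℚ.* c) ≡ b ℚ.* (a ℚ.* c)
        regroup = Q.solve 3 (λ a b c → a Q.:* (b Q.:* c) Q.:= b Q.:* (a Q.:* c)) ≡.refl

  Approximation : ℚ → Carrier → Set
  Approximation δ a = Σ Torus λ t → Close δ (scalar a) (proj₁ (proj₁ t)) × T⟨𝔒⟩ t × Regular t

  abstract
    -- The approximating element is a z / z̄ with z = 1 + e τ.
    approximate-by : ∀ {δ a e} → a * a ≈ 1# → 𝔪 e → ∣ e ∣ ℚ.< δ → ¬ (e ≈ 0#) →
      ¬ (1# + 1# + T * e ≈ 0#) → Approximation δ a
    approximate-by {δ} {a} {e} a²≈1 𝔪e e<δ e≉0 2+Te≉0 = use (unit-inverse norm-unit)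
      where
      𝔒e : 𝔒 e
      𝔒e = 𝔪⇒𝔒 𝔪e
      𝔒a : 𝔒 a
      𝔒a = ℚ.≤-reflexive (square-one a a²≈1)
      norm-unit : ¬ 𝔪 (norm 1# e)
      norm-unit m = ¬𝔪1 (𝔪-resp (solve 3 (λ e T N → :norm T N :1 e :- (T :* e :+ N :* e :* e) := :1)
        refl e T N)
        (𝔪-- m (𝔪-+ (𝔪-*ʳ 𝔒T 𝔪e) (𝔪-*ʳ (𝔒-* 𝔒N 𝔒e) 𝔪e))))

      use : (∃ λ w → 𝔒 w × (norm 1# e * w ≈ 1#)) → Approximation δ a
      use (w , 𝔒w , nw≈1) = torus a′ b′ norm≈1 , close , entries⇒T⟨𝔒⟩ (torus a′ b′ norm≈1) 𝔒a′ 𝔒b′ ,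
          ((λ (_ , _ , b′≈0 , _) → b′≉0 b′≈0) , (λ (_ , _ , b′≈0 , _) → b′≉0 b′≈0))
        where
        -- z / z̄ = z² / N(z), where w is the inverse of N(z) and the brackets are the coordinates
        -- of z².
        a′ b′ : Carrier
        a′ = (a * w) * (1# * 1# - N * (e * e))
        b′ = (a * w) * (1# * e + e * 1# + T * (e * e))

        norm≈1 : norm a′ b′ ≈ 1#
        norm≈1 = trans (norm-scale (a * w) _ _) (trans (*-congˡ (sym (norm-* 1# e 1# e)))
          (combine₂ (norm 1# e * w * (norm 1# e * w)) (norm 1# e * w + 1#) a²≈1 nw≈1
            (solve 3 (λ a w n →
            (a :* w) :* (a :* w) :* (n :* n) :- :1
              := (n :* w :* (n :* w)) :* (a :* a :- :1) :+ (n :* w :+ :1) :* (n :* w :- :1)) refl a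
              w (norm 1# e))))

        𝔒a′ : 𝔒 a′
        𝔒a′ = 𝔒-* (𝔒-* 𝔒a 𝔒w) (𝔒-- (𝔒-* 𝔒1 𝔒1) (𝔒-* 𝔒N (𝔒-* 𝔒e 𝔒e)))
        𝔒b′ : 𝔒 b′
        𝔒b′ = 𝔒-* (𝔒-* 𝔒a 𝔒w) (𝔒-+ (𝔒-+ (𝔒-* 𝔒1 𝔒e) (𝔒-* 𝔒e 𝔒1)) (𝔒-* 𝔒T (𝔒-* 𝔒e 𝔒e)))

        b′≉0 : ¬ (b′ ≈ 0#)
        -- b′ = a w · e (2 + T e), which explains the two hypotheses of nonvanishing.
        b′≉0 z = *-nonzero (a * w) (e * (1# + 1# + T * e))
          (λ aw≈0 → 1≉0 (trans (sym (combine₂ (norm 1# e * w) 1# a²≈1 nw≈1 (solve 3 (λ a w n →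
              (n :* a) :* (a :* w) :- :1 := (n :* w) :* (a :* a :- :1) :+ :1 :* (n :* w :- :1)) refl
                a w (norm 1# e))))
            (trans (*-congˡ aw≈0) (zeroʳ _))))
          (*-nonzero e (1# + 1# + T * e) e≉0 2+Te≉0)
          (trans (*-congˡ (solve 2 (λ e T → e :* (:1 :+ :1 :+ T :* e)
            := :1 :* e :+ e :* :1 :+ T :* (e :* e)) refl e T)) z)

        small : ∀ {x} z → 𝔒 z → x ≈ e * z → ∣ x ∣ ℚ.< δ
        small z 𝔒z x≈ = ℚ.≤-<-trans (≡.subst₂ ℚ._≤_ (≡.sym (≡.trans (∣∣-cong x≈) (∣∣-mult e z)))
          (ℚ.*-identityʳ ∣ e ∣)
          (ℚ.*-monoˡ-≤-nonNeg ∣ e ∣ {{ℚ.nonNegative (∣∣-nonneg e)}} 𝔒z)) e<δ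

        A B : Carrier
        A = (a * w) * (T + (N + N) * e)
        B = (a * w) * (1# + 1# + T * e)
        𝔒A : 𝔒 A
        𝔒A = 𝔒-* (𝔒-* 𝔒a 𝔒w) (𝔒-+ 𝔒T (𝔒-* (𝔒-+ 𝔒N 𝔒N) 𝔒e))
        𝔒B : 𝔒 B
        𝔒B = 𝔒-* (𝔒-* 𝔒a 𝔒w) (𝔒-+ (𝔒-+ 𝔒1 𝔒1) (𝔒-* 𝔒T 𝔒e))
        a-a′ : a - a′ ≈ e * A
        a-a′ = combine₁ (- a) nw≈1 (solve 5 (λ a w e T N →
          (a :- (a :* w) :* (:1 :* :1 :- N :* (e :* e))) :- e :* ((a :* w) :* (T :+ (N :+ N) :* e))
          := (:- a) :* (:norm T N :1 e :* w :- :1)) refl a w e T N)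
        b′≈ : b′ ≈ e * B
        b′≈ = solve 4 (λ a w e T → (a :* w) :* (:1 :* e :+ e :* :1 :+ T :* (e :* e))
          := e :* ((a :* w) :* (:1 :+ :1 :+ T :* e))) refl a w e T

        close : Close δ (scalar a) (multiplication a′ b′)
        close = small A 𝔒A a-a′ ,
          small (N * B) (𝔒-* 𝔒N 𝔒B) (combine₁ N b′≈
            (solve 4 (λ N b e B → (:0 :- (:- (N :* b))) :- e :* (N :* B) := N :* (b :- e :* B)) refl
            N b′ e B)) ,
          small (- B) (𝔒-neg 𝔒B) (combine₁ (- 1#) b′≈
            (solve 3 (λ b e B → (:0 :- b) :- e :* (:- B) := (:- :1) :* (b :- e :* B)) refl b′ e
            B)) ,
          small (A - T * B) (𝔒-- 𝔒A (𝔒-* 𝔒T 𝔒B))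
            (combine₂ 1# (- T) a-a′ b′≈ (solve 7 (λ a a′ b T e A B →
            (a :- (a′ :+ T :* b)) :- e :* (A :- T :* B)
              := :1 :* ((a :- a′) :- e :* A) :+ (:- T) :* (b :- e :* B)) refl a a′ b′ T e A B))

    -- Of two candidates e and ϖ e one must work: if 2 + T e and 2 + T ϖ e were both zero, their
    -- difference would give T = 0, then 2 = 0, and the discriminant would vanish.
    approximate : ∀ δ → 0ℚ ℚ.< δ → ∀ {a} → a * a ≈ 1# → Approximation δ a
    approximate δ 0<δ {a} a²≈1 = use (small-power δ 0<δ)
      where
      use : (∃ λ n → ∣ ϖ^ n ∣ ℚ.≤ δ) → Approximation δ a
      use (n , le) = by-case (decide (1# + 1# + T * ϖ^ suc n ≈ 0#))
        where
        e<δ : ∣ ϖ^ suc n ∣ ℚ.< δ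
        e<δ = ℚ.<-≤-trans (≡.subst₂ ℚ._<_ (≡.sym (∣∣-mult ϖ (ϖ^ n))) (ℚ.*-identityˡ ∣ ϖ^ n ∣)
          (ℚ.*-monoˡ-<-pos ∣ ϖ^ n ∣ {{ℚ.positive (∣x∣>0 (ϖ^≉0 n))}} 𝔪ϖ)) le
        ϖe<δ : ∣ ϖ^ suc (suc n) ∣ ℚ.< δ
        ϖe<δ = ℚ.≤-<-trans (≡.subst₂ ℚ._≤_ (≡.sym (∣∣-mult ϖ (ϖ^ suc n)))
          (ℚ.*-identityˡ ∣ ϖ^ suc n ∣)
          (ℚ.*-monoʳ-≤-nonNeg ∣ ϖ^ suc n ∣ {{ℚ.nonNegative (∣∣-nonneg (ϖ^ suc n))}} 𝔒ϖ)) e<δ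
        by-case : Dec (1# + 1# + T * ϖ^ suc n ≈ 0#) → Approximation δ a
        by-case (no ≉0) = approximate-by a²≈1 (ϖ-𝔪 (𝔒ϖ^ n)) e<δ (ϖ^≉0 (suc n)) ≉0
        by-case (yes ≈0) = approximate-by a²≈1 (ϖ-𝔪 (𝔒ϖ^ (suc n))) ϖe<δ (ϖ^≉0 (suc (suc n)))
          (λ ≈0′ → ¬𝔪⇒≉0 discriminant-unit (vanish ≈0′))
          where
          vanish : 1# + 1# + T * ϖ^ suc (suc n) ≈ 0# → discriminant ≈ 0#
          vanish ≈0′ = trans (combine₂ T (- (N + N)) T≈0 2≈0
            (solve 2 (λ T N → (T :* T :- (N :+ N :+ N :+ N)) :- :0
              := T :* (T :- :0) :+ (:- (N :+ N)) :* ((:1 :+ :1) :- :0)) refl T N)) refl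
            where
            1-ϖ≉0 : ¬ (1# - ϖ ≈ 0#)
            1-ϖ≉0 z = ¬𝔪1 (𝔪-resp (sym (zero-difference z)) 𝔪ϖ)
            T≈0 : T ≈ 0#
            T≈0 = *-cancel (ϖ^ suc n * (1# - ϖ))
              (*-nonzero (ϖ^ suc n) (1# - ϖ) (ϖ^≉0 (suc n)) 1-ϖ≉0)
              (combine₂ 1# (- 1#) ≈0 ≈0′
                (solve 3 (λ T ϖ e → (e :* (:1 :- ϖ)) :* T :- (e :* (:1 :- ϖ)) :* :0
                := :1 :* ((:1 :+ :1 :+ T :* e) :- :0) :+ (:- :1)
                  :* ((:1 :+ :1 :+ T :* (ϖ :* e)) :- :0)) refl T ϖ (ϖ^ suc n)))
            2≈0 : 1# + 1# ≈ 0#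
            2≈0 = trans (solve 1 (λ e → :1 :+ :1 := :1 :+ :1 :+ :0 :* e) refl (ϖ^ suc n))
              (trans (+-congˡ (*-congʳ (sym T≈0))) ≈0)

    irregular-scalar : (t : Torus) → ¬ Regular t → ∃ λ a →
      (a * a ≈ 1#) × (proj₁ (proj₁ t) ≈ᴹ scalar a)
    irregular-scalar t irregular = by-case (decide (proj₁ (proj₁ t) ≈ᴹ scalar 1#))
      where
      by-case : Dec (proj₁ (proj₁ t) ≈ᴹ scalar 1#) → ∃ λ a →
        (a * a ≈ 1#) × (proj₁ (proj₁ t) ≈ᴹ scalar a)
      by-case (yes e) = 1# , *-identityˡ 1# , e
      by-case (no ≉1) = - 1# , solve 0 ((:- :1) :* (:- :1) := :1) refl ,
        stable (λ ≉-1 → irregular (≉1 , ≉-1))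

  transfer⇒indicator : ∀ fᴱ → IsTransfer M ε ε (indicator lem SL₂⟨𝔒⟩) fᴱ → ∀ t → fᴱ t ≡
    indicator lem T⟨𝔒⟩ t
  transfer⇒indicator fᴱ transfer t = by-case (decide (Regular t))
    where
    open IsTransfer transfer
    at-regular : ∀ t → Regular t → fᴱ t ≡ indicator lem T⟨𝔒⟩ t
    at-regular t reg = let (d , v , factor , integral , fᴱ≡) = regular t reg in ≡.trans fᴱ≡
      (evaluation-unique t reg d v factor integral)

    at-scalar : (∃ λ a → (a * a ≈ 1#) × (proj₁ (proj₁ t) ≈ᴹ scalar a)) → fᴱ t ≡ indicator lem T⟨𝔒⟩ t
    at-scalar (a , a²≈1 , t≈) =
      let (U , open-U , Ut , const) = smooth t
          (δ , 0<δ , u) = open-U t Ut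
          (t′ , close , t′∈ , reg) = approximate δ 0<δ a²≈1
      in ≡.trans (≡.sym (const t′ (u t′ (close-resp t′ close))))
        (≡.trans (at-regular t′ reg) (≡.trans (⟦⟧-true t′∈) (≡.sym (⟦⟧-true t∈))))
      where
      𝔒a : 𝔒 a
      𝔒a = ℚ.≤-reflexive (square-one a a²≈1)
      t∈ : T⟨𝔒⟩ t
      t∈ = let (e₁₁ , _ , e₂₁ , _) = t≈ in entries⇒T⟨𝔒⟩ t (𝔒-resp (sym e₁₁) 𝔒a)
        (𝔒-resp (sym e₂₁) 𝔒0)
      close-resp : ∀ {δ} t′ → Close δ (scalar a) (proj₁ (proj₁ t′)) → Close δ (proj₁ (proj₁ t))
        (proj₁ (proj₁ t′))
      close-resp {δ} t′ (c₁₁ , c₁₂ , c₂₁ , c₂₂) = let (e₁₁ , e₁₂ , e₂₁ , e₂₂) =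
                                                        t≈ in shift e₁₁ c₁₁ , shift e₁₂ c₁₂ ,
                                                        shift e₂₁ c₂₁ , shift e₂₂ c₂₂
        where
        shift : ∀ {x y z} → x ≈ y → ∣ y - z ∣ ℚ.< δ → ∣ x - z ∣ ℚ.< δ
        shift e = ≡.subst (ℚ._< δ) (∣∣-cong (+-congʳ (sym e)))

    by-case : Dec (Regular t) → fᴱ t ≡ indicator lem T⟨𝔒⟩ t
    by-case (yes reg) = at-regular t reg
    by-case (no irregular) = at-scalar (irregular-scalar t irregular)

  indicator⇒transfer : ∀ fᴱ → (∀ t → fᴱ t ≡ indicator lem T⟨𝔒⟩ t) →
    IsTransfer M ε ε (indicator lem SL₂⟨𝔒⟩) fᴱ
  indicator⇒transfer fᴱ fᴱ≡ = record
    -- Local constancy of the indicator of T(𝔒) is part of `vol-T`.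
    { smooth  = proj₁ (T-test.isTest-cong (λ t → ≡.sym (fᴱ≡ t)) (proj₁ vol-T , proj₁ (proj₂ vol-T)))
    ; regular = λ t reg → let (v , integral , value) = evaluate t reg in
        signℚ (ε (bˣ t reg)) ℚ.* ∣ entryᶜ t ∣ , v , transferFactor t reg , integral ,
          ≡.trans (fᴱ≡ t) (≡.sym (value reg))
    }

mainTheorem2 : (lem : ExcludedMiddle 0ℓ) (F : LocalField) (E : QuadraticAlgebra F) →
    QuadraticAlgebra.Unramified E →
    (τ : QuadraticAlgebra.Carrier E) → QuadraticAlgebra.IsIntegralGenerator E τ →
    (ε : LocalField.Fˣ F → Sign) → QuadraticAlgebra.IsNormCharacter E ε →
    let open Endoscopy lem F E τ in
    (M : Measures) (fᴱ : T → ℚ) →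
    IsTransfer M ε ε (indicator lem SL₂⟨𝔒⟩) fᴱ ⇔ (∀ t → fᴱ t ≡ indicator lem T⟨𝔒⟩ t)
mainTheorem2 lem F E unr τ gen ε isNormCharacter M fᴱ = mk⇔ (transfer⇒indicator fᴱ)
  (indicator⇒transfer fᴱ)
  where open Evaluation lem F E τ gen unr ε isNormCharacter M
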